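{- Let $\Sigma\in\mathcal{G}_n$ and let $Q_0$ be the unique regular rational orthogonal matrix with $Q_0^{\rm T}S(\Sigma)Q_0=S(\Sigma^{\rm T})$. If $Q_0$ is not factorable, then $\Sigma$ is weakly determined by its generalized skew-spectrum (WDGSS).
   Context: An oriented graph $\Sigma$ on vertices $v_1,\dots,v_n$ is a simple graph with each edge given a direction. Its skew-adjacency matrix $S(\Sigma)=(s_{ij})$ has $s_{ij}=1$ if $(v_i,v_j)$ is an arc, $s_{ij}=-1$ if $(v_j,v_i)$ is an arc, and $0$ otherwise. The converse $\Sigma^{\rm T}$ is obtained by reversing every arc, so $S(\Sigma^{\rm T})=-S(\Sigma)$. Oriented graphs $\Sigma,\Delta$ are isomorphic if $P^{\rm T}S(\Sigma)P=S(\Delta)$ for some permutation matrix $P$; they are generalized cospectral if $S(\Sigma)$, $S(\Delta)$ have the same spectrum and $J-I-S(\Sigma)$, $J-I-S(\Delta)$ have the same spectrum ($J$ all-one). $\Sigma$ is WDGSS if every oriented graph generalized cospectral with $\Sigma$ is isomorphic to $\Sigma$ or to $\Sigma^{\rm T}$. The skew-walk matrix is $W(\Sigma)=[e,Se,\dots,S^{n-1}e]$ with $S=S(\Sigma)$, $e$ the all-one vector. $\mathcal{G}_n$ is the set of $n$-vertex oriented graphs $\Sigma$ such that $2^{ -\lfloor n/2\rfloor}\det W(\Sigma)$ is an odd square-free integer. A rational orthogonal matrix $Q$ is regular if $Qe=e$; its level is the smallest positive integer $k$ with $kQ$ integral. A regular rational orthogonal matrix $Q$ of level $\ell$ is factorable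 if $Q=Q_1Q_2$ for regular rational orthogonal matrices $Q_1,Q_2$ of levels smaller than $\ell$, neither of which is a permutation matrix. For $\Sigma$ with $\det W(\Sigma)\ne0$ there is a unique regular rational orthogonal $Q_0$ with $Q_0^{\rm T}S(\Sigma)Q_0=S(\Sigma^{\rm T})$. -}

module Defs where

open import Data.Bool using (Bool; true; false; if_then_else_)
open import Data.Nat as ℕ using (ℕ; zero; suc; _<_)
open import Data.Nat.Divisibility using (_∣_)
open import Data.Nat.DivMod using (_/_)
open import Data.Fin using (Fin; zero; suc; toℕ; punchIn; _≟_)
open import Data.Integer as ℤ using (ℤ; +_; -[1+_]; ∣_∣)
open import Data.Rational as ℚ using (ℚ; 0ℚ; 1ℚ; ↧ₙ_)
open import Data.Product using (Σ; _×_; _,_; ∃)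
open import Data.Sum using (_⊎_)
open import Function.Bundles using (_↔_; Inverse)
open import Relation.Binary.PropositionalEquality using (_≡_)
open import Relation.Nullary using (¬_; does)

Mat : Set → ℕ → Set
Mat A n = Fin n → Fin n → A

sumℤ : ∀ {n} → (Fin n → ℤ) → ℤ
sumℤ {zero}  f = + 0
sumℤ {suc n} f = f zero ℤ.+ sumℤ (λ i → f (suc i))

sumℚ : ∀ {n} → (Fin n → ℚ) → ℚ
sumℚ {zero}  f = 0ℚ
sumℚ {suc n} f = f zero ℚ.+ sumℚ (λ i → f (suc i))

sgn : ℕ → ℤ
sgn zero          = + 1
sgn (suc zero)    = -[1+ 0 ]
sgn (suc (suc k)) = sgn k

det : ∀ {n} → Mat ℤ n → ℤ
det {zero}  M = + 1
det {suc n} M =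
  sumℤ (λ i → sgn (toℕ i) ℤ.* M i zero ℤ.* det (λ a b → M (punchIn i a) (suc b)))

δℤ : ∀ {n} → Fin n → Fin n → ℤ
δℤ i j = if does (i ≟ j) then + 1 else + 0

charPoly : ∀ {n} → Mat ℤ n → ℤ → ℤ
charPoly M x = det (λ i j → x ℤ.* δℤ i j ℤ.- M i j)

-- Two integer matrices have the same spectrum: equal characteristic polynomials
-- (a polynomial over ℤ is determined by its values on ℤ).
SameSpectrum : ∀ {n} → Mat ℤ n → Mat ℤ n → Set
SameSpectrum A B = ∀ x → charPoly A x ≡ charPoly B x

record OrientedGraph (n : ℕ) : Set where
  field
    arc    : Fin n → Fin n → Bool
    irrefl : ∀ i → arc i i ≡ false
    asym   : ∀ i j → arc i j ≡ true → arc j i ≡ false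
open OrientedGraph public

skew : ∀ {n} → OrientedGraph n → Mat ℤ n
skew Σ' i j = if arc Σ' i j then + 1 else (if arc Σ' j i then -[1+ 0 ] else + 0)

converse : ∀ {n} → OrientedGraph n → OrientedGraph n
converse Σ' = record
  { arc = λ i j → arc Σ' j i
  ; irrefl = λ i → irrefl Σ' i
  ; asym = λ i j h → asym Σ' j i h }

Isomorphic : ∀ {n} → OrientedGraph n → OrientedGraph n → Set
Isomorphic {n} Σ' Δ =
  Σ (Fin n ↔ Fin n) λ σ → ∀ i j →
    skew Σ' (Inverse.to σ i) (Inverse.to σ j) ≡ skew Δ i j

complMat : ∀ {n} → Mat ℤ n → Mat ℤ n
complMat M i j = + 1 ℤ.- δℤ i j ℤ.- M i j

GenCospectral : ∀ {n} → OrientedGraph n → OrientedGraph n → Set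
GenCospectral Σ' Δ =
  SameSpectrum (skew Σ') (skew Δ) × SameSpectrum (complMat (skew Σ')) (complMat (skew Δ))

WDGSS : ∀ {n} → OrientedGraph n → Set
WDGSS {n} Σ' = (Δ : OrientedGraph n) → GenCospectral Σ' Δ →
  Isomorphic Σ' Δ ⊎ Isomorphic (converse Σ') Δ

walkVec : ∀ {n} → Mat ℤ n → ℕ → Fin n → ℤ
walkVec S zero    i = + 1
walkVec S (suc k) i = sumℤ (λ j → S i j ℤ.* walkVec S k j)

walkMat : ∀ {n} → OrientedGraph n → Mat ℤ n
walkMat Σ' i k = walkVec (skew Σ') (toℕ k) i

OddInt : ℤ → Set
OddInt m = ¬ (2 ∣ ∣ m ∣)

SquareFreeInt : ℤ → Set
SquareFreeInt m = ∀ d → d ℕ.* d ∣ ∣ m ∣ → d ≡ 1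

InG : ∀ {n} → OrientedGraph n → Set
InG {n} Σ' = ∃ λ m → det (walkMat Σ') ≡ + (2 ℕ.^ (n / 2)) ℤ.* m × OddInt m × SquareFreeInt m

toℚ : ℤ → ℚ
toℚ z = z ℚ./ 1

δℚ : ∀ {n} → Fin n → Fin n → ℚ
δℚ i j = if does (i ≟ j) then 1ℚ else 0ℚ

_·_ : ∀ {n} → Mat ℚ n → Mat ℚ n → Mat ℚ n
(A · B) i j = sumℚ (λ k → A i k ℚ.* B k j)

transpose : ∀ {n} → Mat ℚ n → Mat ℚ n
transpose A i j = A j i

Orthogonal : ∀ {n} → Mat ℚ n → Set
Orthogonal Q = ∀ i j → (transpose Q · Q) i j ≡ δℚ i j

Regular : ∀ {n} → Mat ℚ n → Set
Regular Q = ∀ i → sumℚ (λ j → Q i j) ≡ 1ℚ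

RegOrth : ∀ {n} → Mat ℚ n → Set
RegOrth Q = Regular Q × Orthogonal Q

IsIntegral : ∀ {n} → Mat ℚ n → Set
IsIntegral Q = ∀ i j → ↧ₙ (Q i j) ≡ 1

scale : ∀ {n} → ℕ → Mat ℚ n → Mat ℚ n
scale k Q i j = toℚ (+ k) ℚ.* Q i j

HasLevel : ∀ {n} → Mat ℚ n → ℕ → Set
HasLevel Q ℓ = 0 < ℓ × IsIntegral (scale ℓ Q) × (∀ k → 0 < k → k < ℓ → ¬ IsIntegral (scale k Q))

IsPermutationMatrix : ∀ {n} → Mat ℚ n → Set
IsPermutationMatrix {n} Q =
  Σ (Fin n ↔ Fin n) λ σ → ∀ i j → Q i j ≡ δℚ (Inverse.to σ i) j

Factorable : ∀ {n} → Mat ℚ n → Set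
Factorable Q =
  Σ ℕ λ ℓ → HasLevel Q ℓ ×
  Σ _ λ Q₁ → Σ _ λ Q₂ → Σ ℕ λ ℓ₁ → Σ ℕ λ ℓ₂ →
    RegOrth Q₁ × RegOrth Q₂ × HasLevel Q₁ ℓ₁ × HasLevel Q₂ ℓ₂ × ℓ₁ < ℓ × ℓ₂ < ℓ ×
    ¬ IsPermutationMatrix Q₁ × ¬ IsPermutationMatrix Q₂ ×
    (∀ i j → Q i j ≡ (Q₁ · Q₂) i j)

skewℚ : ∀ {n} → OrientedGraph n → Mat ℚ n
skewℚ Σ' i j = toℚ (skew Σ' i j)

ConjToConverse : ∀ {n} → OrientedGraph n → Mat ℚ n → Set
ConjToConverse Σ' Q = ∀ i j → (transpose Q · (skewℚ Σ' · Q)) i j ≡ skewℚ (converse Σ') i j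

{-# OPTIONS --safe #-}

-- Write S for the matrix of Σ, W for its walk matrix, e for the all-one vector, L = ℤⁿ and M = Wℤⁿ.
-- The two spectra determine all numbers eᵀSᵏe (compare the resolvents at a large integer), so a graph
-- Δ that is generalized cospectral with Σ has matrix QᵀSQ for a regular orthogonal Q with QᵀW(Σ) = W(Δ),
-- and the unimodular lattices L and QL both contain M.
--
-- At 2 they agree: some monic h of degree ⌈n/2⌉ has h(S)e ≡ 0, and modulo 2 the numbers eᵀSᵏe determine h
-- through its square, so Δ has the same h. Hence the level of Q divides the odd square-free part m of det W.
--
-- At an odd prime p | m the quotient M*/M is at most a hyperbolic plane over 𝔽ₚ, so L has at most one
-- competitor. If QL ≠ L at p, then Q₀L ≠ L as well: otherwise Q₀, which maps Sʲe to (-1)ʲSʲe, would act on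
-- M*/M by a sign that the position of p(M*/L) inside M excludes. Hence Q₀L = QL, so at every prime one of
-- Q and QᵀQ₀ is integral. Their levels are therefore coprime, and from Q₀ = Q · QᵀQ₀ each divides the level
-- of Q₀. If Q₀ is not factorable, one of the levels is 1, so Q or QᵀQ₀ is a permutation matrix.

module Submission where

-- All powers of 2 in det W come from one relation. Modulo 2 the walk vectors Sⁱe (without e itself
-- if n is odd) are mutually orthogonal and isotropic, so the rank of W is at most k = ⌈n/2⌉. With
-- h(S)e = 2y, the matrix V of e, ..., Sᵏ⁻¹e, y, Sy, ... satisfies det W = 2^⌊n/2⌋ det V, so det V =
-- m. If the same h works for Δ, it yields an integral V' with QᵀV = V', and |m|Qᵀ = V'(|m|V⁻¹) is
-- integral. This is why h has to be shared.
--
-- At an odd prime p | m the same division with k = n - 1 gives a V that is invertible modulo p,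
-- because p² ∤ m. The kernel of Wᵗ modulo p is then a line that contains all rows of |m|Qᵀ and
-- |m|Q₀ᵀ. Expanding these rows to first order in p around one generator z of that line takes the
-- place of lattices and discriminant groups. The sign (-1)ᵏ appears because a p-integral Q₀ forces
-- h to be, modulo p, an even or an odd polynomial, according to its degree k.
--
-- Matrices stay integral, as known multiples of orthogonal ones; rational numbers enter only with
-- levels and factorability.

open import Defs
open import Algebra.Bundles using (CommutativeRing)
import Algebra.Solver.Ring
open import Algebra.Solver.Ring.AlmostCommutativeRing using (fromCommutativeRing; _-Raw-AlmostCommutative⟶_)
open import Algebra.Structures using (IsCommutativeRing)
open import Data.Bool using (true; false)
open import Data.Empty using (⊥; ⊥-elim)
open import Data.Fin as Fin using (Fin; zero; suc; toℕ; punchIn)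
import Data.Fin.Properties as Fin
open import Data.Integer as ℤ using (ℤ; +_; -[1+_]; ∣_∣)
import Data.Integer.Divisibility.Signed as ℤˢ
import Data.Integer.Properties as ℤ
open import Data.List using ([]; _∷_)
open import Data.List.Relation.Unary.All using (_∷_)
open import Data.Nat as ℕ using (ℕ; zero; suc)
import Data.Nat.Coprimality as Coprimality
open import Data.Nat.Coprimality using (Coprime; coprime-Bézout; coprime-divisor; 1-coprimeTo)
import Data.Nat.DivMod as ℕ
import Data.Nat.Divisibility as ℕ
open import Data.Nat.GCD using (module Bézout)
open import Data.Nat.Induction using (<-rec)
open import Data.Nat.Primality
  using (Prime; euclidsLemma; prime?; prime⇒irreducible; prime⇒nonTrivial; prime⇒nonZero)
open import Data.Nat.Primality.Factorisation using (factorise; PrimeFactorisation)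
import Data.Nat.Properties as ℕ
open import Data.Product using (Σ; _×_; _,_; proj₁; proj₂; ∃)
open import Data.Rational as ℚ using (ℚ; mkℚ; ↥_; ↧_; ↧ₙ_)
import Data.Rational.Properties as ℚ
open import Data.Rational.Unnormalised using (mkℚᵘ; *≡*)
open import Data.Sum using (_⊎_; inj₁; inj₂; [_,_]′)
open import Function using (_∘_)
open import Function.Bundles using (_↔_; mk↔ₛ′; Inverse)
open import Agda.Primitive using (lzero)
open import Relation.Binary.PropositionalEquality
open import Relation.Nullary using (¬_; Dec; yes; no)
open import Relation.Nullary.Decidable as Dec
  using (_×-dec_; ¬?; decidable-stable; from-yes)

-- The operations are opaque: otherwise unification unfolds integer products into signs and absolute
-- values, and no implicit argument is ever found.

infixl 7 _*_
infixl 6 _+_ _-_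
infix  8 -_
opaque
  _+_ _*_ : ℤ → ℤ → ℤ
  _+_ = ℤ._+_
  _*_ = ℤ._*_
  -_ : ℤ → ℤ
  -_ = ℤ.-_
  ∑ : ∀ {n} → (Fin n → ℤ) → ℤ
  ∑ = sumℤ
  det′ : ∀ {n} → Mat ℤ n → ℤ
  det′ = det

_-_ : ℤ → ℤ → ℤ
a - b = a + (- b)

opaque
  unfolding _+_

  +-def : ∀ a b → a + b ≡ a ℤ.+ b
  +-def a b = refl

  *-def : ∀ a b → a * b ≡ a ℤ.* b
  *-def a b = refl

  neg-def : ∀ a → - a ≡ ℤ.- a
  neg-def a = refl

  ∑-def : ∀ {n} (f : Fin n → ℤ) → ∑ f ≡ sumℤ f
  ∑-def f = refl

  det′-def : ∀ {n} (M : Mat ℤ n) → det′ M ≡ det M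
  det′-def M = refl

  isCommutativeRing : IsCommutativeRing _≡_ _+_ _*_ -_ (+ 0) (+ 1)
  isCommutativeRing = ℤ.+-*-isCommutativeRing

ℤ-commutativeRing : CommutativeRing lzero lzero
ℤ-commutativeRing = record { isCommutativeRing = isCommutativeRing }

ring-morphism : ℤ.+-*-rawRing -Raw-AlmostCommutative⟶ fromCommutativeRing ℤ-commutativeRing
ring-morphism = record
  { ⟦_⟧ = λ a → a ; +-homo = λ a b → sym (+-def a b) ; *-homo = λ a b → sym (*-def a b)
  ; -‿homo = λ a → sym (neg-def a) ; 0-homo = refl ; 1-homo = refl }

open Algebra.Solver.Ring ℤ.+-*-rawRing (fromCommutativeRing ℤ-commutativeRing) ring-morphism
  (λ a b → Dec.dec⇒maybe (a ℤ.≟ b))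
  using (solve; _:+_; _:*_; _:-_; :-_; con; _:=_)

open CommutativeRing ℤ-commutativeRing
  using (+-comm; +-assoc; *-comm; *-assoc; +-identityˡ; +-identityʳ; *-identityˡ; *-identityʳ;
         zeroˡ; zeroʳ; distribˡ; distribʳ; -‿inverseʳ)

-- Divisibility and congruences

infix 4 _∣_ _≡_mod_

record _∣_ (d a : ℤ) : Set where
  constructor divides
  field
    quotient : ℤ
    equality : a ≡ quotient * d

-- For d = 0 the congruence is equality.
record _≡_mod_ (a b d : ℤ) : Set where
  constructor congruent
  field ∣-difference : d ∣ a - b
open _≡_mod_

∣-0 : ∀ {d} → d ∣ + 0
∣-0 {d} = divides (+ 0) (sym (zeroˡ d))

∣-refl : ∀ {d} → d ∣ d
∣-refl {d} = divides (+ 1) (sym (*-identityˡ d))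

∣-+ : ∀ {d a b} → d ∣ a → d ∣ b → d ∣ a + b
∣-+ {d} (divides q refl) (divides r refl) = divides (q + r) (sym (distribʳ d q r))

∣-*ˡ : ∀ {d b} a → d ∣ b → d ∣ a * b
∣-*ˡ {d} a (divides q refl) = divides (a * q) (sym (*-assoc a q d))

∣-*ʳ : ∀ {d a} b → d ∣ a → d ∣ a * b
∣-*ʳ {d} {a} b p = subst (d ∣_) (*-comm b a) (∣-*ˡ b p)

∣-neg : ∀ {d a} → d ∣ a → d ∣ - a
∣-neg {d} {a} p = subst (d ∣_) (solve 1 (λ a → con -[1+ 0 ] :* a := :- a) refl a) (∣-*ˡ -[1+ 0 ] p)

∣-- : ∀ {d a b} → d ∣ a → d ∣ b → d ∣ a - b
∣-- p q = ∣-+ p (∣-neg q)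

∣-trans : ∀ {a b c} → a ∣ b → b ∣ c → a ∣ c
∣-trans {a} (divides q refl) (divides r refl) = divides (r * q) (sym (*-assoc r q a))

∣-* : ∀ {a b c d} → a ∣ b → c ∣ d → a * c ∣ b * d
∣-* {a} {_} {c} (divides q refl) (divides r refl) = divides (q * r)
  (solve 4 (λ q a r c → q :* a :* (r :* c) := q :* r :* (a :* c)) refl q a r c)

mod-reflexive : ∀ {d a b} → a ≡ b → a ≡ b mod d
mod-reflexive {d} {a} refl = congruent (subst (d ∣_) (sym (-‿inverseʳ a)) ∣-0)

mod-refl : ∀ {d a} → a ≡ a mod d
mod-refl = mod-reflexive refl

mod-trans : ∀ {d a b c} → a ≡ b mod d → b ≡ c mod d → a ≡ c mod d
mod-trans {d} {a} {b} {c} (congruent p) (congruent q) = congruent (subst (d ∣_)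
  (solve 3 (λ a b c → (a :- b) :+ (b :- c) := a :- c) refl a b c) (∣-+ p q))

mod-sym : ∀ {d a b} → a ≡ b mod d → b ≡ a mod d
mod-sym {d} {a} {b} (congruent p) = congruent (subst (d ∣_)
  (solve 2 (λ a b → :- (a :- b) := b :- a) refl a b) (∣-neg p))

mod-+ : ∀ {d a b a' b'} → a ≡ b mod d → a' ≡ b' mod d → a + a' ≡ b + b' mod d
mod-+ {d} {a} {b} {a'} {b'} (congruent p) (congruent q) = congruent (subst (d ∣_)
  (solve 4 (λ a b a' b' → (a :- b) :+ (a' :- b') := (a :+ a') :- (b :+ b')) refl a b a' b') (∣-+ p q))

mod-* : ∀ {d a b a' b'} → a ≡ b mod d → a' ≡ b' mod d → a * a' ≡ b * b' mod d
mod-* {d} {a} {b} {a'} {b'} (congruent p) (congruent q) = congruent (subst (d ∣_)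
  (solve 4 (λ a b a' b' → (a :- b) :* a' :+ b :* (a' :- b') := a :* a' :- b :* b') refl a b a' b')
  (∣-+ (∣-*ʳ a' p) (∣-*ˡ b q)))

mod-*ˡ : ∀ {d a b} c → a ≡ b mod d → c * a ≡ c * b mod d
mod-*ˡ c p = mod-* mod-refl p

mod-∣ : ∀ {d a b} → a ≡ b mod d → d ∣ b → d ∣ a
mod-∣ {d} {a} {b} (congruent p) q = subst (d ∣_)
  (solve 2 (λ a b → (a :- b) :+ b := a) refl a b) (∣-+ p q)

∣⇒mod : ∀ {d a} → d ∣ a → a ≡ + 0 mod d
∣⇒mod {d} {a} p = congruent (subst (d ∣_) (solve 1 (λ a → a := a :- con (+ 0)) refl a) p)

mod⇒∣ : ∀ {d a} → a ≡ + 0 mod d → d ∣ a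
mod⇒∣ p = mod-∣ p ∣-0

-- Sums and determinants are treated once, modulo d; their exact versions are the case d = 0 and are
-- recovered here.
mod-0⇒≡ : ∀ {a b} → a ≡ b mod + 0 → a ≡ b
mod-0⇒≡ {a} {b} (congruent (divides q e)) = begin
  a ≡⟨ solve 2 (λ a b → a := (a :- b) :+ b) refl a b ⟩
  (a - b) + b ≡⟨ cong (_+ b) (trans e (zeroʳ q)) ⟩
  + 0 + b ≡⟨ +-identityˡ b ⟩
  b ∎
  where open ≡-Reasoning

-- Finite sums

∑-empty : (f : Fin 0 → ℤ) → ∑ f ≡ + 0
∑-empty f = ∑-def f

∑-suc : ∀ {n} (f : Fin (suc n) → ℤ) → ∑ f ≡ f zero + ∑ (f ∘ suc)
∑-suc f = trans (∑-def f) (sym (trans (+-def _ _) (cong (ℤ._+_ (f zero)) (∑-def (f ∘ suc)))))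

mod-∑ : ∀ {d n} {f g : Fin n → ℤ} → (∀ i → f i ≡ g i mod d) → ∑ f ≡ ∑ g mod d
mod-∑ {n = zero}  {f} {g} h = mod-reflexive (trans (∑-empty f) (sym (∑-empty g)))
mod-∑ {n = suc n} {f} {g} h = mod-trans (mod-reflexive (∑-suc f))
  (mod-trans (mod-+ (h zero) (mod-∑ (h ∘ suc))) (mod-reflexive (sym (∑-suc g))))

∑-cong : ∀ {n} {f g : Fin n → ℤ} → (∀ i → f i ≡ g i) → ∑ f ≡ ∑ g
∑-cong h = mod-0⇒≡ (mod-∑ (mod-reflexive ∘ h))

∑-0 : ∀ {n} → ∑ {n} (λ _ → + 0) ≡ + 0
∑-0 {zero}  = ∑-empty _
∑-0 {suc n} = trans (∑-suc _) (trans (+-identityˡ _) ∑-0)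

∑-zero : ∀ {n} {f : Fin n → ℤ} → (∀ i → f i ≡ + 0) → ∑ f ≡ + 0
∑-zero h = trans (∑-cong h) ∑-0

∑-∣ : ∀ {n d} {f : Fin n → ℤ} → (∀ i → d ∣ f i) → d ∣ ∑ f
∑-∣ h = mod⇒∣ (mod-trans (mod-∑ (∣⇒mod ∘ h)) (mod-reflexive ∑-0))

∑-+ : ∀ {n} (f g : Fin n → ℤ) → ∑ (λ i → f i + g i) ≡ ∑ f + ∑ g
∑-+ {zero}  f g = trans (∑-empty _) (sym (trans (cong₂ _+_ (∑-empty f) (∑-empty g)) (+-identityˡ _)))
∑-+ {suc n} f g = begin
  ∑ (λ i → f i + g i) ≡⟨ ∑-suc _ ⟩
  f zero + g zero + ∑ (λ i → f (suc i) + g (suc i)) ≡⟨ cong (_+_ _) (∑-+ (f ∘ suc) (g ∘ suc)) ⟩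
  f zero + g zero + (∑ (f ∘ suc) + ∑ (g ∘ suc))
    ≡⟨ solve 4 (λ a b c d → a :+ b :+ (c :+ d) := a :+ c :+ (b :+ d)) refl (f zero) (g zero) _ _ ⟩
  f zero + ∑ (f ∘ suc) + (g zero + ∑ (g ∘ suc)) ≡⟨ cong₂ _+_ (∑-suc f) (∑-suc g) ⟨
  ∑ f + ∑ g ∎
  where open ≡-Reasoning

∑-*ˡ : ∀ {n} c (f : Fin n → ℤ) → ∑ (λ i → c * f i) ≡ c * ∑ f
∑-*ˡ {zero}  c f = trans (∑-empty _) (sym (trans (cong (c *_) (∑-empty f)) (zeroʳ c)))
∑-*ˡ {suc n} c f = begin
  ∑ (λ i → c * f i) ≡⟨ ∑-suc _ ⟩
  c * f zero + ∑ (λ i → c * f (suc i)) ≡⟨ cong (_+_ _) (∑-*ˡ c (f ∘ suc)) ⟩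
  c * f zero + c * ∑ (f ∘ suc) ≡⟨ distribˡ c (f zero) _ ⟨
  c * (f zero + ∑ (f ∘ suc)) ≡⟨ cong (c *_) (∑-suc f) ⟨
  c * ∑ f ∎
  where open ≡-Reasoning

∑-*ʳ : ∀ {n} c (f : Fin n → ℤ) → ∑ (λ i → f i * c) ≡ ∑ f * c
∑-*ʳ c f = trans (∑-cong (λ i → *-comm (f i) c)) (trans (∑-*ˡ c f) (*-comm c _))

∑-neg : ∀ {n} (f : Fin n → ℤ) → ∑ (λ i → - f i) ≡ - ∑ f
∑-neg f = trans (∑-cong (λ i → as-multiple (f i))) (trans (∑-*ˡ -[1+ 0 ] f) (sym (as-multiple _)))
  where
  as-multiple : ∀ a → - a ≡ -[1+ 0 ] * a
  as-multiple = solve 1 (λ a → :- a := con -[1+ 0 ] :* a) refl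

∑-swap : ∀ {m n} (f : Fin m → Fin n → ℤ) → ∑ (λ i → ∑ (λ j → f i j)) ≡ ∑ (λ j → ∑ (λ i → f i j))
∑-swap {zero}  f = trans (∑-empty _) (sym (∑-zero (λ j → ∑-empty _)))
∑-swap {suc m} f = begin
  ∑ (λ i → ∑ (λ j → f i j)) ≡⟨ ∑-suc _ ⟩
  ∑ (f zero) + ∑ (λ i → ∑ (λ j → f (suc i) j)) ≡⟨ cong (_+_ _) (∑-swap (f ∘ suc)) ⟩
  ∑ (f zero) + ∑ (λ j → ∑ (λ i → f (suc i) j)) ≡⟨ ∑-+ _ _ ⟨
  ∑ (λ j → f zero j + ∑ (λ i → f (suc i) j)) ≡⟨ ∑-cong (λ j → ∑-suc (λ i → f i j)) ⟨
  ∑ (λ j → ∑ (λ i → f i j)) ∎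
  where open ≡-Reasoning

δ-refl : ∀ {n} (i : Fin n) → δℤ i i ≡ + 1
δ-refl i with i Fin.≟ i
... | yes _ = refl
... | no ¬p = ⊥-elim (¬p refl)

δ-≢ : ∀ {n} {i j : Fin n} → i ≢ j → δℤ i j ≡ + 0
δ-≢ {_} {i} {j} i≢j with i Fin.≟ j
... | yes p = ⊥-elim (i≢j p)
... | no _  = refl

δ-sym : ∀ {n} (i j : Fin n) → δℤ i j ≡ δℤ j i
δ-sym i j with i Fin.≟ j
... | yes refl = sym (δ-refl j)
... | no ¬p    = sym (δ-≢ (¬p ∘ sym))

δ-suc : ∀ {n} (i j : Fin n) → δℤ (suc i) (suc j) ≡ δℤ i j
δ-suc i j with i Fin.≟ j
... | yes refl = refl
... | no ¬p    = refl

∑-δˡ : ∀ {n} i (f : Fin n → ℤ) → ∑ (λ k → δℤ i k * f k) ≡ f i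
∑-δˡ {suc n} zero f = begin
  ∑ (λ k → δℤ zero k * f k) ≡⟨ ∑-suc _ ⟩
  + 1 * f zero + ∑ (λ k → + 0 * f (suc k)) ≡⟨ cong₂ _+_ (*-identityˡ _) (∑-zero (λ k → zeroˡ (f (suc k)))) ⟩
  f zero + + 0 ≡⟨ +-identityʳ _ ⟩
  f zero ∎
  where open ≡-Reasoning
∑-δˡ {suc n} (suc i) f = begin
  ∑ (λ k → δℤ (suc i) k * f k) ≡⟨ ∑-suc _ ⟩
  + 0 * f zero + ∑ (λ k → δℤ (suc i) (suc k) * f (suc k))
    ≡⟨ cong₂ _+_ (zeroˡ _) (∑-cong (λ k → cong (_* f (suc k)) (δ-suc i k))) ⟩
  + 0 + ∑ (λ k → δℤ i k * f (suc k)) ≡⟨ +-identityˡ _ ⟩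
  ∑ (λ k → δℤ i k * f (suc k)) ≡⟨ ∑-δˡ i (f ∘ suc) ⟩
  f (suc i) ∎
  where open ≡-Reasoning

∑-δʳ : ∀ {n} i (f : Fin n → ℤ) → ∑ (λ k → f k * δℤ k i) ≡ f i
∑-δʳ i f = trans (∑-cong (λ k → trans (*-comm (f k) _) (cong (_* f k) (δ-sym k i)))) (∑-δˡ i f)

-- Vectors and matrices over ℤ

Vector : ℕ → Set
Vector n = Fin n → ℤ

infixl 7 _⊡_ _▹_
infix  8 _ᵗ

_⊡_ : ∀ {n} → Mat ℤ n → Mat ℤ n → Mat ℤ n
(A ⊡ B) i j = ∑ (λ k → A i k * B k j)

_▹_ : ∀ {n} → Mat ℤ n → Vector n → Vector n
(A ▹ x) i = ∑ (λ k → A i k * x k)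

_ᵗ : ∀ {n} → Mat ℤ n → Mat ℤ n
(A ᵗ) i j = A j i

dot : ∀ {n} → Vector n → Vector n → ℤ
dot x y = ∑ (λ i → x i * y i)

comb : ∀ {n m} → (Fin m → ℤ) → (Fin m → Vector n) → Vector n
comb c v i = ∑ (λ k → c k * v k i)

dot-cong : ∀ {n} {x x' y y' : Vector n} → x ≗ x' → y ≗ y' → dot x y ≡ dot x' y'
dot-cong p q = ∑-cong (λ i → cong₂ _*_ (p i) (q i))

dot-comm : ∀ {n} (x y : Vector n) → dot x y ≡ dot y x
dot-comm x y = ∑-cong (λ i → *-comm (x i) (y i))

dot-+ʳ : ∀ {n} (x y z : Vector n) → dot x (λ i → y i + z i) ≡ dot x y + dot x z
dot-+ʳ x y z = trans (∑-cong (λ i → distribˡ (x i) (y i) (z i))) (∑-+ _ _)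

private
  pull-left : ∀ a b c → a * (b * c) ≡ b * (a * c)
  pull-left = solve 3 (λ a b c → a :* (b :* c) := b :* (a :* c)) refl

dot-*ʳ : ∀ {n} c (x y : Vector n) → dot x (λ i → c * y i) ≡ c * dot x y
dot-*ʳ c x y = trans (∑-cong (λ i → pull-left (x i) c (y i))) (∑-*ˡ c _)

dot-*ˡ : ∀ {n} c (x y : Vector n) → dot (λ i → c * y i) x ≡ c * dot y x
dot-*ˡ c x y = trans (dot-comm _ x) (trans (dot-*ʳ c x y) (cong (c *_) (dot-comm x y)))

dot-linʳ : ∀ {n} c (x y z : Vector n) → dot x (λ i → y i + c * z i) ≡ dot x y + c * dot x z
dot-linʳ c x y z = trans (dot-+ʳ x _ _) (cong (_+_ _) (dot-*ʳ c x z))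

dot-linˡ : ∀ {n} c (x y z : Vector n) → dot (λ i → y i + c * z i) x ≡ dot y x + c * dot z x
dot-linˡ c x y z = trans (dot-comm _ x)
  (trans (dot-linʳ c x y z) (cong₂ (λ s t → s + c * t) (dot-comm x y) (dot-comm x z)))

dot-combʳ : ∀ {n m} (x : Vector n) (c : Fin m → ℤ) (v : Fin m → Vector n) →
  dot x (comb c v) ≡ ∑ (λ k → c k * dot x (v k))
dot-combʳ x c v = begin
  ∑ (λ i → x i * ∑ (λ k → c k * v k i)) ≡⟨ ∑-cong (λ i → ∑-*ˡ (x i) _) ⟨
  ∑ (λ i → ∑ (λ k → x i * (c k * v k i))) ≡⟨ ∑-swap _ ⟩
  ∑ (λ k → dot x (λ i → c k * v k i)) ≡⟨ ∑-cong (λ k → dot-*ʳ (c k) x (v k)) ⟩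
  ∑ (λ k → c k * dot x (v k)) ∎
  where open ≡-Reasoning

dot-combˡ : ∀ {n m} (x : Vector n) (c : Fin m → ℤ) (v : Fin m → Vector n) →
  dot (comb c v) x ≡ ∑ (λ k → c k * dot (v k) x)
dot-combˡ x c v = trans (dot-comm _ x)
  (trans (dot-combʳ x c v) (∑-cong (λ k → cong (c k *_) (dot-comm x (v k)))))

dot-▹ : ∀ {n} (A : Mat ℤ n) x y → dot (A ▹ x) y ≡ dot x (A ᵗ ▹ y)
dot-▹ A x y = begin
  ∑ (λ i → ∑ (λ k → A i k * x k) * y i) ≡⟨ ∑-cong (λ i → ∑-*ʳ (y i) _) ⟨
  ∑ (λ i → ∑ (λ k → A i k * x k * y i)) ≡⟨ ∑-swap _ ⟩
  ∑ (λ k → ∑ (λ i → A i k * x k * y i))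
    ≡⟨ ∑-cong (λ k → ∑-cong (λ i → solve 3 (λ a b c → a :* b :* c := b :* (a :* c)) refl (A i k) (x k) (y i))) ⟩
  ∑ (λ k → ∑ (λ i → x k * (A i k * y i))) ≡⟨ ∑-cong (λ k → ∑-*ˡ (x k) _) ⟩
  dot x (A ᵗ ▹ y) ∎
  where open ≡-Reasoning

▹-congʳ : ∀ {n} (A : Mat ℤ n) {x y : Vector n} → x ≗ y → A ▹ x ≗ A ▹ y
▹-congʳ A q i = dot-cong (λ _ → refl) q

▹-congˡ : ∀ {n} {A B : Mat ℤ n} (x : Vector n) → (∀ i j → A i j ≡ B i j) → A ▹ x ≗ B ▹ x
▹-congˡ x p i = dot-cong (p i) (λ _ → refl)

⊡-cong : ∀ {n} {A A' B B' : Mat ℤ n} → (∀ i j → A i j ≡ A' i j) → (∀ i j → B i j ≡ B' i j) →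
  ∀ i j → (A ⊡ B) i j ≡ (A' ⊡ B') i j
⊡-cong p q i j = ∑-cong (λ k → cong₂ _*_ (p i k) (q k j))

▹-▹ : ∀ {n} (A B : Mat ℤ n) x → (A ⊡ B) ▹ x ≗ A ▹ (B ▹ x)
▹-▹ A B x i = begin
  ∑ (λ k → ∑ (λ l → A i l * B l k) * x k) ≡⟨ ∑-cong (λ k → ∑-*ʳ (x k) _) ⟨
  ∑ (λ k → ∑ (λ l → A i l * B l k * x k)) ≡⟨ ∑-swap _ ⟩
  ∑ (λ l → ∑ (λ k → A i l * B l k * x k)) ≡⟨ ∑-cong (λ l → ∑-cong (λ k → *-assoc (A i l) (B l k) (x k))) ⟩
  ∑ (λ l → ∑ (λ k → A i l * (B l k * x k))) ≡⟨ ∑-cong (λ l → ∑-*ˡ (A i l) _) ⟩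
  ∑ (λ l → A i l * ∑ (λ k → B l k * x k)) ∎
  where open ≡-Reasoning

⊡-assoc : ∀ {n} (A B C : Mat ℤ n) i j → ((A ⊡ B) ⊡ C) i j ≡ (A ⊡ (B ⊡ C)) i j
⊡-assoc A B C i j = ▹-▹ A B (λ k → C k j) i

⊡-ᵗ : ∀ {n} (A B : Mat ℤ n) i j → (A ⊡ B) i j ≡ (B ᵗ ⊡ A ᵗ) j i
⊡-ᵗ A B i j = ∑-cong (λ k → *-comm (A i k) (B k j))

scalar : ∀ {n} → ℤ → Mat ℤ n
scalar c i j = c * δℤ i j

scalar-▹ : ∀ {n} c (x : Vector n) → scalar c ▹ x ≗ (λ i → c * x i)
scalar-▹ c x i = trans (∑-cong (λ k → *-assoc c (δℤ i k) (x k)))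
  (trans (∑-*ˡ c _) (cong (c *_) (∑-δˡ i x)))

scalar-⊡ : ∀ {n} c (A : Mat ℤ n) i j → (scalar c ⊡ A) i j ≡ c * A i j
scalar-⊡ c A i j = scalar-▹ c (λ k → A k j) i

⊡-scalar : ∀ {n} c (A : Mat ℤ n) i j → (A ⊡ scalar c) i j ≡ c * A i j
⊡-scalar c A i j = trans (dot-*ʳ c (A i) (λ k → δℤ k j)) (cong (c *_) (∑-δʳ j (A i)))

-- Determinants

sgn-suc : ∀ k → sgn (suc k) ≡ - sgn k
sgn-suc zero          = sym (neg-def (+ 1))
sgn-suc (suc zero)    = sym (neg-def -[1+ 0 ])
sgn-suc (suc (suc k)) = sgn-suc k

minor : ∀ {n} → Fin (suc n) → Fin (suc n) → Mat ℤ (suc n) → Mat ℤ n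
minor i j M a b = M (punchIn i a) (punchIn j b)

det′-empty : (M : Mat ℤ 0) → det′ M ≡ + 1
det′-empty M = det′-def M

det′-suc : ∀ {n} (M : Mat ℤ (suc n)) →
  det′ M ≡ ∑ (λ i → sgn (toℕ i) * M i zero * det′ (minor i zero M))
det′-suc {n} M = trans (det′-def M) (trans (go (suc n) (λ i → i)) (sym (∑-def _)))
  where
  go : ∀ m (ρ : Fin m → Fin (suc n)) →
    sumℤ (λ i → sgn (toℕ (ρ i)) ℤ.* M (ρ i) zero ℤ.* det (minor (ρ i) zero M)) ≡
    sumℤ (λ i → sgn (toℕ (ρ i)) * M (ρ i) zero * det′ (minor (ρ i) zero M))
  go zero    ρ = refl
  go (suc m) ρ = cong₂ ℤ._+_
    (sym (trans (*-def _ _) (cong₂ ℤ._*_ (*-def _ _) (det′-def _)))) (go m (ρ ∘ suc))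

mod-det : ∀ {d n} {A B : Mat ℤ n} → (∀ i j → A i j ≡ B i j mod d) → det′ A ≡ det′ B mod d
mod-det {n = zero}  {A} {B} h = mod-reflexive (trans (det′-empty A) (sym (det′-empty B)))
mod-det {n = suc n} {A} {B} h = mod-trans (mod-reflexive (det′-suc A)) (mod-trans
  (mod-∑ (λ i → mod-* (mod-*ˡ (sgn (toℕ i)) (h i zero)) (mod-det (λ a b → h (punchIn i a) (suc b)))))
  (mod-reflexive (sym (det′-suc B))))

det′-cong : ∀ {n} {A B : Mat ℤ n} → (∀ i j → A i j ≡ B i j) → det′ A ≡ det′ B
det′-cong h = mod-0⇒≡ (mod-det (λ i j → mod-reflexive (h i j)))

∏ : ∀ {n} → (Fin n → ℤ) → ℤ
∏ {zero}  f = + 1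
∏ {suc n} f = f zero * ∏ (f ∘ suc)

det′-triangular : ∀ {d n} (M : Mat ℤ n) → (∀ i j → toℕ j ℕ.< toℕ i → d ∣ M i j) →
  det′ M ≡ ∏ (λ i → M i i) mod d
det′-triangular {n = zero}  M h = mod-reflexive (det′-empty M)
det′-triangular {n = suc n} M h = mod-trans (mod-reflexive (trans (det′-suc M) (∑-suc _)))
  (mod-trans (mod-+ (mod-* (mod-reflexive (*-identityˡ (M zero zero)))
      (det′-triangular (minor zero zero M) (λ i j l → h (suc i) (suc j) (ℕ.s≤s l))))
    (∣⇒mod (∑-∣ (λ i → ∣-*ʳ _ (∣-*ˡ (sgn (suc (toℕ i))) (h (suc i) zero (ℕ.s≤s ℕ.z≤n)))))))
  (mod-reflexive (+-identityʳ _)))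

∏-mod-1 : ∀ {d n} {f : Fin n → ℤ} → (∀ i → f i ≡ + 1 mod d) → ∏ f ≡ + 1 mod d
∏-mod-1 {n = zero}  h = mod-refl
∏-mod-1 {n = suc n} h = mod-trans (mod-* (h zero) (∏-mod-1 (h ∘ suc))) (mod-reflexive (*-identityˡ _))

det′-unitriangular : ∀ {d n} (M : Mat ℤ n) → (∀ i j → toℕ j ℕ.< toℕ i → d ∣ M i j) →
  (∀ i → M i i ≡ + 1 mod d) → det′ M ≡ + 1 mod d
det′-unitriangular M h₀ h₁ = mod-trans (det′-triangular M h₀) (∏-mod-1 h₁)

det′-zero-column : ∀ {n} (M : Mat ℤ (suc n)) → (∀ i → M i zero ≡ + 0) → det′ M ≡ + 0
det′-zero-column M h = trans (det′-suc M)
  (∑-zero (λ i → trans (cong (_* det′ (minor i zero M)) (trans (cong (sgn (toℕ i) *_) (h i)) (zeroʳ _))) (zeroˡ _)))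

-- Expanding both sides once more along the other line gives the same double sum.
det′-first-row : ∀ {n} (M : Mat ℤ (suc n)) →
  det′ M ≡ ∑ (λ j → sgn (toℕ j) * M zero j * det′ (minor zero j M))
det′-first-row {zero}  M = trans (det′-suc M) (trans (∑-suc _) (trans
  (cong₂ _+_ (cong (sgn 0 * M zero zero *_) (det′-cong {A = minor zero zero M} {B = minor zero zero M} (λ ())))
      (trans (∑-empty _) (sym (∑-empty _))))
  (sym (∑-suc _))))
det′-first-row {suc n} M = begin
  det′ M ≡⟨ det′-suc M ⟩
  ∑ (λ i → sgn (toℕ i) * M i zero * det′ (minor i zero M)) ≡⟨ ∑-suc _ ⟩
  + 1 * M zero zero * det′ (minor zero zero M) +
    ∑ (λ i → sgn (suc (toℕ i)) * M (suc i) zero * det′ (minor (suc i) zero M))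
    ≡⟨ cong (_+_ _) tails ⟩
  + 1 * M zero zero * det′ (minor zero zero M) +
    ∑ (λ j → sgn (suc (toℕ j)) * M zero (suc j) * det′ (minor zero (suc j) M)) ≡⟨ ∑-suc _ ⟨
  ∑ (λ j → sgn (toℕ j) * M zero j * det′ (minor zero j M)) ∎
  where
  open ≡-Reasoning
  D : Fin (suc n) → Fin (suc n) → ℤ
  D i j = det′ (λ a b → M (suc (punchIn i a)) (suc (punchIn j b)))
  exchange : ∀ i j a b d → sgn (suc i) * a * (sgn j * b * d) ≡ sgn (suc j) * b * (sgn i * a * d)
  exchange i j a b d rewrite sgn-suc i | sgn-suc j =
    solve 5 (λ s t a b d → (:- s) :* a :* (t :* b :* d) := (:- t) :* b :* (s :* a :* d)) refl (sgn i) (sgn j) a b d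
  tails : ∑ (λ i → sgn (suc (toℕ i)) * M (suc i) zero * det′ (minor (suc i) zero M)) ≡
          ∑ (λ j → sgn (suc (toℕ j)) * M zero (suc j) * det′ (minor zero (suc j) M))
  tails = begin
    ∑ (λ i → sgn (suc (toℕ i)) * M (suc i) zero * det′ (minor (suc i) zero M))
      ≡⟨ ∑-cong (λ i → trans (cong (sgn (suc (toℕ i)) * M (suc i) zero *_) (det′-first-row (minor (suc i) zero M)))
           (sym (∑-*ˡ _ _))) ⟩
    ∑ (λ i → ∑ (λ j → sgn (suc (toℕ i)) * M (suc i) zero * (sgn (toℕ j) * M zero (suc j) * D i j)))
      ≡⟨ ∑-swap _ ⟩
    ∑ (λ j → ∑ (λ i → sgn (suc (toℕ i)) * M (suc i) zero * (sgn (toℕ j) * M zero (suc j) * D i j)))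
      ≡⟨ ∑-cong (λ j → ∑-cong (λ i → exchange (toℕ i) (toℕ j) (M (suc i) zero) (M zero (suc j)) (D i j))) ⟩
    ∑ (λ j → ∑ (λ i → sgn (suc (toℕ j)) * M zero (suc j) * (sgn (toℕ i) * M (suc i) zero * D i j)))
      ≡⟨ ∑-cong (λ j → trans (cong (sgn (suc (toℕ j)) * M zero (suc j) *_) (det′-suc (minor zero (suc j) M)))
           (sym (∑-*ˡ _ _))) ⟨
    ∑ (λ j → sgn (suc (toℕ j)) * M zero (suc j) * det′ (minor zero (suc j) M)) ∎

det′-ᵗ : ∀ {n} (M : Mat ℤ n) → det′ (M ᵗ) ≡ det′ M
det′-ᵗ {zero}  M = trans (det′-empty _) (sym (det′-empty M))
det′-ᵗ {suc n} M = trans (det′-suc (M ᵗ)) (trans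
  (∑-cong (λ i → cong (sgn (toℕ i) * M zero i *_) (det′-ᵗ (minor zero i M))))
  (sym (det′-first-row M)))

-- Alternating multilinear forms in m vectors

infixl 6 _[_]≔_
_[_]≔_ : ∀ {m} {A : Set} → (Fin m → A) → Fin m → A → Fin m → A
(B [ zero ]≔ x)  zero    = x
(B [ zero ]≔ x)  (suc k) = B (suc k)
(B [ suc j ]≔ x) zero    = B zero
(B [ suc j ]≔ x) (suc k) = ((B ∘ suc) [ j ]≔ x) k

≔-same : ∀ {m} {A : Set} (B : Fin m → A) j x → (B [ j ]≔ x) j ≡ x
≔-same B zero    x = refl
≔-same B (suc j) x = ≔-same (B ∘ suc) j x

≔-other : ∀ {m} {A : Set} (B : Fin m → A) j x k → k ≢ j → (B [ j ]≔ x) k ≡ B k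
≔-other B zero    x zero    k≢j = ⊥-elim (k≢j refl)
≔-other B zero    x (suc k) k≢j = refl
≔-other B (suc j) x zero    k≢j = refl
≔-other B (suc j) x (suc k) k≢j = ≔-other (B ∘ suc) j x k (k≢j ∘ cong suc)

infixr 5 _◂_
_◂_ : ∀ {m} {A : Set} → A → (Fin m → A) → Fin (suc m) → A
(x ◂ B) zero    = x
(x ◂ B) (suc k) = B k

-- The number of vectors and their dimension are separate parameters: `partial` lowers the first and
-- `pullback` changes the second, and the induction in `form-unique` needs both.
record Alternating (m N : ℕ) : Set where
  field
    form : (Fin m → Vector N) → ℤ
    form-cong : ∀ {A B} → (∀ j → A j ≗ B j) → form A ≡ form B
    linear : ∀ j A x y c → form (A [ j ]≔ (λ i → x i + c * y i)) ≡ form (A [ j ]≔ x) + c * form (A [ j ]≔ y)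
    alternating : ∀ {j k} → j ≢ k → ∀ A → A j ≗ A k → form A ≡ + 0
open Alternating

-- The double sum over pairs of rows cancels because each unordered pair occurs twice, with opposite signs.
∑-antisymmetric : ∀ n (E : Fin (suc (suc n)) → Fin (suc (suc n)) → (Fin n → Fin (suc (suc n))) → ℤ) →
  (∀ i j {ρ ρ'} → ρ ≗ ρ' → E i j ρ ≡ E j i ρ') →
  ∑ (λ i → ∑ (λ a → sgn (toℕ i) * sgn (toℕ a) * E i (punchIn i a) (λ b → punchIn i (punchIn a b)))) ≡ + 0
∑-antisymmetric n E E-sym = begin
  ∑ (λ i → ∑ (λ a → T i a)) ≡⟨ ∑-suc _ ⟩
  ∑ (λ a → T zero a) + ∑ (λ i → ∑ (λ a → T (suc i) a))
    ≡⟨ cong (_+_ _) (trans (∑-cong (λ i → ∑-suc (T (suc i)))) (∑-+ _ _)) ⟩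
  ∑ (λ a → T zero a) + (∑ (λ i → T (suc i) zero) + ∑ (λ i → ∑ (λ a → T (suc i) (suc a))))
    ≡⟨ +-assoc _ _ _ ⟨
  ∑ (λ a → T zero a) + ∑ (λ i → T (suc i) zero) + ∑ (λ i → ∑ (λ a → T (suc i) (suc a)))
    ≡⟨ cong₂ _+_ (trans (sym (∑-+ _ _)) (∑-zero cancel)) (rest n E E-sym) ⟩
  + 0 + + 0 ≡⟨ +-identityˡ _ ⟩
  + 0 ∎
  where
  open ≡-Reasoning
  T : Fin (suc (suc n)) → Fin (suc n) → ℤ
  T i a = sgn (toℕ i) * sgn (toℕ a) * E i (punchIn i a) (λ b → punchIn i (punchIn a b))
  opposite : ∀ k {x y} → x ≡ y → + 1 * sgn k * x + sgn (suc k) * + 1 * y ≡ + 0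
  opposite k {x} refl rewrite sgn-suc k =
    solve 2 (λ s x → con (+ 1) :* s :* x :+ (:- s) :* con (+ 1) :* x := con (+ 0)) refl (sgn k) x
  cancel : ∀ a → T zero a + T (suc a) zero ≡ + 0
  cancel a = opposite (toℕ a) (E-sym zero (suc a) (λ b → refl))
  rest : ∀ n (E : Fin (suc (suc n)) → Fin (suc (suc n)) → (Fin n → Fin (suc (suc n))) → ℤ) →
    (∀ i j {ρ ρ'} → ρ ≗ ρ' → E i j ρ ≡ E j i ρ') →
    ∑ (λ i → ∑ (λ a → sgn (suc (toℕ i)) * sgn (suc (toℕ a)) *
      E (suc i) (suc (punchIn i a)) (λ b → punchIn (suc i) (punchIn (suc a) b)))) ≡ + 0
  rest zero    E E-sym = ∑-zero (λ i → ∑-empty _)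
  rest (suc n) E E-sym = trans
    (∑-cong (λ i → ∑-cong (λ a → cong₂ _*_ (signs (toℕ i) (toℕ a))
      -- Using the symmetry twice replaces the list of remaining rows by a pointwise equal one.
      (trans (E-sym (suc i) (suc (punchIn i a)) (λ b → refl))
        (E-sym (suc (punchIn i a)) (suc i) (λ { zero → refl ; (suc b) → refl }))))))
    -- Row `zero` is now never one of the two chosen rows, so it heads the list of the remaining
    -- ones.
    (∑-antisymmetric n (λ i j ρ → E (suc i) (suc j) (zero ◂ (suc ∘ ρ)))
      (λ i j ρ≗ρ' → E-sym (suc i) (suc j) (λ { zero → refl ; (suc b) → cong suc (ρ≗ρ' b) })))
    where
    signs : ∀ k l → sgn (suc k) * sgn (suc l) ≡ sgn k * sgn l
    signs k l rewrite sgn-suc k | sgn-suc l = solve 2 (λ s t → (:- s) :* (:- t) := s :* t) refl (sgn k) (sgn l)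

columns : ∀ {n} → (Fin n → Vector n) → Mat ℤ n
columns A i j = A j i

private
  ≔-minor : ∀ {n} (A : Fin (suc n) → Vector (suc n)) (j : Fin n) x (i : Fin (suc n)) → ∀ a b →
    (A [ suc j ]≔ x) (suc b) (punchIn i a) ≡ ((λ b a → A (suc b) (punchIn i a)) [ j ]≔ (λ a → x (punchIn i a))) b a
  ≔-minor A j x i a b with b Fin.≟ j
  ... | yes refl = trans (cong (λ v → v (punchIn i a)) (≔-same (A ∘ suc) b x))
    (sym (cong (λ v → v a) (≔-same (λ b a → A (suc b) (punchIn i a)) b _)))
  ... | no b≢j = trans (cong (λ v → v (punchIn i a)) (≔-other (A ∘ suc) j x b b≢j))
    (sym (cong (λ v → v a) (≔-other (λ b a → A (suc b) (punchIn i a)) j _ b b≢j)))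

det′-linear : ∀ {n} (j : Fin n) A x y c →
  det′ (columns (A [ j ]≔ (λ i → x i + c * y i))) ≡
  det′ (columns (A [ j ]≔ x)) + c * det′ (columns (A [ j ]≔ y))
det′-linear {suc n} zero A x y c = begin
  det′ (columns (A [ zero ]≔ (λ i → x i + c * y i))) ≡⟨ det′-suc _ ⟩
  ∑ (λ i → sgn (toℕ i) * (x i + c * y i) * D i)
    ≡⟨ ∑-cong (λ i → solve 5 (λ s x c y d → s :* (x :+ c :* y) :* d := s :* x :* d :+ c :* (s :* y :* d)) refl
         (sgn (toℕ i)) (x i) c (y i) (D i)) ⟩
  ∑ (λ i → sgn (toℕ i) * x i * D i + c * (sgn (toℕ i) * y i * D i)) ≡⟨ ∑-+ _ _ ⟩
  ∑ (λ i → sgn (toℕ i) * x i * D i) + ∑ (λ i → c * (sgn (toℕ i) * y i * D i))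
    ≡⟨ cong₂ _+_ (sym (det′-suc _)) (trans (∑-*ˡ c _) (cong (c *_) (sym (det′-suc _)))) ⟩
  det′ (columns (A [ zero ]≔ x)) + c * det′ (columns (A [ zero ]≔ y)) ∎
  where
  open ≡-Reasoning
  D : Fin (suc n) → ℤ
  D i = det′ (λ a b → A (suc b) (punchIn i a))
det′-linear {suc n} (suc j) A x y c = begin
  det′ (columns (A [ suc j ]≔ (λ i → x i + c * y i))) ≡⟨ det′-suc _ ⟩
  ∑ (λ i → sgn (toℕ i) * A zero i * det′ (λ a b → (A [ suc j ]≔ (λ i → x i + c * y i)) (suc b) (punchIn i a)))
    ≡⟨ ∑-cong (λ i → cong (sgn (toℕ i) * A zero i *_) (trans (det′-cong (≔-minor A j _ i)) (det′-linear j _ _ _ c))) ⟩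
  ∑ (λ i → sgn (toℕ i) * A zero i * (D x i + c * D y i))
    ≡⟨ ∑-cong (λ i → solve 4 (λ s u c v → s :* (u :+ c :* v) := s :* u :+ c :* (s :* v)) refl
         (sgn (toℕ i) * A zero i) (D x i) c (D y i)) ⟩
  ∑ (λ i → sgn (toℕ i) * A zero i * D x i + c * (sgn (toℕ i) * A zero i * D y i)) ≡⟨ ∑-+ _ _ ⟩
  ∑ (λ i → sgn (toℕ i) * A zero i * D x i) + ∑ (λ i → c * (sgn (toℕ i) * A zero i * D y i))
    ≡⟨ cong₂ _+_ (back x) (trans (∑-*ˡ c _) (cong (c *_) (back y))) ⟩
  det′ (columns (A [ suc j ]≔ x)) + c * det′ (columns (A [ suc j ]≔ y)) ∎
  where
  open ≡-Reasoning
  D : Vector (suc n) → Fin (suc n) → ℤ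
  D x i = det′ (columns ((λ b a → A (suc b) (punchIn i a)) [ j ]≔ (λ a → x (punchIn i a))))
  back : ∀ x → ∑ (λ i → sgn (toℕ i) * A zero i * D x i) ≡ det′ (columns (A [ suc j ]≔ x))
  back x = sym (trans (det′-suc _)
    (∑-cong (λ i → cong (sgn (toℕ i) * A zero i *_) (det′-cong (≔-minor A j x i)))))

-- Expansion along both equal columns leaves a double sum over two rows whose summand, signs aside,
-- is symmetric in them.
det′-01 : ∀ {n} (A : Fin (suc (suc n)) → Vector (suc (suc n))) → A zero ≗ A (suc zero) →
  det′ (columns A) ≡ + 0
det′-01 {n} A A₀≗A₁ = begin
  det′ (columns A) ≡⟨ det′-suc _ ⟩
  ∑ (λ i → sgn (toℕ i) * A zero i * det′ (minor i zero (columns A)))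
    ≡⟨ ∑-cong (λ i → trans (cong (sgn (toℕ i) * A zero i *_) (det′-suc (minor i zero (columns A)))) (sym
        (∑-*ˡ _ _))) ⟩
  ∑ (λ i → ∑ (λ a → sgn (toℕ i) * A zero i * (sgn (toℕ a) * A (suc zero) (punchIn i a) * D (λ b → punchIn i
      (punchIn a b)))))
    ≡⟨ ∑-cong (λ i → ∑-cong (λ a → trans
         (cong (λ z → sgn (toℕ i) * A zero i * (sgn (toℕ a) * z * D (λ b → punchIn i (punchIn a b)))) (sym (A₀≗A₁
             (punchIn i a))))
         (solve 5 (λ s x t y d → s :* x :* (t :* y :* d) := s :* t :* (x :* y :* d)) refl
           (sgn (toℕ i)) (A zero i) (sgn (toℕ a)) (A zero (punchIn i a)) _))) ⟩
  ∑ (λ i → ∑ (λ a → sgn (toℕ i) * sgn (toℕ a) * E i (punchIn i a) (λ b → punchIn i (punchIn a b))))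
    ≡⟨ ∑-antisymmetric n E (λ i j ρ≗ρ' → cong₂ _*_ (*-comm (A zero i) (A zero j))
         (det′-cong (λ a b → cong (A (suc (suc b))) (ρ≗ρ' a)))) ⟩
  + 0 ∎
  where
  open ≡-Reasoning
  D : (Fin n → Fin (suc (suc n))) → ℤ
  D ρ = det′ (λ a b → A (suc (suc b)) (ρ a))
  E : Fin (suc (suc n)) → Fin (suc (suc n)) → (Fin n → Fin (suc (suc n))) → ℤ
  E i j ρ = A zero i * A zero j * D ρ

-- Expand G (x + y) (x + y) = 0. The coefficients `+ 1` are there because linearity is stated for x
-- + c y.
swap-slots : ∀ {N} (G : Vector N → Vector N → ℤ) →
  (∀ {x x' y y'} → x ≗ x' → y ≗ y' → G x y ≡ G x' y') →
  (∀ x x' c y → G (λ i → x i + c * x' i) y ≡ G x y + c * G x' y) →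
  (∀ x y c y' → G x (λ i → y i + c * y' i) ≡ G x y + c * G x y') →
  (∀ x → G x x ≡ + 0) → ∀ x y → G x y ≡ - G y x
swap-slots G G-cong linˡ linʳ alt x y = begin
  G x y ≡⟨ solve 2 (λ u v → u := (con (+ 0) :+ con (+ 1) :* u :+ con (+ 1) :* (v :+ con (+ 1) :* con
      (+ 0))) :- v) refl _ _ ⟩
  (+ 0 + + 1 * G x y + + 1 * (G y x + + 1 * + 0)) - G y x
    ≡⟨ cong (_- G y x) (cong₂ (λ s t → s + + 1 * G x y + + 1 * (G y x + + 1 * t)) (alt x) (alt y)) ⟨
  (G x x + + 1 * G x y + + 1 * (G y x + + 1 * G y y)) - G y x
    ≡⟨ cong (_- G y x) (cong₂ (λ s t → s + + 1 * t) (linʳ x x (+ 1) y) (linʳ y x (+ 1) y)) ⟨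
  (G x (λ i → x i + + 1 * y i) + + 1 * G y (λ i → x i + + 1 * y i)) - G y x ≡⟨ cong (_- G y x) (linˡ x y (+ 1) _) ⟨
  G (λ i → x i + + 1 * y i) (λ i → x i + + 1 * y i) - G y x ≡⟨ cong (_- G y x) (alt _) ⟩
  + 0 - G y x ≡⟨ +-identityˡ _ ⟩
  - G y x ∎
  where open ≡-Reasoning

private
  ≔-idem : ∀ {m N} (A : Fin m → Vector N) j {x} → A j ≗ x → ∀ k → (A [ j ]≔ x) k ≗ A k
  ≔-idem A j {x} p k i with k Fin.≟ j
  ... | yes refl = trans (cong (λ v → v i) (≔-same A j x)) (sym (p i))
  ... | no k≢j   = cong (λ v → v i) (≔-other A j x k k≢j)

  ≔-cong : ∀ {m N} {A B : Fin m → Vector N} j {x y} → (∀ k → k ≢ j → A k ≗ B k) → x ≗ y →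
    ∀ k → (A [ j ]≔ x) k ≗ (B [ j ]≔ y) k
  ≔-cong {A = A} {B} j {x} {y} p q k i with k Fin.≟ j
  ... | yes refl = trans (cong (λ v → v i) (≔-same A j x)) (trans (q i) (sym (cong (λ v → v i) (≔-same B j y))))
  ... | no k≢j   = trans (cong (λ v → v i) (≔-other A j x k k≢j))
    (trans (p k k≢j i) (sym (cong (λ v → v i) (≔-other B j y k k≢j))))

  ≔-comm : ∀ {m N} (A : Fin m → Vector N) {j k} x y → j ≢ k → ∀ l → (A [ j ]≔ x [ k ]≔ y) l ≗ (A [ k ]≔ y [ j ]≔ x) l
  ≔-comm A {j} {k} x y j≢k l i with l Fin.≟ j | l Fin.≟ k
  ... | yes refl | yes refl = ⊥-elim (j≢k refl)
  ... | yes refl | no l≢k = cong (λ v → v i) (trans (≔-other (A [ j ]≔ x) k y l l≢k)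
    (trans (≔-same A j x) (sym (≔-same (A [ k ]≔ y) j x))))
  ... | no l≢j | yes refl = cong (λ v → v i) (trans (≔-same (A [ j ]≔ x) k y)
    (trans (sym (≔-same A k y)) (sym (≔-other (A [ k ]≔ y) j x l l≢j))))
  ... | no l≢j | no l≢k = cong (λ v → v i) (trans (≔-other (A [ j ]≔ x) k y l l≢k) (trans (≔-other A j x l l≢j)
    (sym (trans (≔-other (A [ k ]≔ y) j x l l≢j) (≔-other A k y l l≢k)))))

det-columns-cong : ∀ {n} {A B : Fin n → Vector n} → (∀ j → A j ≗ B j) → det′ (columns A) ≡ det′ (columns B)
det-columns-cong h = det′-cong (λ i j → h j i)

minors-alternating : ∀ {n} → (∀ {j k : Fin n} → j ≢ k → ∀ A → A j ≗ A k → det′ (columns A) ≡ + 0) →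
  ∀ {j k : Fin n} → j ≢ k → ∀ A → A (suc j) ≗ A (suc k) → det′ (columns A) ≡ + 0
minors-alternating alt j≢k A p = trans (det′-suc (columns A)) (∑-zero (λ i → trans
  (cong (sgn (toℕ i) * A zero i *_) (alt j≢k (λ b a → A (suc b) (punchIn i a)) (λ a → p (punchIn i a))))
  (zeroʳ _)))

-- For a later column, exchange it with column 1 at the cost of a sign. The exchange involves no
-- first column, so it follows from alternation of the minors, and the equal columns become
-- adjacent.
alternating-first : ∀ {n} → (∀ {j k : Fin n} → j ≢ k → ∀ A → A j ≗ A k → det′ (columns A) ≡ + 0) →
  ∀ (k : Fin n) A → A zero ≗ A (suc k) → det′ (columns A) ≡ + 0
alternating-first alt zero    A p = det′-01 A p
alternating-first alt (suc k) A p = begin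
  det′ (columns A) ≡⟨ det-columns-cong unchanged ⟨
  G (A 1ᶠ) (A l)
    ≡⟨ swap-slots G (λ q r → det-columns-cong (≔-cong l (λ i _ → ≔-cong 1ᶠ (λ _ _ _ → refl) q i) r))
         (λ x x' c y → trans (det-columns-cong (≔-comm A _ y 1≢l)) (trans (det′-linear 1ᶠ (A [ l ]≔ y) x x' c)
           (cong₂ (λ s t → s + c * t) (det-columns-cong (λ i a → sym (≔-comm A x y 1≢l i a)))
             (det-columns-cong (λ i a → sym (≔-comm A x' y 1≢l i a))))))
         (λ x y c y' → det′-linear l (A [ 1ᶠ ]≔ x) y y' c)
         (λ x → minors-alternating alt (1≢l ∘ cong suc) (A [ 1ᶠ ]≔ x [ l ]≔ x) (λ i →
           cong (λ v → v i) (trans (≔-other (A [ 1ᶠ ]≔ x) l x 1ᶠ 1≢l) (sym (≔-same (A [ 1ᶠ ]≔ x) l x)))))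
         (A 1ᶠ) (A l) ⟩
  - G (A l) (A 1ᶠ) ≡⟨ cong -_ (det′-01 (A [ 1ᶠ ]≔ A l [ l ]≔ A 1ᶠ) p) ⟩
  - (+ 0) ≡⟨ neg-def (+ 0) ⟩
  + 0 ∎
  where
  open ≡-Reasoning
  1ᶠ l : Fin _
  1ᶠ = suc zero
  l = suc (suc k)
  1≢l : 1ᶠ ≢ l
  1≢l ()
  G : Vector _ → Vector _ → ℤ
  G x y = det′ (columns (A [ 1ᶠ ]≔ x [ l ]≔ y))
  unchanged : ∀ j → (A [ 1ᶠ ]≔ A 1ᶠ [ l ]≔ A l) j ≗ A j
  unchanged j i = trans (≔-idem (A [ 1ᶠ ]≔ A 1ᶠ) l (λ i → cong (λ v → v i) (≔-other A 1ᶠ (A 1ᶠ) l (1≢l ∘ sym))) j i)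
    (≔-idem A 1ᶠ (λ i → refl) j i)

det′-alternating : ∀ {n} {j k : Fin n} → j ≢ k → ∀ A → A j ≗ A k → det′ (columns A) ≡ + 0
det′-alternating {suc n} {zero}  {zero}  j≢k A p = ⊥-elim (j≢k refl)
det′-alternating {suc n} {zero}  {suc k} j≢k A p = alternating-first (det′-alternating {n}) k A p
det′-alternating {suc n} {suc j} {zero}  j≢k A p = alternating-first (det′-alternating {n}) j A (λ i → sym (p i))
det′-alternating {suc n} {suc j} {suc k} j≢k A p =
  minors-alternating (det′-alternating {n}) (j≢k ∘ cong suc) A p

det′-form : ∀ n → Alternating n n
det′-form n = record
  { form = λ A → det′ (columns A)
  ; form-cong = det-columns-cong
  ; linear = λ j A x y c → det′-linear j A x y c
  ; alternating = det′-alternating }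

partial : ∀ {m N} → Vector N → Alternating (suc m) N → Alternating m N
partial v F = record
  { form = λ A → form F (v ◂ A)
  ; form-cong = λ h → form-cong F (λ { zero i → refl ; (suc j) i → h j i })
  ; linear = λ j A x y c → trans (form-cong F (shift j A _)) (trans (linear F (suc j) (v ◂ A) x y c)
      (cong₂ (λ s t → s + c * t) (form-cong F (λ k i → sym (shift j A x k i))) (form-cong F (λ k i → sym
          (shift j A y k i)))))
  ; alternating = λ j≢k A p → alternating F (λ { refl → j≢k refl }) (v ◂ A) p }
  where
  shift : ∀ j A x k → (v ◂ (A [ j ]≔ x)) k ≗ ((v ◂ A) [ suc j ]≔ x) k
  shift j A x zero    i = refl
  shift j A x (suc k) i = refl

record Linear (N N' : ℕ) : Set where
  field
    map : Vector N → Vector N'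
    map-cong : ∀ {x y} → x ≗ y → map x ≗ map y
    map-linear : ∀ x y c → map (λ i → x i + c * y i) ≗ (λ i → map x i + c * map y i)

pullback : ∀ {m N N'} → Linear N N' → Alternating m N' → Alternating m N
pullback L F = record
  { form = λ A → form F (map ∘ A)
  ; form-cong = λ h → form-cong F (λ j → map-cong (h j))
  ; linear = λ j A x y c → trans (form-cong F (λ k i → trans (image j A _ k i) (≔-cong j (λ _ _ _ → refl)
      (map-linear x y c) k i)))
      (trans (linear F j (map ∘ A) (map x) (map y) c)
        (cong₂ (λ s t → s + c * t) (form-cong F (λ k i → sym (image j A x k i))) (form-cong F (λ k i → sym
            (image j A y k i)))))
  ; alternating = λ j≢k A p → alternating F j≢k (map ∘ A) (map-cong p) }
  where
  open Linear L
  image : ∀ j A x k → map ((A [ j ]≔ x) k) ≗ ((map ∘ A) [ j ]≔ map x) k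
  image j A x k i with k Fin.≟ j
  ... | yes refl = trans (cong (λ v → map v i) (≔-same A j x)) (sym (cong (λ v → v i) (≔-same (map ∘ A) j (map x))))
  ... | no k≢j   = trans (cong (λ v → map v i) (≔-other A j x k k≢j)) (sym (cong (λ v → v i) (≔-other (map ∘ A) j
      (map x) k k≢j)))

module _ {m N} (F : Alternating m N) where

  form-zero : ∀ j A → form F (A [ j ]≔ (λ _ → + 0)) ≡ + 0
  form-zero j A = begin
    f 0ᵛ ≡⟨ form-cong F (≔-cong j (λ _ _ _ → refl) (λ i → trans (sym (neg-def (+ 0))) (sym (sum-zero)))) ⟩
    f (λ i → + 0 + -[1+ 0 ] * + 0) ≡⟨ linear F j A 0ᵛ 0ᵛ -[1+ 0 ] ⟩
    f 0ᵛ + -[1+ 0 ] * f 0ᵛ ≡⟨ solve 1 (λ x → x :+ con -[1+ 0 ] :* x := con (+ 0)) refl _ ⟩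
    + 0 ∎
    where
    open ≡-Reasoning
    0ᵛ : Vector N
    0ᵛ _ = + 0
    f : Vector N → ℤ
    f x = form F (A [ j ]≔ x)
    sum-zero : + 0 + -[1+ 0 ] * + 0 ≡ - (+ 0)
    sum-zero = solve 0 (con (+ 0) :+ con -[1+ 0 ] :* con (+ 0) := :- (con (+ 0))) refl

  form-comb : ∀ {r} j A (c : Fin r → ℤ) (v : Fin r → Vector N) →
    form F (A [ j ]≔ comb c v) ≡ ∑ (λ k → c k * form F (A [ j ]≔ v k))
  form-comb {zero}  j A c v = trans (form-cong F (≔-cong j (λ _ _ _ → refl) (λ i → ∑-empty _)))
    (trans (form-zero j A) (sym (∑-empty _)))
  form-comb {suc r} j A c v = begin
    f (comb c v)
      ≡⟨ form-cong F (≔-cong j (λ _ _ _ → refl) (λ i → trans (∑-suc _) (+-comm _ _))) ⟩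
    f (λ i → comb (c ∘ suc) (v ∘ suc) i + c zero * v zero i) ≡⟨ linear F j A _ (v zero) (c zero) ⟩
    f (comb (c ∘ suc) (v ∘ suc)) + c zero * f (v zero) ≡⟨ cong (_+ c zero * f (v zero)) (form-comb j A (c ∘ suc)
        (v ∘ suc)) ⟩
    ∑ (λ k → c (suc k) * f (v (suc k))) + c zero * f (v zero) ≡⟨ +-comm _ _ ⟩
    c zero * f (v zero) + ∑ (λ k → c (suc k) * f (v (suc k))) ≡⟨ ∑-suc _ ⟨
    ∑ (λ k → c k * f (v k)) ∎
    where
    open ≡-Reasoning
    f : Vector N → ℤ
    f x = form F (A [ j ]≔ x)

form-swap : ∀ {m N} (F : Alternating (suc (suc m)) N) x y B → form F (x ◂ y ◂ B) ≡ - form F (y ◂ x ◂ B)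
form-swap F x y B = swap-slots (λ x y → form F (x ◂ y ◂ B))
  (λ p q → form-cong F (λ { zero → p ; (suc zero) → q ; (suc (suc j)) i → refl }))
  (λ x x' c y → trans (form-cong F (set₀ y _)) (trans (linear F zero (x ◂ y ◂ B) x x' c)
    (cong₂ (λ s t → s + c * t) (form-cong F (λ j i → sym (set₀ y x j i))) (form-cong F (λ j i → sym
        (set₀ y x' j i))))))
  (λ x y c y' → trans (form-cong F (set₁ x _)) (trans (linear F (suc zero) (x ◂ y ◂ B) y y' c)
    (cong₂ (λ s t → s + c * t) (form-cong F (λ j i → sym (set₁ x y j i))) (form-cong F (λ j i → sym
        (set₁ x y' j i))))))
  (λ x → alternating F {zero} {suc zero} (λ ()) (x ◂ x ◂ B) (λ i → refl)) x y
  where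
  set₀ : ∀ y {x'} x j → (x ◂ y ◂ B) j ≗ ((x' ◂ y ◂ B) [ zero ]≔ x) j
  set₀ y x zero          i = refl
  set₀ y x (suc zero)    i = refl
  set₀ y x (suc (suc j)) i = refl
  set₁ : ∀ x {y'} y j → (x ◂ y ◂ B) j ≗ ((x ◂ y' ◂ B) [ suc zero ]≔ y) j
  set₁ x y zero          i = refl
  set₁ x y (suc zero)    i = refl
  set₁ x y (suc (suc j)) i = refl

form-move : ∀ {m N} (F : Alternating (suc m) N) (g : Fin (suc m) → Vector N) k →
  form F (g k ◂ (g ∘ punchIn k)) ≡ sgn (toℕ k) * form F g
form-move F g zero = trans (form-cong F (λ { zero i → refl ; (suc j) i → refl })) (sym (*-identityˡ _))
form-move {suc m} F g (suc k) = begin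
  form F (g (suc k) ◂ (g ∘ punchIn (suc k)))
    ≡⟨ form-cong F (λ { zero i → refl ; (suc zero) i → refl ; (suc (suc j)) i → refl }) ⟩
  form F (g (suc k) ◂ g zero ◂ (g ∘ suc ∘ punchIn k)) ≡⟨ form-swap F _ _ _ ⟩
  - form F (g zero ◂ g (suc k) ◂ (g ∘ suc ∘ punchIn k)) ≡⟨ cong -_ (form-move (partial (g zero) F) (g ∘ suc) k) ⟩
  - (sgn (toℕ k) * form F (g zero ◂ (g ∘ suc)))
    ≡⟨ solve 2 (λ s x → :- (s :* x) := (:- s) :* x) refl _ _ ⟩
  - sgn (toℕ k) * form F (g zero ◂ (g ∘ suc))
    ≡⟨ cong₂ _*_ (sym (sgn-suc (toℕ k))) (form-cong F (λ { zero i → refl ; (suc j) i → refl })) ⟩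
  sgn (suc (toℕ k)) * form F g ∎
  where open ≡-Reasoning

-- Each added multiple of v repeats the argument v and contributes nothing. Swapping v behind a
-- vector already treated lets `partial` freeze that vector for the recursion.
form-shear : ∀ {m N} (F : Alternating (suc m) N) v (A B : Fin m → Vector N) (c : Fin m → ℤ) →
  (∀ j i → A j i ≡ B j i + c j * v i) → form F (v ◂ A) ≡ form F (v ◂ B)
form-shear {zero}  F v A B c h = form-cong F (λ { zero i → refl ; (suc ()) })
form-shear {suc m} F v A B c h = begin
  form F (v ◂ A)
    ≡⟨ form-cong F (λ { zero i → refl ; (suc zero) i → h zero i ; (suc (suc j)) i → refl }) ⟩
  form F ((v ◂ B zero ◂ (A ∘ suc)) [ suc zero ]≔ (λ i → B zero i + c zero * v i)) ≡⟨ linear F (suc zero) _ _ _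
      (c zero) ⟩
  form F ((v ◂ B zero ◂ (A ∘ suc)) [ suc zero ]≔ B zero) + c zero * form F ((v ◂ B zero ◂ (A ∘ suc)) [ suc zero ]≔ v)
    ≡⟨ cong₂ (λ s t → s + c zero * t) (form-swap' _ (B zero)) (alternating F {zero} {suc zero} (λ ()) _ (λ i →
        refl)) ⟩
  - form F (B zero ◂ v ◂ (A ∘ suc)) + c zero * + 0
    ≡⟨ cong (λ s → - s + c zero * + 0) (form-shear (partial (B zero) F) v (A ∘ suc) (B ∘ suc) (c ∘ suc) (h ∘ suc)) ⟩
  - form F (B zero ◂ v ◂ (B ∘ suc)) + c zero * + 0
    ≡⟨ solve 2 (λ s t → (:- s) :+ t :* con (+ 0) := :- s) refl _ _ ⟩
  - form F (B zero ◂ v ◂ (B ∘ suc)) ≡⟨ form-swap F v (B zero) (B ∘ suc) ⟨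
  form F (v ◂ B zero ◂ (B ∘ suc))
    ≡⟨ form-cong F (λ { zero i → refl ; (suc zero) i → refl ; (suc (suc j)) i → refl }) ⟩
  form F (v ◂ B) ∎
  where
  open ≡-Reasoning
  form-swap' : ∀ w x → form F ((v ◂ w ◂ (A ∘ suc)) [ suc zero ]≔ x) ≡ - form F (x ◂ v ◂ (A ∘ suc))
  form-swap' w x = trans (form-cong F (λ { zero i → refl ; (suc zero) i → refl ; (suc (suc j)) i → refl }))
      (form-swap F v x (A ∘ suc))

-- Uniqueness of the determinant among alternating forms

insert-zero : ∀ {n} → Fin (suc n) → Linear n (suc n)
insert-zero k = record
  { map = insert k
  ; map-cong = insert-cong k
  ; map-linear = insert-linear k }
  where
  insert : ∀ {n} → Fin (suc n) → Vector n → Vector (suc n)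
  insert zero    x zero    = + 0
  insert zero    x (suc i) = x i
  insert {suc n} (suc k) x zero    = x zero
  insert {suc n} (suc k) x (suc i) = insert k (x ∘ suc) i
  insert-cong : ∀ {n} (k : Fin (suc n)) {x y} → x ≗ y → insert k x ≗ insert k y
  insert-cong zero p zero    = refl
  insert-cong zero p (suc i) = p i
  insert-cong {suc n} (suc k) p zero    = p zero
  insert-cong {suc n} (suc k) p (suc i) = insert-cong k (p ∘ suc) i
  insert-linear : ∀ {n} (k : Fin (suc n)) x y c → insert k (λ i → x i + c * y i) ≗ (λ i →
      insert k x i + c * insert k y i)
  insert-linear zero x y c zero    = solve 1 (λ c → con (+ 0) := con (+ 0) :+ c :* con (+ 0)) refl c
  insert-linear zero x y c (suc i) = refl
  insert-linear {suc n} (suc k) x y c zero    = refl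
  insert-linear {suc n} (suc k) x y c (suc i) = insert-linear k (x ∘ suc) (y ∘ suc) c i

insert-zero-punchIn : ∀ {n} (k : Fin (suc n)) (x : Vector (suc n)) i →
  x i ≡ Linear.map (insert-zero k) (x ∘ punchIn k) i + x k * δℤ k i
insert-zero-punchIn zero x zero = solve 1 (λ x → x := con (+ 0) :+ x :* con (+ 1)) refl (x zero)
insert-zero-punchIn zero x (suc i) = solve 2 (λ x y → x := x :+ y :* con (+ 0)) refl (x (suc i)) (x zero)
insert-zero-punchIn {suc n} (suc k) x zero = solve 2 (λ x y → x := x :+ y :* con (+ 0)) refl (x zero) (x (suc k))
insert-zero-punchIn {suc n} (suc k) x (suc i) = trans (insert-zero-punchIn k (x ∘ suc) i)
  (cong (λ z → Linear.map (insert-zero k) (x ∘ suc ∘ punchIn k) i + x (suc k) * z) (sym (δ-suc k i)))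

insert-zero-unit : ∀ {n} (k : Fin (suc n)) j → Linear.map (insert-zero k) (δℤ j) ≗ δℤ (punchIn k j)
insert-zero-unit zero j zero = refl
insert-zero-unit zero j (suc i) = sym (δ-suc j i)
insert-zero-unit {suc n} (suc k) zero    zero    = refl
insert-zero-unit {suc n} (suc k) zero    (suc i) = zeros k i
  where
  zeros : ∀ {n} (k : Fin (suc n)) → Linear.map (insert-zero k) (λ _ → + 0) ≗ (λ _ → + 0)
  zeros zero zero = refl
  zeros zero (suc i) = refl
  zeros {suc n} (suc k) zero = refl
  zeros {suc n} (suc k) (suc i) = zeros k i
insert-zero-unit {suc n} (suc k) (suc j) zero    = refl
insert-zero-unit {suc n} (suc k) (suc j) (suc i) = trans (Linear.map-cong (insert-zero k) (δ-suc j) i)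
  (trans (insert-zero-unit k j i) (sym (δ-suc (punchIn k j) i)))

-- Expand the first vector in unit vectors. Next to the k-th unit vector the k-th coordinates of the
-- others can be sheared away, which leaves an alternating form in one dimension less; `form-move`
-- supplies the sign of the cofactor.
form-unique : ∀ {n} (F : Alternating n n) A → form F A ≡ det′ (columns A) * form F δℤ
form-unique {zero} F A = trans (form-cong F (λ ())) (sym (trans (cong (_* _) (det′-empty _)) (*-identityˡ _)))
form-unique {suc n} F A = begin
  form F A ≡⟨ form-cong F (λ { zero i → sym (trans (∑-cong (λ k → cong (A zero k *_) refl)) (∑-δʳ i (A zero))) ;
      (suc j) i → refl }) ⟩
  form F (A [ zero ]≔ comb (A zero) δℤ) ≡⟨ form-comb F zero A (A zero) δℤ ⟩
  ∑ (λ k → A zero k * form F (A [ zero ]≔ δℤ k)) ≡⟨ ∑-cong term ⟩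
  ∑ (λ k → sgn (toℕ k) * A zero k * det′ (minor k zero (columns A)) * form F δℤ) ≡⟨ ∑-*ʳ _ _ ⟩
  ∑ (λ k → sgn (toℕ k) * A zero k * det′ (minor k zero (columns A))) * form F δℤ
    ≡⟨ cong (_* form F δℤ) (det′-suc (columns A)) ⟨
  det′ (columns A) * form F δℤ ∎
  where
  open ≡-Reasoning
  term : ∀ k → A zero k * form F (A [ zero ]≔ δℤ k) ≡
    sgn (toℕ k) * A zero k * det′ (minor k zero (columns A)) * form F δℤ
  term k = begin
    A zero k * form F (A [ zero ]≔ δℤ k)
      ≡⟨ cong (A zero k *_) (form-cong F (λ { zero i → refl ; (suc j) i → refl })) ⟩
    A zero k * form F (δℤ k ◂ (A ∘ suc))
      ≡⟨ cong (A zero k *_) (form-shear F (δℤ k) _ _ (λ j → A (suc j) k) (λ j → insert-zero-punchIn k (A (suc j)))) ⟩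
    A zero k * form F' (λ j → A (suc j) ∘ punchIn k) ≡⟨ cong (A zero k *_) (form-unique F' _) ⟩
    A zero k * (det′ (minor k zero (columns A)) * form F' δℤ)
      ≡⟨ cong (λ z → A zero k * (det′ (minor k zero (columns A)) * z))
           (trans (form-cong F (λ { zero i → refl ; (suc j) i → insert-zero-unit k j i })) (form-move F δℤ k)) ⟩
    A zero k * (det′ (minor k zero (columns A)) * (sgn (toℕ k) * form F δℤ))
      ≡⟨ solve 4 (λ a d s f → a :* (d :* (s :* f)) := s :* a :* d :* f) refl (A zero k) _ (sgn (toℕ k)) (form F δℤ) ⟩
    sgn (toℕ k) * A zero k * det′ (minor k zero (columns A)) * form F δℤ ∎
    where
    F' : Alternating n n
    F' = pullback (insert-zero k) (partial (δℤ k) F)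

-- The determinant of the product is an alternating form in the columns of B, with value det A at
-- the unit vectors.
det′-⊡ : ∀ {n} (A B : Mat ℤ n) → det′ (A ⊡ B) ≡ det′ A * det′ B
det′-⊡ {n} A B = trans (form-unique (pullback (record
    { map = A ▹_ ; map-cong = ▹-congʳ A ; map-linear = λ x y c i → dot-linʳ c (A i) x y }) (det′-form n)) (λ j i →
        B i j))
  (trans (cong (det′ B *_) (det′-cong (λ i j → trans (∑-cong (λ k → cong (A i k *_) (δ-sym j k))) (∑-δʳ j (A i)))))
    (*-comm _ _))

-- Cramer's rule

adjugate : ∀ {n} → Mat ℤ n → Mat ℤ n
adjugate M i j = det′ (columns ((λ j i → M i j) [ i ]≔ δℤ j))

-- By linearity the entry is the determinant of M with column i replaced by column j, which has a
-- repeated column unless i = j.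
adjugate-inverseˡ : ∀ {n} (M : Mat ℤ n) i j → (adjugate M ⊡ M) i j ≡ det′ M * δℤ i j
adjugate-inverseˡ {n} M i j = trans
  (trans (∑-cong (λ k → *-comm _ (M k j))) (sym (form-comb (det′-form n) i A (A j) δℤ)))
  (trans (det-columns-cong (≔-cong {A = A} {B = A} i (λ _ _ _ → refl) (λ l → ∑-δʳ l (A j)))) value)
  where
  A : Fin n → Vector n
  A j i = M i j
  value : det′ (columns (A [ i ]≔ A j)) ≡ det′ M * δℤ i j
  value with i Fin.≟ j
  ... | yes refl = trans (det-columns-cong (≔-idem A i (λ _ → refl)))
    (sym (*-identityʳ _))
  ... | no i≢j = trans (det′-alternating i≢j (A [ i ]≔ A j)
    (λ l → cong (λ v → v l) (trans (≔-same A i (A j)) (sym (≔-other A i (A j) j (i≢j ∘ sym))))))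
    (sym (zeroʳ _))

-- A second adjugate, so that the inverse on the right needs no further argument.
adjugate' : ∀ {n} → Mat ℤ n → Mat ℤ n
adjugate' M = adjugate (M ᵗ) ᵗ

adjugate-inverseʳ : ∀ {n} (M : Mat ℤ n) i j → (M ⊡ adjugate' M) i j ≡ det′ M * δℤ i j
adjugate-inverseʳ M i j = trans (⊡-ᵗ M (adjugate' M) i j) (trans (adjugate-inverseˡ (M ᵗ) j i)
  (cong₂ _*_ (det′-ᵗ M) (δ-sym j i)))

-- Linear systems

adjugate-▹ : ∀ {n} (M : Mat ℤ n) x i → (adjugate M ▹ (M ▹ x)) i ≡ det′ M * x i
adjugate-▹ M x i = trans (sym (▹-▹ (adjugate M) M x i))
  (trans (▹-congˡ x (adjugate-inverseˡ M) i) (scalar-▹ (det′ M) x i))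

adjugate'-▹ : ∀ {n} (M : Mat ℤ n) x i → (M ▹ (adjugate' M ▹ x)) i ≡ det′ M * x i
adjugate'-▹ M x i = trans (sym (▹-▹ M (adjugate' M) x i))
  (trans (▹-congˡ x (adjugate-inverseʳ M) i) (scalar-▹ (det′ M) x i))

▹-∣ : ∀ {d n} (M : Mat ℤ n) x → (∀ i → d ∣ (M ▹ x) i) → ∀ i → d ∣ det′ M * x i
▹-∣ {d} M x h i = subst (d ∣_) (adjugate-▹ M x i) (∑-∣ (λ k → ∣-*ˡ _ (h k)))

integral-domain : ∀ {a b} → a * b ≡ + 0 → a ≢ + 0 → b ≡ + 0
integral-domain {a} {b} ab≡0 a≢0 with ℤ.i*j≡0⇒i≡0∨j≡0 a {b} (trans (sym (*-def a b)) ab≡0)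
... | inj₁ a≡0 = ⊥-elim (a≢0 a≡0)
... | inj₂ b≡0 = b≡0

▹-zero : ∀ {n} (M : Mat ℤ n) x → det′ M ≢ + 0 → (∀ i → (M ▹ x) i ≡ + 0) → ∀ i → x i ≡ + 0
▹-zero M x det≢0 h i = integral-domain (trans (sym (adjugate-▹ M x i))
  (∑-zero (λ k → trans (cong (adjugate M i k *_) (h k)) (zeroʳ _)))) det≢0

-- Bordered determinants

det′-δ : ∀ n → det′ {n} δℤ ≡ + 1
det′-δ n = mod-0⇒≡ (det′-unitriangular {n = n} δℤ
  (λ i j j<i → subst (+ 0 ∣_) (sym (δ-≢ {i = i} {j} (λ { refl → ℕ.<-irrefl refl j<i }))) ∣-0)
  (λ i → mod-reflexive (δ-refl i)))

bordered : ∀ {n} → ℤ → Vector n → Vector n → Mat ℤ n → Mat ℤ (suc n)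
bordered a r c M zero    zero    = a
bordered a r c M zero    (suc j) = r j
bordered a r c M (suc i) zero    = c i
bordered a r c M (suc i) (suc j) = M i j

0ᵛ 1ᵛ : ∀ {n} → Vector n
0ᵛ _ = + 0
1ᵛ _ = + 1

bordered-column : ∀ {n} a r (M : Mat ℤ n) → det′ (bordered a r 0ᵛ M) ≡ a * det′ M
bordered-column a r M = begin
  det′ X ≡⟨ det′-suc X ⟩
  ∑ (λ i → sgn (toℕ i) * X i zero * det′ (minor i zero X)) ≡⟨ ∑-suc _ ⟩
  + 1 * a * det′ M + ∑ (λ i → sgn (suc (toℕ i)) * + 0 * det′ (minor (suc i) zero X))
    ≡⟨ cong₂ _+_ (cong (_* det′ M) (*-identityˡ a))
         (∑-zero (λ i → trans (cong (_* det′ (minor (suc i) zero X)) (zeroʳ (sgn (suc (toℕ i))))) (zeroˡ _))) ⟩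
  a * det′ M + + 0 ≡⟨ +-identityʳ _ ⟩
  a * det′ M ∎
  where
  open ≡-Reasoning
  X = bordered a r 0ᵛ M

bordered-row : ∀ {n} a c (M : Mat ℤ n) → det′ (bordered a 0ᵛ c M) ≡ a * det′ M
bordered-row a c M = begin
  det′ (bordered a 0ᵛ c M) ≡⟨ det′-ᵗ _ ⟨
  det′ (bordered a 0ᵛ c M ᵗ)
    ≡⟨ det′-cong (λ { zero zero → refl ; zero (suc j) → refl ; (suc i) zero → refl ; (suc i) (suc j) → refl }) ⟩
  det′ (bordered a c 0ᵛ (M ᵗ)) ≡⟨ bordered-column a c (M ᵗ) ⟩
  a * det′ (M ᵗ) ≡⟨ cong (a *_) (det′-ᵗ M) ⟩
  a * det′ M ∎
  where open ≡-Reasoning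

-- The Schur complement, multiplied through by the determinant of M.
det′-bordered : ∀ {n} a r c (M : Mat ℤ n) u → det′ M ≢ + 0 →
  (∀ i → (M ▹ u) i ≡ det′ M * c i) → det′ (bordered a r c M) ≡ a * det′ M - dot r u
det′-bordered {n} a r c M u d≢0 Mu≡dc = ℤ.*-cancelʳ-≡ _ _ d {{ℤ.≢-nonZero d≢0}} (trans (sym (*-def _ _))
  (trans (begin
    det′ X * d ≡⟨ cong (det′ X *_) detY ⟨
    det′ X * det′ Y ≡⟨ det′-⊡ X Y ⟨
    det′ (X ⊡ Y) ≡⟨ det′-cong product ⟩
    det′ (bordered (a * d - dot r u) r 0ᵛ M) ≡⟨ bordered-column _ r M ⟩
    (a * d - dot r u) * d ∎) (*-def _ _)))
  where
  open ≡-Reasoning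
  d = det′ M
  X = bordered a r c M
  Y = bordered d 0ᵛ (λ i → - u i) δℤ
  detY : det′ Y ≡ d
  detY = trans (bordered-row d _ δℤ) (trans (cong (d *_) (det′-δ n)) (*-identityʳ d))
  neg-dot : ∀ (x : Vector n) → dot x (λ i → - u i) ≡ - dot x u
  neg-dot x = trans (∑-cong (λ i → solve 2 (λ x y → x :* (:- y) := :- (x :* y)) refl (x i) (u i))) (∑-neg _)
  product : ∀ i j → (X ⊡ Y) i j ≡ bordered (a * d - dot r u) r 0ᵛ M i j
  product zero    zero    = trans (∑-suc _) (cong (_+_ (a * d)) (neg-dot r))
  product zero    (suc j) = trans (∑-suc _) (trans (cong₂ _+_ (zeroʳ a) (∑-δʳ j r)) (+-identityˡ _))
  product (suc i) zero    = trans (∑-suc _) (trans (cong (_+_ (c i * d)) (trans (neg-dot (M i)) (cong -_ (Mu≡dc i))))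
    (solve 2 (λ c d → c :* d :- d :* c := con (+ 0)) refl (c i) d))
  product (suc i) (suc j) = trans (∑-suc _) (trans (cong₂ _+_ (zeroʳ (c i)) (∑-δʳ j (M i))) (+-identityˡ _))

-- With N = M - J the bordered matrix factors into block triangular matrices with diagonals (1, N)
-- and (1, I).
det′-minus-J : ∀ {n} (M : Mat ℤ n) → det′ (λ i j → M i j - + 1) ≡ det′ (bordered (+ 1) 1ᵛ 1ᵛ M)
det′-minus-J {n} M = sym (begin
  det′ (bordered (+ 1) 1ᵛ 1ᵛ M) ≡⟨ det′-cong product ⟨
  det′ (X ⊡ Y) ≡⟨ det′-⊡ X Y ⟩
  det′ X * det′ Y ≡⟨ cong₂ _*_ (bordered-row (+ 1) 1ᵛ N) (trans (bordered-column (+ 1) 1ᵛ δℤ) (cong (+ 1 *_)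
      (det′-δ n))) ⟩
  + 1 * det′ N * (+ 1 * + 1) ≡⟨ solve 1 (λ x → con (+ 1) :* x :* (con (+ 1) :* con (+ 1)) := x) refl (det′ N) ⟩
  det′ N ∎)
  where
  open ≡-Reasoning
  N : Mat ℤ _
  N i j = M i j - + 1
  X = bordered (+ 1) 0ᵛ 1ᵛ N
  Y = bordered (+ 1) 1ᵛ 0ᵛ δℤ
  product : ∀ i j → (X ⊡ Y) i j ≡ bordered (+ 1) 1ᵛ 1ᵛ M i j
  product zero    zero    = trans (∑-suc _) (trans (cong (_+_ _) (∑-zero (λ k → zeroʳ (+ 0)))) (solve 0 (con
      (+ 1) :* con (+ 1) :+ con (+ 0) := con (+ 1)) refl))
  product zero    (suc j) = trans (∑-suc _) (trans (cong (_+_ _) (∑-zero (λ k → zeroˡ (δℤ k j)))) (solve 0 (con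
      (+ 1) :* con (+ 1) :+ con (+ 0) := con (+ 1)) refl))
  product (suc i) zero    = trans (∑-suc _) (trans (cong (_+_ _) (∑-zero (λ k → zeroʳ (N i k)))) (solve 0 (con
      (+ 1) :* con (+ 1) :+ con (+ 0) := con (+ 1)) refl))
  product (suc i) (suc j) = trans (∑-suc _) (trans (cong (_+_ _) (∑-δʳ j (N i)))
    (solve 1 (λ x → con (+ 1) :* con (+ 1) :+ (x :- con (+ 1)) := x) refl (M i j)))

-- Absolute values

abs-+ : ∀ a b → ∣ a + b ∣ ℕ.≤ ∣ a ∣ ℕ.+ ∣ b ∣
abs-+ a b = subst (λ z → ∣ z ∣ ℕ.≤ ∣ a ∣ ℕ.+ ∣ b ∣) (sym (+-def a b)) (ℤ.∣i+j∣≤∣i∣+∣j∣ a b)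

abs-neg : ∀ a → ∣ - a ∣ ≡ ∣ a ∣
abs-neg a = trans (cong ∣_∣ (neg-def a)) (ℤ.∣-i∣≡∣i∣ a)

abs-* : ∀ a b → ∣ a * b ∣ ≡ ∣ a ∣ ℕ.* ∣ b ∣
abs-* a b = trans (cong ∣_∣ (*-def a b)) (ℤ.abs-* a b)

∥_∥ : ∀ {n} → Vector n → ℕ
∥_∥ {zero}  x = 0
∥_∥ {suc n} x = ∣ x zero ∣ ℕ.+ ∥ x ∘ suc ∥

dot-bound : ∀ {n} b (x u : Vector n) → (∀ i → ∣ x i ∣ ℕ.≤ b) → ∣ dot x u ∣ ℕ.≤ b ℕ.* ∥ u ∥
dot-bound {zero}  b x u h = ℕ.≤-trans (ℕ.≤-reflexive (cong ∣_∣ (∑-empty _))) ℕ.z≤n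
dot-bound {suc n} b x u h = begin
  ∣ dot x u ∣ ≡⟨ cong ∣_∣ (∑-suc _) ⟩
  ∣ x zero * u zero + dot (x ∘ suc) (u ∘ suc) ∣ ≤⟨ abs-+ (x zero * u zero) _ ⟩
  ∣ x zero * u zero ∣ ℕ.+ ∣ dot (x ∘ suc) (u ∘ suc) ∣
    ≤⟨ ℕ.+-mono-≤ (ℕ.≤-trans (ℕ.≤-reflexive (abs-* (x zero) (u zero))) (ℕ.*-monoˡ-≤ _ (h zero))) (dot-bound b
        (x ∘ suc) (u ∘ suc) (h ∘ suc)) ⟩
  b ℕ.* ∣ u zero ∣ ℕ.+ b ℕ.* ∥ u ∘ suc ∥ ≡⟨ ℕ.*-distribˡ-+ b _ _ ⟨
  b ℕ.* ∥ u ∥ ∎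
  where open ℕ.≤-Reasoning

norm-bound : ∀ {n} y b (u : Vector n) → (∀ i → y ℕ.* ∣ u i ∣ ℕ.≤ b) → y ℕ.* ∥ u ∥ ℕ.≤ n ℕ.* b
norm-bound {zero}  y b u h = ℕ.≤-reflexive (ℕ.*-zeroʳ y)
norm-bound {suc n} y b u h = ℕ.≤-trans (ℕ.≤-reflexive (ℕ.*-distribˡ-+ y _ _))
  (ℕ.+-mono-≤ (h zero) (norm-bound y b (u ∘ suc) (h ∘ suc)))

norm-≤ : ∀ {n} b (u : Vector n) → (∀ i → ∣ u i ∣ ℕ.≤ b) → ∥ u ∥ ℕ.≤ n ℕ.* b
norm-≤ b u h = ℕ.≤-trans (ℕ.≤-reflexive (sym (ℕ.*-identityˡ _)))
  (norm-bound 1 b u (λ i → ℕ.≤-trans (ℕ.≤-reflexive (ℕ.*-identityˡ _)) (h i)))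

-- Walk vectors of skew matrices and the Johnson–Newman argument

Bounded : ∀ {n} → Mat ℤ n → Set
Bounded S = ∀ i j → ∣ S i j ∣ ℕ.≤ 1

Skew : ∀ {n} → Mat ℤ n → Set
Skew S = ∀ i j → S i j ≡ - S j i

walkVec-suc : ∀ {n} (S : Mat ℤ n) k → walkVec S (suc k) ≗ S ▹ walkVec S k
walkVec-suc {n} S k i = trans (go n (λ j → j)) (sym (∑-def _))
  where
  go : ∀ m (ρ : Fin m → Fin n) →
    sumℤ (λ j → S i (ρ j) ℤ.* walkVec S k (ρ j)) ≡ sumℤ (λ j → S i (ρ j) * walkVec S k (ρ j))
  go zero    ρ = refl
  go (suc m) ρ = cong₂ ℤ._+_ (sym (*-def _ _)) (go m (ρ ∘ suc))

skew-▹ : ∀ {n} {S : Mat ℤ n} → Skew S → ∀ x y → dot (S ▹ x) y ≡ - dot x (S ▹ y)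
skew-▹ {S = S} sk x y = begin
  dot (S ▹ x) y ≡⟨ dot-▹ S x y ⟩
  dot x (S ᵗ ▹ y) ≡⟨ ∑-cong (λ i → cong (x i *_) (trans (∑-cong (λ k → trans (cong (_* y k) (sk k i))
      (solve 2 (λ a b → (:- a) :* b := :- (a :* b)) refl (S i k) (y k)))) (∑-neg _))) ⟩
  dot x (λ i → - (S ▹ y) i) ≡⟨ trans (∑-cong (λ i → solve 2 (λ a b → a :* (:- b) := :- (a :* b)) refl (x i) _))
      (∑-neg _) ⟩
  - dot x (S ▹ y) ∎
  where open ≡-Reasoning

walks : ∀ {n} → Mat ℤ n → ℕ → ℤ
walks S k = dot 1ᵛ (walkVec S k)

shifted : ∀ {n} → ℕ → Mat ℤ n → Mat ℤ n
shifted y S i j = + y * δℤ i j + S i j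

shifted-▹ : ∀ {n} y (S : Mat ℤ n) u i → (shifted y S ▹ u) i ≡ + y * u i + (S ▹ u) i
shifted-▹ y S u i = trans (∑-cong (λ k → distribʳ (u k) _ _)) (trans (∑-+ _ _)
  (cong (_+ (S ▹ u) i) (scalar-▹ (+ y) u i)))

-- Row by row, y |uᵢ| ≤ |d| + ‖u‖ in the ℓ¹ norm. Summation gives n (L + 1) ‖u‖ ≤ n (|d| + ‖u‖), and
-- one ‖u‖ cancels.
solution-bound : ∀ {n} {S : Mat ℤ n} → Bounded S → ∀ y L d (c u : Vector n) → n ℕ.* suc L ℕ.≤ y → (∀ i →
    ∣ c i ∣ ℕ.≤ 1) →
  (∀ i → (shifted y S ▹ u) i ≡ d * c i) → L ℕ.* ∥ u ∥ ℕ.≤ ∣ d ∣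
solution-bound {zero}  bd y L d c u le hc hu = ℕ.≤-trans (ℕ.≤-reflexive (ℕ.*-zeroʳ L)) ℕ.z≤n
solution-bound {suc n} {S} bd y L d c u le hc hu = ℕ.+-cancelʳ-≤ ∥ u ∥ _ _ (ℕ.*-cancelˡ-≤ (suc n) (begin
  suc n ℕ.* (L ℕ.* ∥ u ∥ ℕ.+ ∥ u ∥) ≡⟨ trans (cong (suc n ℕ.*_) (ℕ.+-comm (L ℕ.* ∥ u ∥) _)) (sym (ℕ.*-assoc (suc n)
      (suc L) ∥ u ∥)) ⟩
  suc n ℕ.* suc L ℕ.* ∥ u ∥ ≤⟨ ℕ.*-monoˡ-≤ ∥ u ∥ le ⟩
  y ℕ.* ∥ u ∥ ≤⟨ norm-bound y (∣ d ∣ ℕ.+ ∥ u ∥) u each ⟩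
  suc n ℕ.* (∣ d ∣ ℕ.+ ∥ u ∥) ∎))
  where
  open ℕ.≤-Reasoning
  each : ∀ i → y ℕ.* ∣ u i ∣ ℕ.≤ ∣ d ∣ ℕ.+ ∥ u ∥
  each i = begin
    y ℕ.* ∣ u i ∣ ≡⟨ abs-* (+ y) (u i) ⟨
    ∣ + y * u i ∣
      ≡⟨ cong ∣_∣ (trans (solve 2 (λ a b → a := (a :+ b) :- b) refl (+ y * u i) ((S ▹ u) i))
           (cong (_- (S ▹ u) i) (trans (sym (shifted-▹ y S u i)) (hu i)))) ⟩
    ∣ d * c i - (S ▹ u) i ∣ ≤⟨ abs-+ (d * c i) _ ⟩
    ∣ d * c i ∣ ℕ.+ ∣ - (S ▹ u) i ∣ ≡⟨ cong₂ ℕ._+_ (abs-* d (c i)) (abs-neg ((S ▹ u) i)) ⟩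
    ∣ d ∣ ℕ.* ∣ c i ∣ ℕ.+ ∣ (S ▹ u) i ∣
      ≤⟨ ℕ.+-mono-≤ (ℕ.≤-trans (ℕ.*-monoʳ-≤ ∣ d ∣ (hc i)) (ℕ.≤-reflexive (ℕ.*-identityʳ ∣ d ∣)))
           (ℕ.≤-trans (dot-bound 1 (S i) u (bd i)) (ℕ.≤-reflexive (ℕ.*-identityˡ _))) ⟩
    ∣ d ∣ ℕ.+ ∥ u ∥ ∎

-- Induction through the Schur complement: a vanishing determinant means a d = r·u, but |a| ≥ 2,
-- while `solution-bound` with L = 1 gives |r·u| ≤ |d|, and d ≠ 0 by induction.
det′-shifted-≢0 : ∀ {n} {S : Mat ℤ n} → Bounded S → ∀ y → n ℕ.* 2 ℕ.< y → det′ (shifted y S) ≢ + 0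
det′-shifted-≢0 {zero}  bd y le eq with trans (sym (det′-empty _)) eq
... | ()
det′-shifted-≢0 {suc n} {S} bd y le eq = ℕ.<-irrefl refl (begin-strict
  ∣ d ∣ <⟨ ℕ.m<m*n ∣ d ∣ 2 {{ℕ.≢-nonZero (d≢0 ∘ ℤ.∣i∣≡0⇒i≡0)}} (ℕ.s≤s (ℕ.s≤s ℕ.z≤n)) ⟩
  ∣ d ∣ ℕ.* 2 ≤⟨ ℕ.*-monoʳ-≤ ∣ d ∣ 2≤a ⟩
  ∣ d ∣ ℕ.* ∣ a ∣ ≡⟨ ℕ.*-comm ∣ d ∣ ∣ a ∣ ⟩
  ∣ a ∣ ℕ.* ∣ d ∣ ≡⟨ abs-* a d ⟨
  ∣ a * d ∣ ≡⟨ cong ∣_∣ ad≡ru ⟩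
  ∣ dot r u ∣ ≤⟨ dot-bound 1 r u (λ i → bd zero (suc i)) ⟩
  1 ℕ.* ∥ u ∥ ≤⟨ solution-bound {S = S'} (λ i j → bd (suc i) (suc j)) y 1 d c u
                                              (ℕ.≤-trans (ℕ.m≤n+m (n ℕ.* 2) 2) (ℕ.<⇒≤ le)) (λ i → bd
                                                  (suc i) zero) Mu ⟩
  ∣ d ∣ ∎)
  where
  open ℕ.≤-Reasoning
  S' = λ i j → S (suc i) (suc j)
  M = shifted y S'
  d = det′ M
  a = + y * + 1 + S zero zero
  r c u : Vector n
  r j = S zero (suc j)
  c i = S (suc i) zero
  u = adjugate' M ▹ c
  Mu = adjugate'-▹ M c
  d≢0 : d ≢ + 0
  d≢0 = det′-shifted-≢0 {S = S'} (λ i j → bd (suc i) (suc j)) y (ℕ.≤-trans (ℕ.s≤s (ℕ.m≤n+m (n ℕ.* 2) 2)) le)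
  entries : ∀ i j → shifted y S i j ≡ bordered a r c M i j
  entries zero zero = refl
  entries zero (suc j) = solve 2 (λ y s → y :* con (+ 0) :+ s := s) refl (+ y) _
  entries (suc i) zero = solve 2 (λ y s → y :* con (+ 0) :+ s := s) refl (+ y) _
  entries (suc i) (suc j) = cong (λ z → + y * z + S (suc i) (suc j)) (δ-suc i j)
  ad≡ru : a * d ≡ dot r u
  ad≡ru = trans (solve 2 (λ s t → s := (s :- t) :+ t) refl (a * d) (dot r u))
    (trans (cong (_+ dot r u) (trans (sym (det′-bordered a r c M u d≢0 Mu))
      (trans (sym (det′-cong entries)) eq))) (+-identityˡ _))
  2≤a : 2 ℕ.≤ ∣ a ∣
  2≤a = ℕ.+-cancelʳ-≤ 1 2 ∣ a ∣ (begin
    3 ≤⟨ ℕ.≤-trans (ℕ.m≤m+n 3 (n ℕ.* 2)) le ⟩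
    y ≡⟨ cong ∣_∣ (solve 2 (λ y s → y :* con (+ 1) :+ s :- s := y) refl (+ y) (S zero zero)) ⟨
    ∣ a - S zero zero ∣ ≤⟨ abs-+ a _ ⟩
    ∣ a ∣ ℕ.+ ∣ - S zero zero ∣ ≤⟨ ℕ.+-monoʳ-≤ ∣ a ∣ (ℕ.≤-trans (ℕ.≤-reflexive (abs-neg _)) (bd zero zero)) ⟩
    ∣ a ∣ ℕ.+ 1 ∎)

opaque
  unfolding _+_

  charPoly-def : ∀ {n} (M : Mat ℤ n) x → charPoly M x ≡ det′ (λ i j → x * δℤ i j - M i j)
  charPoly-def M x = refl

-- Transposition turns y - S into y + S.
charPoly-skew : ∀ {n} {S : Mat ℤ n} → Skew S → ∀ y → charPoly S (+ y) ≡ det′ (shifted y S)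
charPoly-skew {S = S} sk y = trans (charPoly-def S (+ y)) (trans (sym (det′-ᵗ _))
  (det′-cong (λ i j → cong₂ (λ s t → + y * s + t) (δ-sym j i) (sym (sk i j)))))

-- The argument y - 1 absorbs the identity in J - I - S: the matrix becomes (y + S) - J, to which
-- `det′-minus-J` applies.
charPoly-compl : ∀ {n} (S : Mat ℤ n) y → charPoly (complMat S) (+ y - + 1) ≡ det′ (bordered (+ 1) 1ᵛ 1ᵛ (shifted y S))
charPoly-compl S y = trans (charPoly-def (complMat S) _) (trans (det′-cong (λ i j →
  trans (cong (λ z → (+ y - + 1) * δℤ i j - z) (entry (δℤ i j) (S i j)))
    (solve 3 (λ y d s → (y :- con (+ 1)) :* d :- (con (+ 1) :- d :- s) := (y :* d :+ s) :- con (+ 1)) refl (+ y)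
        (δℤ i j) (S i j))))
  (det′-minus-J (shifted y S)))
  where
  entry : ∀ d s → + 1 ℤ.- d ℤ.- s ≡ + 1 - d - s
  entry d s = sym (trans (+-def _ _) (cong₂ ℤ._+_ (trans (+-def _ _) (cong (ℤ._+_ (+ 1)) (neg-def d))) (neg-def s)))

-- The resolvent vector u solves (y + S) u = det (y + S) 1.
module Resolvent {n} {S : Mat ℤ n} (sk : Skew S) (bd : Bounded S) (y L : ℕ) (le : n ℕ.* suc L ℕ.≤ y) (le' : n ℕ.* 2 ℕ.< y) where

  d : ℤ
  d = det′ (shifted y S)

  u : Vector n
  u = adjugate' (shifted y S) ▹ 1ᵛ

  t : ℕ → ℤ
  t k = dot (walkVec S k) u

  t-zero : t 0 ≡ d - det′ (bordered (+ 1) 1ᵛ 1ᵛ (shifted y S))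
  t-zero = trans (solve 2 (λ d t → t := d :- (con (+ 1) :* d :- t)) refl d (t 0))
    (cong (λ z → d - z) (sym (det′-bordered (+ 1) 1ᵛ 1ᵛ (shifted y S) u (det′-shifted-≢0 bd y le') (adjugate'-▹
        (shifted y S) 1ᵛ))))

  -- Move S across the product with a sign and substitute Su = d e - y u. Read backwards, d times
  -- the k-th walk number is y t(k) - t(k+1).
  t-suc : ∀ k → t (suc k) ≡ + y * t k - d * walks S k
  t-suc k = begin
    dot (walkVec S (suc k)) u ≡⟨ dot-cong (walkVec-suc S k) (λ _ → refl) ⟩
    dot (S ▹ walkVec S k) u ≡⟨ skew-▹ sk _ u ⟩
    - dot x (S ▹ u) ≡⟨ cong -_ (dot-cong {x = x} (λ _ → refl) Su) ⟩
    - dot x (λ i → d * + 1 + (- (+ y)) * u i) ≡⟨ cong -_ (trans (dot-linʳ (- (+ y)) x _ u) (cong (_+ (-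
        (+ y)) * t k) (dot-*ʳ d x 1ᵛ))) ⟩
    - (d * dot x 1ᵛ + (- (+ y)) * t k)
      ≡⟨ solve 4 (λ d w y t → :- (d :* w :+ (:- y) :* t) := y :* t :- d :* w) refl d (dot x 1ᵛ) (+ y) (t k) ⟩
    + y * t k - d * dot x 1ᵛ ≡⟨ cong (λ z → + y * t k - d * z) (dot-comm x 1ᵛ) ⟩
    + y * t k - d * walks S k ∎
    where
    open ≡-Reasoning
    x = walkVec S k
    Su : S ▹ u ≗ λ i → d * + 1 + (- (+ y)) * u i
    Su i = trans (solve 3 (λ s y u → s := (y :* u :+ s) :+ (:- y) :* u) refl ((S ▹ u) i) (+ y) (u i))
      (cong (_+ (- (+ y)) * u i) (trans (sym (shifted-▹ y S u i)) (adjugate'-▹ (shifted y S) 1ᵛ i)))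

  walk-bound : ∀ k i → ∣ walkVec S k i ∣ ℕ.≤ n ℕ.^ k
  walk-bound zero    i = ℕ.≤-refl
  walk-bound (suc k) i = begin
    ∣ walkVec S (suc k) i ∣ ≡⟨ cong ∣_∣ (walkVec-suc S k i) ⟩
    ∣ (S ▹ walkVec S k) i ∣ ≤⟨ dot-bound 1 (S i) _ (bd i) ⟩
    1 ℕ.* ∥ walkVec S k ∥ ≡⟨ ℕ.*-identityˡ _ ⟩
    ∥ walkVec S k ∥ ≤⟨ norm-≤ _ _ (walk-bound k) ⟩
    n ℕ.* n ℕ.^ k ∎
    where open ℕ.≤-Reasoning

  t-bound : ∀ k → L ℕ.* ∣ t k ∣ ℕ.≤ n ℕ.^ k ℕ.* ∣ d ∣
  t-bound k = begin
    L ℕ.* ∣ t k ∣ ≤⟨ ℕ.*-monoʳ-≤ L (dot-bound (n ℕ.^ k) _ u (walk-bound k)) ⟩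
    L ℕ.* (n ℕ.^ k ℕ.* ∥ u ∥) ≡⟨ trans (sym (ℕ.*-assoc L (n ℕ.^ k) ∥ u ∥))
      (trans (cong (ℕ._* ∥ u ∥) (ℕ.*-comm L (n ℕ.^ k))) (ℕ.*-assoc (n ℕ.^ k) L ∥ u ∥)) ⟩
    n ℕ.^ k ℕ.* (L ℕ.* ∥ u ∥) ≤⟨ ℕ.*-monoʳ-≤ (n ℕ.^ k) (solution-bound bd y L d 1ᵛ u le (λ _ → ℕ.≤-refl)
        (adjugate'-▹ (shifted y S) 1ᵛ)) ⟩
    n ℕ.^ k ℕ.* ∣ d ∣ ∎
    where open ℕ.≤-Reasoning

module _ {n} {S S' : Mat ℤ n} (sk : Skew S) (sk' : Skew S') (bd : Bounded S) (bd' : Bounded S')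
  (spec : SameSpectrum S S') (cospec : SameSpectrum (complMat S) (complMat S')) where

  -- The recursion for t makes t(0), ..., t(k) agree, so d times the difference Δ of the k-th walk
  -- numbers is a difference of two values t(k+1). At a large y these are small compared with d, so
  -- the integer Δ is 0. One evaluation point replaces the expansion of the resolvent as a power
  -- series.
  walks-equal-step : ∀ k → (∀ {j} → j ℕ.< k → walks S j ≡ walks S' j) → walks S k ≡ walks S' k
  walks-equal-step k IH = difference (ℕ.n<1⇒n≡0 (ℕ.*-cancelˡ-< (L ℕ.* ∣ R.d ∣) _ 1 (begin-strict
    L ℕ.* ∣ R.d ∣ ℕ.* ∣ Δ ∣ ≡⟨ ℕ.*-assoc L ∣ R.d ∣ ∣ Δ ∣ ⟩
    L ℕ.* (∣ R.d ∣ ℕ.* ∣ Δ ∣) ≡⟨ cong (L ℕ.*_) (trans (sym (abs-* R.d Δ)) (cong ∣_∣ dΔ)) ⟩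
    L ℕ.* ∣ R'.t (suc k) - R.t (suc k) ∣
      ≤⟨ ℕ.*-monoʳ-≤ L (ℕ.≤-trans (abs-+ _ _) (ℕ.≤-reflexive (cong (∣ R'.t (suc k) ∣ ℕ.+_) (abs-neg (R.t
          (suc k)))))) ⟩
    L ℕ.* (∣ R'.t (suc k) ∣ ℕ.+ ∣ R.t (suc k) ∣) ≡⟨ ℕ.*-distribˡ-+ L ∣ R'.t (suc k) ∣ ∣ R.t (suc k) ∣ ⟩
    L ℕ.* ∣ R'.t (suc k) ∣ ℕ.+ L ℕ.* ∣ R.t (suc k) ∣ ≤⟨ ℕ.+-mono-≤ (R'.t-bound (suc k)) (R.t-bound (suc k)) ⟩
    n ℕ.^ suc k ℕ.* ∣ R'.d ∣ ℕ.+ n ℕ.^ suc k ℕ.* ∣ R.d ∣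
      ≡⟨ cong (λ z → n ℕ.^ suc k ℕ.* ∣ z ∣ ℕ.+ n ℕ.^ suc k ℕ.* ∣ R.d ∣) d≡d' ⟨
    n ℕ.^ suc k ℕ.* ∣ R.d ∣ ℕ.+ n ℕ.^ suc k ℕ.* ∣ R.d ∣ ≡⟨ ℕ.*-distribʳ-+ ∣ R.d ∣ (n ℕ.^ suc k) (n ℕ.^ suc k) ⟨
    (n ℕ.^ suc k ℕ.+ n ℕ.^ suc k) ℕ.* ∣ R.d ∣
      <⟨ ℕ.*-monoˡ-< ∣ R.d ∣ {{ℕ.≢-nonZero (d≢0 ∘ ℤ.∣i∣≡0⇒i≡0)}} (ℕ.n<1+n (n ℕ.^ suc k ℕ.+ n ℕ.^ suc k)) ⟩
    L ℕ.* ∣ R.d ∣ ≡⟨ ℕ.*-identityʳ (L ℕ.* ∣ R.d ∣) ⟨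
    L ℕ.* ∣ R.d ∣ ℕ.* 1 ∎)))
    where
    open ℕ.≤-Reasoning
    -- Each of the two values t(k+1), times L, is at most n^(k+1) |d|, so L must exceed 2 n^(k+1).
    L = suc (n ℕ.^ suc k ℕ.+ n ℕ.^ suc k)
    -- A sum, so that y meets both lower bounds required by `Resolvent`.
    y = n ℕ.* suc L ℕ.+ suc (n ℕ.* 2)
    module R = Resolvent sk bd y L (ℕ.m≤m+n _ _) (ℕ.m≤n+m _ _)
    module R' = Resolvent sk' bd' y L (ℕ.m≤m+n _ _) (ℕ.m≤n+m _ _)
    Δ = walks S k - walks S' k
    d≢0 : R.d ≢ + 0
    d≢0 = det′-shifted-≢0 bd y (ℕ.m≤n+m _ _)
    d≡d' : R.d ≡ R'.d
    d≡d' = trans (sym (charPoly-skew sk y)) (trans (spec (+ y)) (charPoly-skew sk' y))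
    t≡t' : ∀ j → j ℕ.≤ k → R.t j ≡ R'.t j
    t≡t' zero    le = trans R.t-zero (trans (cong₂ _-_ d≡d'
      (trans (sym (charPoly-compl S y)) (trans (cospec (+ y - + 1)) (charPoly-compl S' y)))) (sym R'.t-zero))
    t≡t' (suc j) le = trans (R.t-suc j) (trans (cong₂ (λ s r → + y * s - r) (t≡t' j (ℕ.<⇒≤ le))
      (cong₂ _*_ d≡d' (IH le))) (sym (R'.t-suc j)))
    dΔ : R.d * Δ ≡ R'.t (suc k) - R.t (suc k)
    dΔ = trans (solve 4 (λ d w w' yt → d :* (w :- w') := (yt :- d :* w') :- (yt :- d :* w)) refl R.d (walks S k)
        (walks S' k) (+ y * R.t k))
      (cong₂ _-_ (trans (cong₂ (λ s r → + y * s - r * walks S' k) (t≡t' k ℕ.≤-refl) d≡d') (sym (R'.t-suc k))) (sym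
          (R.t-suc k)))
    difference : ∣ Δ ∣ ≡ 0 → walks S k ≡ walks S' k
    difference eq = trans (solve 2 (λ s t → s := (s :- t) :+ t) refl (walks S k) (walks S' k))
      (trans (cong (_+ walks S' k) (ℤ.∣i∣≡0⇒i≡0 eq)) (+-identityˡ _))

  walks-equal : ∀ k → walks S k ≡ walks S' k
  walks-equal = <-rec _ walks-equal-step

-- Primes

∣⇒∣ℕ : ∀ {d a} → d ∣ a → ∣ d ∣ ℕ.∣ ∣ a ∣
∣⇒∣ℕ {d} (divides q e) = ℕ.divides ∣ q ∣ (trans (cong ∣_∣ e) (abs-* q d))

∣ℕ⇒∣ : ∀ {d a} → ∣ d ∣ ℕ.∣ ∣ a ∣ → d ∣ a
∣ℕ⇒∣ {d} {a} h with ℤˢ.∣ᵤ⇒∣ {d} {a} h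
... | ℤˢ.divides q e = divides q (trans e (sym (*-def q d)))

infix 4 _∣?_
_∣?_ : ∀ d a → Dec (d ∣ a)
d ∣? a = Dec.map′ (∣ℕ⇒∣ {d} {a}) (∣⇒∣ℕ {d} {a}) (∣ d ∣ ℕ.∣? ∣ a ∣)

prime-∣-* : ∀ {p} → Prime p → ∀ a b → + p ∣ a * b → (+ p ∣ a) ⊎ (+ p ∣ b)
prime-∣-* {p} pr a b h with euclidsLemma ∣ a ∣ ∣ b ∣ pr (subst (p ℕ.∣_) (abs-* a b) (∣⇒∣ℕ h))
... | inj₁ q = inj₁ (∣ℕ⇒∣ q)
... | inj₂ q = inj₂ (∣ℕ⇒∣ q)

prime-cancel : ∀ {p} → Prime p → ∀ {a} b → ¬ + p ∣ a → + p ∣ a * b → + p ∣ b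
prime-cancel pr {a} b p∤a h with prime-∣-* pr a b h
... | inj₁ q = ⊥-elim (p∤a q)
... | inj₂ q = q

prime-∤1 : ∀ {p} → Prime p → ¬ + p ∣ + 1
prime-∤1 {p} pr h with ℕ.∣1⇒≡1 (∣⇒∣ℕ h) | prime⇒nonTrivial pr
... | refl | ()

+-* : ∀ m n → + (m ℕ.* n) ≡ + m * + n
+-* m n = trans (ℤ.pos-* m n) (sym (*-def (+ m) (+ n)))

++-+ : ∀ m n → + (m ℕ.+ n) ≡ + m + + n
++-+ m n = sym (+-def (+ m) (+ n))

*-cancelˡ : ∀ {c a b} → c ≢ + 0 → c * a ≡ c * b → a ≡ b
*-cancelˡ {c} {a} {b} c≢0 h = ℤ.*-cancelˡ-≡ c a b {{ℤ.≢-nonZero c≢0}} (trans (sym (*-def c a)) (trans h (*-def c b)))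

∣-cancelˡ : ∀ {c a b} → c ≢ + 0 → c * a ∣ c * b → a ∣ b
∣-cancelˡ {c} {a} {b} c≢0 (divides q e) = divides q (*-cancelˡ c≢0 (trans e
  (solve 3 (λ q c a → q :* (c :* a) := c :* (q :* a)) refl q c a)))

prime-≢0 : ∀ {p} → Prime p → + p ≢ + 0
prime-≢0 {p} pr e = ℕ.≢-nonZero⁻¹ p {{prime⇒nonZero pr}} (ℤ.+-injective e)

prime-square-cancel : ∀ {p} → Prime p → ∀ {a} b → ¬ + p ∣ a → + p * + p ∣ a * b → + p * + p ∣ b
prime-square-cancel {p} pr {a} b p∤a h = again (prime-cancel pr b p∤a (∣-trans (∣-*ˡ (+ p) ∣-refl) h)) h
  where
  again : ∀ {b} → + p ∣ b → + p * + p ∣ a * b → + p * + p ∣ b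
  again (divides r refl) h = ∣-* (prime-cancel pr r p∤a (∣-cancelˡ (prime-≢0 pr) (subst (+ p * + p ∣_)
    (solve 3 (λ a r p → a :* (r :* p) := p :* (a :* r)) refl a r (+ p)) h))) ∣-refl

prime-inverse : ∀ {p} → Prime p → ∀ {a} → ¬ + p ∣ a → ∃ λ s → s * a ≡ + 1 mod + p
prime-inverse {p} pr {a} p∤a = signed (natural (coprime-Bézout coprime))
  where
  coprime : Coprime p ∣ a ∣
  coprime {d} (d∣p , d∣a) with prime⇒irreducible pr d∣p
  ... | inj₁ d≡1 = d≡1
  ... | inj₂ refl = ⊥-elim (p∤a (∣ℕ⇒∣ d∣a))
  natural : Bézout.Identity 1 p ∣ a ∣ → ∃ λ s → s * + ∣ a ∣ ≡ + 1 mod + p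
  natural (Bézout.+- x y eq) = - (+ y) , congruent (divides (- (+ x)) (begin
    - (+ y) * + ∣ a ∣ - + 1 ≡⟨ solve 2 (λ y a → (:- y) :* a :- con (+ 1) := :- (con (+ 1) :+ y :* a)) refl (+ y)
        (+ ∣ a ∣) ⟩
    - (+ 1 + + y * + ∣ a ∣) ≡⟨ cong -_ (trans (cong (_+_ (+ 1)) (sym (+-* y ∣ a ∣))) (trans (sym (++-+ 1 _)) (trans
        (cong +_ eq) (+-* x p)))) ⟩
    - (+ x * + p) ≡⟨ solve 2 (λ x p → :- (x :* p) := (:- x) :* p) refl (+ x) (+ p) ⟩
    - (+ x) * + p ∎))
    where open ≡-Reasoning
  natural (Bézout.-+ x y eq) = + y , congruent (divides (+ x) (begin
    + y * + ∣ a ∣ - + 1 ≡⟨ cong (_- + 1) (trans (sym (+-* y ∣ a ∣)) (trans (cong +_ (sym eq)) (trans (++-+ 1 _)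
        (cong (_+_ (+ 1)) (+-* x p))))) ⟩
    + 1 + + x * + p - + 1 ≡⟨ solve 1 (λ x → con (+ 1) :+ x :- con (+ 1) := x) refl (+ x * + p) ⟩
    + x * + p ∎))
    where open ≡-Reasoning
  signed : (∃ λ s → s * + ∣ a ∣ ≡ + 1 mod + p) → ∃ λ s → s * a ≡ + 1 mod + p
  signed (s , h) with ℤ.+∣i∣≡i⊎+∣i∣≡-i a
  ... | inj₁ e = s , subst (λ z → s * z ≡ + 1 mod + p) e h
  ... | inj₂ e = - s , mod-trans (mod-reflexive (trans (solve 2 (λ s a → (:- s) :* a := s :* (:- a)) refl s a)
    (cong (s *_) (trans (neg-def a) (sym e))))) h

-- Sums over initial segments of ℕ

∑< : ℕ → (ℕ → ℤ) → ℤ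
∑< n f = ∑ {n} (λ i → f (toℕ i))

∑<-snoc : ∀ n f → ∑< (suc n) f ≡ ∑< n f + f n
∑<-snoc zero    f = trans (∑-suc _) (trans (cong (_+_ (f 0)) (∑-empty _)) (trans (+-comm _ _) (cong (_+ f 0) (sym
    (∑-empty _)))))
∑<-snoc (suc n) f = trans (∑-suc _) (trans (cong (_+_ (f 0)) (∑<-snoc n (f ∘ suc)))
  (trans (sym (+-assoc _ _ _)) (cong (_+ f (suc n)) (sym (∑-suc _)))))

∑<-cong : ∀ n {f g : ℕ → ℤ} → (∀ i → i ℕ.< n → f i ≡ g i) → ∑< n f ≡ ∑< n g
∑<-cong n h = ∑-cong (λ i → h (toℕ i) (Fin.toℕ<n i))

mod-∑< : ∀ {d} n {f g : ℕ → ℤ} → (∀ i → i ℕ.< n → f i ≡ g i mod d) → ∑< n f ≡ ∑< n g mod d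
mod-∑< n h = mod-∑ (λ i → h (toℕ i) (Fin.toℕ<n i))

∑<-∣ : ∀ {d} n {f : ℕ → ℤ} → (∀ i → i ℕ.< n → d ∣ f i) → d ∣ ∑< n f
∑<-∣ n h = ∑-∣ (λ i → h (toℕ i) (Fin.toℕ<n i))

∑<-extend : ∀ {m n} → m ℕ.≤ n → (f : ℕ → ℤ) → (∀ i → m ℕ.≤ i → f i ≡ + 0) → ∑< n f ≡ ∑< m f
∑<-extend {m} {n} m≤n f h with ℕ.≤⇒≤′ m≤n
... | ℕ.≤′-reflexive refl = refl
... | ℕ.≤′-step {n = n'} m≤′n = trans (∑<-snoc n' f) (trans (cong₂ _+_ (∑<-extend (ℕ.≤′⇒≤ m≤′n) f h) (h n'
    (ℕ.≤′⇒≤ m≤′n)))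
  (+-identityʳ _))

mod-pick : ∀ {d} n i → i ℕ.< n → (f g : ℕ → ℤ) → g i ≡ + 1 mod d → (∀ l → l ℕ.< n → l ≢ i → d ∣ g l) →
  ∑< n (λ l → f l * g l) ≡ f i mod d
mod-pick {d} n i i<n f g h₁ h₀ = mod-trans
  (mod-∑ (λ l → mod-trans (mod-*ˡ (f (toℕ l)) (δ-mod l)) (mod-reflexive (*-comm _ (δℤ i' l)))))
  (mod-reflexive (trans (∑-δˡ i' (f ∘ toℕ)) (cong f (Fin.toℕ-fromℕ< i<n))))
  where
  i' = Fin.fromℕ< i<n
  δ-mod : ∀ l → g (toℕ l) ≡ δℤ i' l mod d
  δ-mod l with i' Fin.≟ l
  ... | yes refl = subst (λ j → g j ≡ + 1 mod d) (sym (Fin.toℕ-fromℕ< i<n)) h₁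
  ... | no i'≢l  = ∣⇒mod (h₀ (toℕ l) (Fin.toℕ<n l) (λ l≡i → i'≢l (Fin.toℕ-injective (trans (Fin.toℕ-fromℕ< i<n)
      (sym l≡i)))))

comb< : ∀ {n} → ℕ → (ℕ → ℤ) → (ℕ → Vector n) → Vector n
comb< m c v i = ∑< m (λ k → c k * v k i)

dot-comb<ʳ : ∀ {n} m (x : Vector n) c v → dot x (comb< m c v) ≡ ∑< m (λ k → c k * dot x (v k))
dot-comb<ʳ m x c v = dot-combʳ {m = m} x (c ∘ toℕ) (v ∘ toℕ)

dot-comb<ˡ : ∀ {n} m (x : Vector n) c v → dot (comb< m c v) x ≡ ∑< m (λ k → c k * dot (v k) x)
dot-comb<ˡ m x c v = dot-combˡ {m = m} x (c ∘ toℕ) (v ∘ toℕ)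

-- Linear dependence modulo a prime

record Monic (k : ℕ) (h : ℕ → ℤ) : Set where
  field
    lead  : h k ≡ + 1
    above : ∀ {j} → k ℕ.< j → h j ≡ + 0
open Monic

-- The relation is exactly monic over ℤ and only its value vanishes modulo p. This lets its shifts
-- form a matrix of determinant 1 later.
Dependent : ∀ {n} → ℕ → (ℕ → Vector n) → ℕ → Set
Dependent p v K = ∃ λ r → r ℕ.< K × ∃ λ h → Monic r h × ∀ i → + p ∣ comb< (suc r) h v i

-- A certificate of linear independence modulo p that can be multiplied with other matrices, so that
-- ranks become statements about determinants.
record DualFamily {n} (p : ℕ) (v : ℕ → Vector n) (K : ℕ) : Set where
  field
    dual : ℕ → Vector n
    dual-diagonal : ∀ {i} → i ℕ.< K → dot (v i) (dual i) ≡ + 1 mod + p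
    dual-other : ∀ {i j} → i ℕ.< K → j ℕ.< K → i ≢ j → + p ∣ dot (v i) (dual j)
open DualFamily

private
  unless : ∀ {A : Set} → ℕ → (ℕ → A) → A → ℕ → A
  unless K f a j with j ℕ.≟ K
  ... | yes _ = a
  ... | no _  = f j

  unless-≡ : ∀ {A : Set} K (f : ℕ → A) a → unless K f a K ≡ a
  unless-≡ K f a with K ℕ.≟ K
  ... | yes _ = refl
  ... | no ¬p = ⊥-elim (¬p refl)

  unless-≢ : ∀ {A : Set} K (f : ℕ → A) a {j} → j ≢ K → unless K f a j ≡ f j
  unless-≢ K f a {j} j≢K with j ℕ.≟ K
  ... | yes p = ⊥-elim (j≢K p)
  ... | no _  = refl

module _ {n} {p} (pr : Prime p) (v : ℕ → Vector n) where

  private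
    module Step (K : ℕ) (D : DualFamily p v K) where
      w = dual D
      -- The only candidates, modulo p, for the coefficients of `v K` in the earlier vectors, read
      -- off by the dual vectors.
      a : ℕ → ℤ
      a i = dot (v K) (w i)
      v' : Vector n
      v' i = v K i - comb< K a v i

      relation : (∀ i → + p ∣ v' i) → Dependent p v (suc K)
      relation h = K , ℕ.n<1+n K , c ,
        record { lead = unless-≡ K below (+ 1) ; above = λ {j} K<j → above-K j K<j } ,
        λ i → subst (+ p ∣_) (sym (trans (∑<-snoc K (λ k → c k * v k i)) (trans (cong₂ _+_ (first i) (last i))
            (+-comm _ _)))) (h i)
        where
        below : ℕ → ℤ
        below j with j ℕ.<? K
        ... | yes _ = - a j
        ... | no _  = + 0
        c = unless K below (+ 1)
        above-K : ∀ j → K ℕ.< j → c j ≡ + 0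
        above-K j K<j = trans (unless-≢ K below (+ 1) (ℕ.>⇒≢ K<j)) below-0
          where
          below-0 : below j ≡ + 0
          below-0 with j ℕ.<? K
          ... | yes j<K = ⊥-elim (ℕ.<-asym K<j j<K)
          ... | no _    = refl
        first : ∀ i → ∑< K (λ k → c k * v k i) ≡ - comb< K a v i
        first i = trans (∑<-cong K (λ k k<K → trans (cong (_* v k i) (trans (unless-≢ K below (+ 1) (ℕ.<⇒≢ k<K))
            (below-a k k<K)))
          (solve 2 (λ a b → (:- a) :* b := :- (a :* b)) refl (a k) (v k i)))) (∑-neg (λ k → a (toℕ k) * v (toℕ k) i))
          where
          below-a : ∀ k → k ℕ.< K → below k ≡ - a k
          below-a k k<K with k ℕ.<? K
          ... | yes _   = refl
          ... | no k≮K = ⊥-elim (k≮K k<K)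
        last : ∀ i → c K * v K i ≡ v K i
        last i = trans (cong (_* v K i) (unless-≡ K below (+ 1))) (*-identityˡ _)

      -- The new dual vector is a multiple of the j-th unit vector, corrected to be orthogonal to the old family.
      extend : (∃ λ j → ¬ + p ∣ v' j) → DualFamily p v (suc K)
      extend (j , p∤) = record { dual = w' ; dual-diagonal = λ {i} i<sK → diagonal i (i ℕ.≟ K) i<sK
                               ; dual-other = λ {i} {l} i<sK l<sK i≢l → other i l (i ℕ.≟ K) (l ℕ.≟ K) i<sK l<sK i≢l }
        where
        s = proj₁ (prime-inverse pr p∤)
        wK x : Vector n
        x = comb< K (λ l → v l j) w
        wK i = s * (δℤ j i + -[1+ 0 ] * x i)
        -- The old dual vectors are corrected as well, to become orthogonal to `v K`.
        w' : ℕ → Vector n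
        w' = unless K (λ l i → w l i + (- a l) * wK i) wK
        v-wK : ∀ u → dot u wK ≡ s * (u j - ∑< K (λ l → v l j * dot u (w l)))
        v-wK u = trans (dot-*ʳ s u _) (cong (s *_) (trans (dot-linʳ -[1+ 0 ] u (δℤ j) x)
          (trans (cong₂ (λ y z → y + -[1+ 0 ] * z) (trans (dot-comm u (δℤ j)) (∑-δˡ j u)) (dot-comb<ʳ K u (λ l →
              v l j) w))
            (solve 2 (λ a b → a :+ con -[1+ 0 ] :* b := a :- b) refl _ _))))
        old : ∀ {i} → i ℕ.< K → + p ∣ dot (v i) wK
        old {i} i<K = subst (+ p ∣_) (sym (v-wK (v i))) (∣-*ˡ s (∣-difference (mod-sym
          (mod-pick K i i<K (λ l → v l j) (λ l → dot (v i) (w l)) (dual-diagonal D i<K)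
            (λ l l<K l≢i → dual-other D i<K l<K (l≢i ∘ sym))))))
        new : dot (v K) wK ≡ + 1 mod + p
        new = mod-trans (mod-reflexive (trans (v-wK (v K)) (cong (λ z → s * (v K j - z))
          (∑<-cong K (λ l _ → *-comm (v l j) (a l)))))) (proj₂ (prime-inverse pr p∤))
        updated : ∀ u {l} → l ≢ K → dot u (w' l) ≡ dot u (w l) + (- a l) * dot u wK
        updated u {l} l≢K = trans (dot-cong {x = u} (λ _ → refl) (λ i → cong (λ f → f i) (unless-≢ K _ wK l≢K)))
            (dot-linʳ (- a l) u (w l) wK)
        at-K : ∀ u → dot u (w' K) ≡ dot u wK
        at-K u = dot-cong {x = u} (λ _ → refl) (λ i → cong (λ f → f i) (unless-≡ K _ wK))
        diagonal : ∀ i → Dec (i ≡ K) → i ℕ.< suc K → dot (v i) (w' i) ≡ + 1 mod + p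
        diagonal i (yes refl) _    = mod-trans (mod-reflexive (at-K (v K))) new
        diagonal i (no i≢K)   i<sK = mod-trans (mod-reflexive (updated (v i) i≢K))
          (mod-trans (mod-+ (dual-diagonal D i<K) (∣⇒mod (∣-*ˡ (- a i) (old i<K)))) (mod-reflexive (+-identityʳ _)))
          where i<K = ℕ.≤∧≢⇒< (ℕ.≤-pred i<sK) i≢K
        other : ∀ i l → Dec (i ≡ K) → Dec (l ≡ K) → i ℕ.< suc K → l ℕ.< suc K → i ≢ l → + p ∣ dot (v i) (w' l)
        other i l (yes refl) (yes refl) _ _ i≢l = ⊥-elim (i≢l refl)
        other i l (no i≢K) (yes refl) i<sK _ i≢l = subst (+ p ∣_) (sym (at-K (v i))) (old (ℕ.≤∧≢⇒<
            (ℕ.≤-pred i<sK) i≢K))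
        other i l (yes refl) (no l≢K) _ _ i≢l = subst (+ p ∣_) (sym (updated (v K) l≢K)) (mod⇒∣ (mod-trans
          (mod-+ (mod-refl {+ p} {a l}) (mod-*ˡ (- a l) new))
          (mod-reflexive (solve 1 (λ a → a :+ (:- a) :* con (+ 1) := con (+ 0)) refl (a l)))))
        other i l (no i≢K) (no l≢K) i<sK l<sK i≢l = subst (+ p ∣_) (sym (updated (v i) l≢K))
          (∣-+ (dual-other D i<K (ℕ.≤∧≢⇒< (ℕ.≤-pred l<sK) l≢K) i≢l) (∣-*ˡ (- a l) (old i<K)))
          where i<K = ℕ.≤∧≢⇒< (ℕ.≤-pred i<sK) i≢K

  dependent-or-dual : ∀ K → Dependent p v K ⊎ DualFamily p v K
  dependent-or-dual zero = inj₂ (record { dual = λ _ _ → + 0 ; dual-diagonal = λ () ; dual-other = λ () })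
  dependent-or-dual (suc K) with dependent-or-dual K
  ... | inj₁ (r , r<K , rest) = inj₁ (r , ℕ.m<n⇒m<1+n r<K , rest)
  ... | inj₂ D with Fin.any? (λ i → ¬? (+ p ∣? Step.v' K D i))
  ...   | yes found = inj₂ (Step.extend K D found)
  ...   | no none = inj₁ (Step.relation K D (λ i → Dec.decidable-stable (+ p ∣? Step.v' K D i) (λ ¬q → none
      (i , ¬q))))

-- The dual vectors, taken as rows, form an inverse of M modulo p.
dual-det : ∀ {n p} → Prime p → (M : Mat ℤ n) (v : ℕ → Vector n) → (∀ i j → M i j ≡ v (toℕ j) i) →
  DualFamily p v n → ¬ + p ∣ det′ M
dual-det {n} {p} pr M v M≡v D h = prime-∤1 pr (mod-∣ (mod-sym (det′-unitriangular (X ⊡ M) off diag))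
  (subst (+ p ∣_) (sym (det′-⊡ X M)) (∣-*ˡ (det′ X) h)))
  where
  X : Mat ℤ n
  X i j = dual D (toℕ i) j
  entry : ∀ i j → (X ⊡ M) i j ≡ dot (v (toℕ j)) (dual D (toℕ i))
  entry i j = trans (dot-cong {x = X i} (λ _ → refl) (λ k → M≡v k j)) (dot-comm (X i) (v (toℕ j)))
  off : ∀ i j → toℕ j ℕ.< toℕ i → + p ∣ (X ⊡ M) i j
  off i j j<i = subst (+ p ∣_) (sym (entry i j)) (dual-other D (Fin.toℕ<n j) (Fin.toℕ<n i) (ℕ.<⇒≢ j<i))
  diag : ∀ i → (X ⊡ M) i i ≡ + 1 mod + p
  diag i = mod-trans (mod-reflexive (entry i i)) (dual-diagonal D (Fin.toℕ<n i))

-- Padding the vectors with a zero coordinate makes the square matrix of the f i singular.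
too-many-vectors : ∀ {n p} → Prime p → (f g : ℕ → Vector n) →
  (∀ {i} → i ℕ.≤ n → dot (f i) (g i) ≡ + 1 mod + p) →
  (∀ {i r} → i ℕ.< r → r ℕ.≤ n → + p ∣ dot (f i) (g r)) → ⊥
too-many-vectors {n} {p} pr f g diag off = prime-∤1 pr (mod⇒∣ (mod-trans
  (mod-sym (det′-unitriangular (G ⊡ F) (λ r i i<r → subst (+ p ∣_) (sym (entry r i)) (off i<r (ℕ.≤-pred
      (Fin.toℕ<n r))))
    (λ i → mod-trans (mod-reflexive (entry i i)) (diag (ℕ.≤-pred (Fin.toℕ<n i))))))
  (mod-reflexive (trans (det′-⊡ G F) (trans (cong (_* det′ F) (det′-zero-column G (λ i → refl))) (zeroˡ _))))))
  where
  pad : Vector n → Vector (suc n)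
  pad x zero    = + 0
  pad x (suc i) = x i
  F G : Mat ℤ (suc n)
  G r = pad (g (toℕ r))
  F k i = pad (f (toℕ i)) k
  entry : ∀ r i → (G ⊡ F) r i ≡ dot (f (toℕ i)) (g (toℕ r))
  entry r i = trans (∑-suc _) (trans (cong (_+ dot (g (toℕ r)) (f (toℕ i))) (zeroˡ (+ 0))) (trans (+-identityˡ _)
      (dot-comm (g (toℕ r)) _)))

-- Families that change at index k

split : ∀ {A : Set} → ℕ → (ℕ → A) → (ℕ → A) → ℕ → A
split zero    f g j       = g j
split (suc k) f g zero    = f zero
split (suc k) f g (suc j) = split k (f ∘ suc) g j

split-< : ∀ {A : Set} k (f g : ℕ → A) {j} → j ℕ.< k → split k f g j ≡ f j
split-< (suc k) f g {zero}  _         = refl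
split-< (suc k) f g {suc j} (ℕ.s≤s l) = split-< k (f ∘ suc) g l

split-≥ : ∀ {A : Set} k (f g : ℕ → A) t → split k f g (k ℕ.+ t) ≡ g t
split-≥ zero    f g t = refl
split-≥ (suc k) f g t = split-≥ k (f ∘ suc) g t

below-or-above : ∀ k j → j ℕ.< k ⊎ ∃ λ t → j ≡ k ℕ.+ t
below-or-above k j with ℕ.<-≤-connex j k
... | inj₁ j<k = inj₁ j<k
... | inj₂ k≤j = inj₂ (j ℕ.∸ k , sym (ℕ.m+[n∸m]≡n k≤j))

-- Multiplication by x of the polynomial with coefficients c.
shift : (ℕ → ℤ) → ℕ → ℤ
shift c zero    = + 0
shift c (suc i) = c i

shifts : ℕ → (ℕ → ℤ) → ℕ → ℤ
shifts zero    h = h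
shifts (suc t) h = shift (shifts t h)

shifts-monic : ∀ {k h} t → Monic k h → Monic (k ℕ.+ t) (shifts t h)
shifts-monic {k} zero    m = subst (λ z → Monic z _) (sym (ℕ.+-identityʳ k)) m
shifts-monic {k} {h} (suc t) m = subst (λ z → Monic z (shifts (suc t) h)) (sym (ℕ.+-suc k t))
  (record { lead = lead ih ; above = λ { {suc j} (ℕ.s≤s l) → above ih l } })
  where ih = shifts-monic t m

-- W and the matrix V of e, Se, …, S^{k-1}e, y, Sy, …, where h(S)e = p y with h monic of degree k

threshold : ∀ {n} → ℕ → ℕ → Mat ℤ n
threshold k p i j = δℤ i j * split k (λ _ → + 1) (λ _ → + p) (toℕ j)

∏-threshold : ∀ n k p → k ℕ.≤ n → ∏ {n} (λ j → split k (λ _ → + 1) (λ _ → + p) (toℕ j)) ≡ + (p ℕ.^ (n ℕ.∸ k))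
∏-threshold zero    zero    p _ = refl
∏-threshold (suc n) zero    p _ = trans (cong (+ p *_) (∏-threshold n zero p ℕ.z≤n)) (sym (+-* p (p ℕ.^ n)))
∏-threshold (suc n) (suc k) p (ℕ.s≤s le) = trans (*-identityˡ _) (∏-threshold n k p le)

det′-threshold : ∀ n k p → k ℕ.≤ n → det′ {n} (threshold k p) ≡ + (p ℕ.^ (n ℕ.∸ k))
det′-threshold n k p le = trans (mod-0⇒≡ (det′-triangular (threshold k p) (λ i j j<i →
    subst (+ 0 ∣_) (sym (trans (cong (_* split k _ _ (toℕ j)) (δ-≢ {i = i} {j} (λ { refl → ℕ.<-irrefl refl j<i })))
        (zeroˡ _))) ∣-0)))
  (trans (∏-cong {n} (λ i → trans (cong (_* split k (λ _ → + 1) (λ _ → + p) (toℕ i)) (δ-refl i)) (*-identityˡ _)))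
      (∏-threshold n k p le))
  where
  ∏-cong : ∀ {n} {f g : Fin n → ℤ} → (∀ i → f i ≡ g i) → ∏ f ≡ ∏ g
  ∏-cong {zero}  h = refl
  ∏-cong {suc n} h = cong₂ _*_ (h zero) (∏-cong (h ∘ suc))

⊡-threshold : ∀ {n} (V : Mat ℤ n) k p i j → (V ⊡ threshold k p) i j ≡ V i j * split k (λ _ → + 1) (λ _ → + p) (toℕ j)
⊡-threshold V k p i j = trans (∑-cong (λ l → sym (*-assoc (V i l) _ _))) (trans (∑-*ʳ s (λ l → V i l * δℤ l j))
    (cong (_* s) (∑-δʳ j (V i))))
  where s = split k (λ _ → + 1) (λ _ → + p) (toℕ j)

walkMatrix : ∀ {n} → Mat ℤ n → Mat ℤ n
walkMatrix S i k = walkVec S (toℕ k) i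

-- The columns are the coefficient vectors of 1, x, ..., xᵏ⁻¹, h, xh, x²h, ..., so that multiplying
-- W by this matrix lists the values of these polynomials at S, applied to e.
shift-matrix : ∀ n k → (ℕ → ℤ) → Mat ℤ n
shift-matrix n k h i j = split k (λ _ → δℤ i j) (λ t → shifts t h (toℕ i)) (toℕ j)

det′-shift-matrix : ∀ n k {h} → Monic k h → det′ (shift-matrix n k h) ≡ + 1
det′-shift-matrix n k {h} m = mod-0⇒≡ (det′-unitriangular H off diag)
  where
  H = shift-matrix n k h
  off : ∀ i j → toℕ j ℕ.< toℕ i → + 0 ∣ H i j
  off i j j<i with below-or-above k (toℕ j)
  ... | inj₁ j<k = subst (+ 0 ∣_) (sym (trans (split-< k _ _ j<k) (δ-≢ {i = i} {j} (λ { refl →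
      ℕ.<-irrefl refl j<i })))) ∣-0
  ... | inj₂ (t , j≡) = subst (+ 0 ∣_) (sym (trans (cong (split k _ _) j≡) (trans (split-≥ k _ _ t)
    (above (shifts-monic t m) (subst (ℕ._< toℕ i) j≡ j<i))))) ∣-0
  diag : ∀ i → H i i ≡ + 1 mod + 0
  diag i with below-or-above k (toℕ i)
  ... | inj₁ i<k = mod-reflexive (trans (split-< k _ _ i<k) (δ-refl i))
  ... | inj₂ (t , i≡) = mod-reflexive (trans (cong (split k _ _) i≡) (trans (split-≥ k _ _ t)
    (trans (cong (shifts t h) i≡) (lead (shifts-monic t m)))))

-- Multiplication by x raises the degree; the vanishing of `c m` ensures that the sum of length m +
-- 1 loses no term.
walk-shift : ∀ {n} (S : Mat ℤ n) m c → c m ≡ + 0 → comb< (suc m) (shift c) (walkVec S) ≗ S ▹ comb< (suc m) c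
    (walkVec S)
walk-shift S m c cm≡0 i = begin
  comb< (suc m) (shift c) u i ≡⟨ ∑-suc _ ⟩
  + 0 * u 0 i + ∑< m (λ k → c k * u (suc k) i) ≡⟨ trans (cong (_+ ∑< m (λ k → c k * u (suc k) i)) (zeroˡ (u 0 i)))
      (+-identityˡ _) ⟩
  ∑< m (λ k → c k * u (suc k) i) ≡⟨ ∑<-cong m (λ k _ → cong (c k *_) (walkVec-suc S k i)) ⟩
  ∑< m (λ k → c k * (S ▹ u k) i) ≡⟨ dot-comb<ʳ m (S i) c u ⟨
  (S ▹ comb< m c u) i
    ≡⟨ ▹-congʳ S (λ j → sym (∑<-drop j)) i ⟩
  (S ▹ comb< (suc m) c u) i ∎
  where
  open ≡-Reasoning
  u = walkVec S
  ∑<-drop : ∀ j → comb< (suc m) c u j ≡ comb< m c u j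
  ∑<-drop j = trans (∑<-snoc m (λ k → c k * u k j)) (trans (cong (λ z → comb< m c u j + z * u m j) cm≡0)
    (trans (cong (_+_ (comb< m c u j)) (zeroˡ (u m j))) (+-identityʳ _)))

iterate : ∀ {n} → Mat ℤ n → ℕ → Vector n → Vector n
iterate S zero    y = y
iterate S (suc t) y = S ▹ iterate S t y

walk-shifts : ∀ {n} (S : Mat ℤ n) k h (y : Vector n) p → Monic k h → (∀ i → comb< (suc k) h (walkVec S) i ≡ p * y i) →
  ∀ t m → k ℕ.+ t ℕ.≤ m → comb< (suc m) (shifts t h) (walkVec S) ≗ (λ i → p * iterate S t y i)
walk-shifts S k h y p mon rel zero m le i = trans (∑<-extend (ℕ.s≤s (ℕ.≤-trans (ℕ.m≤m+n k 0) le)) (λ j →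
    h j * walkVec S j i)
  (λ j k<j → trans (cong (_* walkVec S j i) (above mon k<j)) (zeroˡ _))) (rel i)
walk-shifts S k h y p mon rel (suc t) m le i = trans
  (walk-shift S m (shifts t h) (above (shifts-monic t mon) (subst (ℕ._≤ m) (ℕ.+-suc k t) le)) i)
  (trans (▹-congʳ S (walk-shifts S k h y p mon rel t m (ℕ.≤-trans (ℕ.+-monoʳ-≤ k (ℕ.n≤1+n t)) le)) i)
    (dot-*ʳ p (S i) (iterate S t y)))

reduced : ∀ {n} → Mat ℤ n → ℕ → Vector n → Mat ℤ n
reduced S k y i j = split k (λ l → walkVec S l) (λ t → iterate S t y) (toℕ j) i

-- The columns from k on are Sᵗh(S)e = p Sᵗy. All divisibility of W by p that the relation provides
-- is collected in a diagonal factor.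
walk-factorization : ∀ {n} (S : Mat ℤ n) k h (y : Vector n) p → Monic k h →
  (∀ i → comb< (suc k) h (walkVec S) i ≡ + p * y i) →
  ∀ i j → (walkMatrix S ⊡ shift-matrix n k h) i j ≡ (reduced S k y ⊡ threshold k p) i j
walk-factorization {suc n} S k h y p mon rel i j = trans (go (below-or-above k (toℕ j))) (sym (⊡-threshold
    (reduced S k y) k p i j))
  where
  W = walkMatrix S
  H = shift-matrix (suc n) k h
  V = reduced S k y
  go : (toℕ j ℕ.< k ⊎ ∃ λ t → toℕ j ≡ k ℕ.+ t) → (W ⊡ H) i j ≡ V i j * split k (λ _ → + 1) (λ _ → + p) (toℕ j)
  go (inj₁ j<k) = trans (∑-cong (λ l → cong (W i l *_) (split-< k (λ _ → δℤ l j) _ j<k))) (trans (∑-δʳ j (W i))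
    (sym (trans (cong₂ _*_ (cong (λ f → f i) (split-< k (walkVec S) _ j<k)) (split-< k _ _ j<k)) (*-identityʳ _))))
  go (inj₂ (t , j≡)) = trans (∑-cong (λ l → trans (cong (W i l *_) (trans (cong (split k _ _) j≡) (split-≥ k (λ _ →
      δℤ l j) _ t))) (*-comm (W i l) _)))
    (trans (walk-shifts S k h y (+ p) mon rel t n (subst (ℕ._≤ n) j≡ (ℕ.≤-pred (Fin.toℕ<n j))) i)
      (trans (*-comm (+ p) _) (sym (cong₂ _*_ (cong (λ f → f i) (trans (cong (split k _ _) j≡) (split-≥ k
          (walkVec S) _ t)))
        (trans (cong (split k _ _) j≡) (split-≥ k (λ _ → + 1) _ t))))))

-- Used with p = 2 and k = ⌈n/2⌉, where the cofactor is m, and with an odd p | m and k = n - 1,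
-- where it is prime to p.
det′-reduced : ∀ {n} (S : Mat ℤ n) k h (y : Vector n) p → Monic k h → k ℕ.≤ n →
  (∀ i → comb< (suc k) h (walkVec S) i ≡ + p * y i) →
  det′ (walkMatrix S) ≡ det′ (reduced S k y) * + (p ℕ.^ (n ℕ.∸ k))
det′-reduced {n} S k h y p mon k≤n rel = begin
  det′ (walkMatrix S) ≡⟨ *-identityʳ _ ⟨
  det′ (walkMatrix S) * + 1 ≡⟨ cong (det′ (walkMatrix S) *_) (det′-shift-matrix n k mon) ⟨
  det′ (walkMatrix S) * det′ (shift-matrix n k h) ≡⟨ det′-⊡ _ _ ⟨
  det′ (walkMatrix S ⊡ shift-matrix n k h) ≡⟨ det′-cong (walk-factorization S k h y p mon rel) ⟩
  det′ (reduced S k y ⊡ threshold k p) ≡⟨ det′-⊡ _ _ ⟩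
  det′ (reduced S k y) * det′ {n} (threshold k p) ≡⟨ cong (det′ (reduced S k y) *_) (det′-threshold n k p k≤n) ⟩
  det′ (reduced S k y) * + (p ℕ.^ (n ℕ.∸ k)) ∎
  where open ≡-Reasoning

-- A relation of lower degree is multiplied by a power of x; this stays a relation because S is
-- integral.
monic-relation : ∀ {n} (S : Mat ℤ n) {p} K → Dependent p (walkVec S) (suc K) →
  ∃ λ h → Monic K h × ∀ i → + p ∣ comb< (suc K) h (walkVec S) i
monic-relation S {p} K (r , r<sK , h , mon , rel) with ℕ.m≤n⇒∃[o]m+o≡n (ℕ.≤-pred r<sK)
... | t , refl = shifts t h , shifts-monic t mon , λ i → subst (+ p ∣_)
  (sym (walk-shifts S r h (λ i → _∣_.quotient (rel i)) (+ p) mon (λ i → trans (_∣_.equality (rel i)) (*-comm _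
      (+ p))) t (r ℕ.+ t) ℕ.≤-refl i))
  (∣-*ʳ _ ∣-refl)

-- Parity

opaque
  prime-2 : Prime 2
  prime-2 = from-yes (prime? 2)

halve : ∀ n → ∃ λ m → (n ≡ m ℕ.+ m) ⊎ (n ≡ suc (m ℕ.+ m))
halve zero = 0 , inj₁ refl
halve (suc n) with halve n
... | m , inj₁ e = m , inj₂ (cong suc e)
... | m , inj₂ e = suc m , inj₁ (cong suc (trans e (sym (ℕ.+-suc m m))))

double : ∀ m → + (m ℕ.+ m) ≡ + m * + 2
double m = trans (++-+ m m) (solve 1 (λ m → m :+ m := m :* con (+ 2)) refl (+ m))

even-or-odd : ∀ a → (+ 2 ∣ a) ⊎ (+ 2 ∣ a - + 1)
even-or-odd (+ n) with halve n
... | m , inj₁ refl = inj₁ (divides (+ m) (double m))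
... | m , inj₂ refl = inj₂ (divides (+ m) (trans (cong (_- + 1) (trans (++-+ 1 (m ℕ.+ m)) (cong (_+_ (+ 1))
    (double m))))
  (solve 1 (λ a → con (+ 1) :+ a :- con (+ 1) := a) refl _)))
even-or-odd -[1+ n ] with halve n
... | m , inj₂ refl = inj₁ (divides (- + suc m) (trans (trans (sym (neg-def (+ suc (suc (m ℕ.+ m))))) (cong (λ z →
    - + suc z) (sym (ℕ.+-suc m m))))
  (trans (cong -_ (double (suc m))) (solve 1 (λ a → :- (a :* con (+ 2)) := (:- a) :* con (+ 2)) refl (+ suc m)))))
... | m , inj₁ refl = inj₂ (divides (- + suc m) (trans (cong (_- + 1) (trans (sym (neg-def (+ suc (m ℕ.+ m))))
    (cong -_ (trans (++-+ 1 _) (cong (_+_ (+ 1)) (double m))))))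
  (trans (solve 1 (λ a → (:- (con (+ 1) :+ a :* con (+ 2))) :- con (+ 1) := (:- (con (+ 1) :+ a)) :* con (+ 2)) refl
      (+ m))
    (cong (λ z → - z * + 2) (sym (++-+ 1 m))))))

even-square-minus : ∀ a → + 2 ∣ a * a - a
even-square-minus a with even-or-odd a
... | inj₁ e = ∣-- (∣-*ˡ a e) e
... | inj₂ o = subst (+ 2 ∣_) (solve 1 (λ a → a :* (a :- con (+ 1)) := a :* a :- a) refl a) (∣-*ˡ a o)

sgn-square : ∀ k → sgn k * sgn k ≡ + 1
sgn-square zero          = *-identityˡ _
sgn-square (suc zero)    = *-def _ _
sgn-square (suc (suc k)) = sgn-square k

sgn-odd : ∀ k → + 2 ∣ sgn k - + 1
sgn-odd zero          = subst (+ 2 ∣_) (sym (-‿inverseʳ (+ 1))) ∣-0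
sgn-odd (suc zero)    = divides -[1+ 0 ] (solve 0 (con -[1+ 0 ] :- con (+ 1) := con -[1+ 0 ] :* con (+ 2)) refl)
sgn-odd (suc (suc k)) = sgn-odd k

sgn-∣ : ∀ {d} k {a} → d ∣ sgn k * a → d ∣ a
sgn-∣ {d} k {a} h = subst (d ∣_) (trans (sym (*-assoc (sgn k) (sgn k) a)) (trans (cong (_* a) (sgn-square k))
    (*-identityˡ a))) (∣-*ˡ (sgn k) h)

sgn-+ : ∀ k l → sgn (k ℕ.+ l) ≡ sgn k * sgn l
sgn-+ zero          l = sym (*-identityˡ _)
sgn-+ (suc zero)    l = trans (sgn-suc l) (solve 1 (λ a → :- a := con -[1+ 0 ] :* a) refl (sgn l))
sgn-+ (suc (suc k)) l = sgn-+ k l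

∑-∑-diagonal : ∀ {d} N (a : ℕ → ℕ → ℤ) → (∀ i j → i ≢ j → d ∣ a i j + a j i) →
  ∑< N (λ i → ∑< N (a i)) ≡ ∑< N (λ i → a i i) mod d
∑-∑-diagonal zero    a h = mod-reflexive (trans (∑-empty _) (sym (∑-empty _)))
∑-∑-diagonal {d} (suc N) a h = mod-trans (mod-reflexive (begin
    ∑< (suc N) (λ i → ∑< (suc N) (a i)) ≡⟨ ∑<-snoc N (λ i → ∑< (suc N) (a i)) ⟩
    ∑< N (λ i → ∑< (suc N) (a i)) + ∑< (suc N) (a N)
      ≡⟨ cong₂ _+_ (trans (∑<-cong N (λ i _ → ∑<-snoc N (a i))) (∑-+ {N} _ _)) (∑<-snoc N (a N)) ⟩
    ∑< N (λ i → ∑< N (a i)) + ∑< N (λ i → a i N) + (∑< N (a N) + a N N)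
      ≡⟨ solve 4 (λ x y z w → x :+ y :+ (z :+ w) := x :+ (y :+ z) :+ w) refl _ (∑< N (λ i → a i N)) _ (a N N) ⟩
    ∑< N (λ i → ∑< N (a i)) + (∑< N (λ i → a i N) + ∑< N (a N)) + a N N
      ≡⟨ cong (λ z → ∑< N (λ i → ∑< N (a i)) + z + a N N) (sym (∑-+ {N} _ _)) ⟩
    ∑< N (λ i → ∑< N (a i)) + ∑< N (λ i → a i N + a N i) + a N N ∎))
  (mod-trans (mod-+ (mod-+ (∑-∑-diagonal N a h) (∣⇒mod (∑<-∣ N (λ i i<N → h i N (ℕ.<⇒≢ i<N)))))
      (mod-refl {d} {a N N}))
    (mod-reflexive (trans (cong (_+ a N N) (+-identityʳ _)) (sym (∑<-snoc N (λ i → a i i))))))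
  where open ≡-Reasoning

-- Gram matrices of walk vectors

≗-injective : ∀ {n} (M : Mat ℤ n) → det′ M ≢ + 0 → ∀ {x y} → M ▹ x ≗ M ▹ y → x ≗ y
≗-injective M det≢0 {x} {y} h i = begin
  x i ≡⟨ solve 2 (λ x y → x := (x :+ con -[1+ 0 ] :* y) :+ y) refl (x i) (y i) ⟩
  (x i + -[1+ 0 ] * y i) + y i ≡⟨ cong (_+ y i) (▹-zero M (λ i → x i + -[1+ 0 ] * y i) det≢0 zeros i) ⟩
  + 0 + y i ≡⟨ +-identityˡ _ ⟩
  y i ∎
  where
  open ≡-Reasoning
  zeros : ∀ j → (M ▹ (λ i → x i + -[1+ 0 ] * y i)) j ≡ + 0
  zeros j = trans (dot-linʳ -[1+ 0 ] (M j) x y) (trans (cong (λ z → z + -[1+ 0 ] * (M ▹ y) j) (h j))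
    (solve 1 (λ a → a :+ con -[1+ 0 ] :* a := con (+ 0)) refl ((M ▹ y) j)))

⊡-cancelʳ : ∀ {n} {X Y : Mat ℤ n} (M : Mat ℤ n) → det′ M ≢ + 0 → (∀ i j → (X ⊡ M) i j ≡ (Y ⊡ M) i j) → ∀ i j →
    X i j ≡ Y i j
⊡-cancelʳ {X = X} {Y} M det≢0 h i = ≗-injective (M ᵗ) (λ e → det≢0 (trans (sym (det′-ᵗ M)) e))
  (λ j → trans (dot-comm (λ k → M k j) (X i)) (trans (h i j) (dot-comm (Y i) _)))

module Gram {n} {S : Mat ℤ n} (sk : Skew S) where

  private
    u = walkVec S
    w = walks S

  -- Each S moved from the left factor to the right one costs a sign.
  gram : ∀ i j → dot (u i) (u j) ≡ sgn i * w (i ℕ.+ j)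
  gram zero    j = sym (*-identityˡ _)
  gram (suc i) j = begin
    dot (u (suc i)) (u j) ≡⟨ dot-cong (walkVec-suc S i) (λ _ → refl) ⟩
    dot (S ▹ u i) (u j) ≡⟨ skew-▹ sk (u i) (u j) ⟩
    - dot (u i) (S ▹ u j) ≡⟨ cong -_ (dot-cong {x = u i} (λ _ → refl) (λ k → sym (walkVec-suc S j k))) ⟩
    - dot (u i) (u (suc j)) ≡⟨ cong -_ (gram i (suc j)) ⟩
    - (sgn i * w (i ℕ.+ suc j)) ≡⟨ solve 2 (λ s x → :- (s :* x) := (:- s) :* x) refl (sgn i) _ ⟩
    - sgn i * w (i ℕ.+ suc j) ≡⟨ cong₂ _*_ (sym (sgn-suc i)) (cong w (ℕ.+-suc i j)) ⟩
    sgn (suc i) * w (suc i ℕ.+ j) ∎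
    where open ≡-Reasoning

  walks-sgn : ∀ k → w k ≡ sgn k * w k
  walks-sgn k = trans (dot-comm 1ᵛ (u k)) (trans (gram k 0) (cong (λ z → sgn k * w z) (ℕ.+-identityʳ k)))

  walks-odd : ∀ m → w (suc (m ℕ.+ m)) ≡ + 0
  walks-odd m = integral-domain {+ 2} (trans (solve 1 (λ a → con (+ 2) :* a := a :+ a) refl x)
    (trans (cong (_+_ x) x≡-x) (-‿inverseʳ x))) λ ()
    where
    x = w (suc (m ℕ.+ m))
    x≡-x : x ≡ - x
    x≡-x = trans (walks-sgn (suc (m ℕ.+ m))) (trans (cong (_* x) (trans (sgn-suc (m ℕ.+ m)) (cong -_ (trans
        (sgn-+ m m) (sgn-square m)))))
      (solve 1 (λ x → (:- con (+ 1)) :* x := :- x) refl x))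

  -- x·x and 1·x have the same parity, so e·S²ʲe reduces to e·Sʲe.
  walks-even : ∀ k → + 2 ∣ w (suc k)
  walks-even k = <-rec (λ k → 0 ℕ.< k → + 2 ∣ w k) step (suc k) (ℕ.s≤s ℕ.z≤n)
    where
    step : ∀ k → (∀ {j} → j ℕ.< k → 0 ℕ.< j → + 2 ∣ w j) → 0 ℕ.< k → + 2 ∣ w k
    step k IH 0<k with halve k
    ... | m , inj₂ refl = subst (+ 2 ∣_) (sym (walks-odd m)) ∣-0
    ... | zero , inj₁ refl = ⊥-elim (ℕ.<-irrefl refl 0<k)
    ... | m@(suc m') , inj₁ refl = sgn-∣ m (subst (+ 2 ∣_) (gram m m) (mod-∣
      (mod-∑ (λ i → congruent (subst (λ z → + 2 ∣ u m i * u m i - z) (sym (*-identityˡ (u m i))) (even-square-minus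
          (u m i)))))
      (IH (ℕ.m<m+n m (ℕ.s≤s ℕ.z≤n)) (ℕ.s≤s ℕ.z≤n))))

  walks-zero : w 0 ≡ + n
  walks-zero = count n
    where
    count : ∀ n → ∑ {n} (λ _ → + 1 * + 1) ≡ + n
    count zero    = ∑-empty _
    count (suc n) = trans (∑-suc _) (trans (cong (_+_ _) (count n)) (trans (cong (_+ + n) (*-identityˡ _)) (sym
        (++-+ 1 n))))

  det′-gram : ∀ (G : Mat ℤ n) → (∀ i j → G i j ≡ dot (u (toℕ i)) (u (toℕ j))) →
    det′ G ≡ det′ (walkMatrix S) * det′ (walkMatrix S)
  det′-gram G h = trans (det′-cong h) (trans (det′-⊡ (walkMatrix S ᵗ) (walkMatrix S))
    (cong (_* det′ (walkMatrix S)) (det′-ᵗ (walkMatrix S))))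

-- Parity of the order of the graph: n = κ + 2 m₀ with κ ≤ 1, and k = κ + m₀ is the 2-rank of W.
record Halved (n : ℕ) : Set where
  field
    κ m₀ : ℕ
    κ≤1 : κ ℕ.≤ 1
    order : n ≡ κ ℕ.+ (m₀ ℕ.+ m₀)
    half : n ℕ./ 2 ≡ m₀

halved : ∀ n → Halved n
halved n with halve n
... | m , inj₁ refl = record { κ = 0 ; m₀ = m ; κ≤1 = ℕ.z≤n ; order = refl
  ; half = trans (cong (ℕ._/ 2) (doubled m)) (ℕ.m*n/n≡m m 2) }
  where
  doubled : ∀ m → m ℕ.+ m ≡ m ℕ.* 2
  doubled m = trans (cong (m ℕ.+_) (sym (ℕ.+-identityʳ m))) (ℕ.*-comm 2 m)
... | m , inj₂ refl = record { κ = 1 ; m₀ = m ; κ≤1 = ℕ.≤-refl ; order = refl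
  ; half = trans (cong (λ z → suc z ℕ./ 2) (doubled m)) (trans (ℕ.+-distrib-/-∣ʳ 1 {m ℕ.* 2} {2} (ℕ.n∣m*n m))
      (ℕ.m*n/n≡m m 2)) }
  where
  doubled : ∀ m → m ℕ.+ m ≡ m ℕ.* 2
  doubled m = trans (cong (m ℕ.+_) (sym (ℕ.+-identityʳ m))) (ℕ.*-comm 2 m)

-- The rank of W modulo 2 and its Gram matrix modulo 4

module TwoAdic {n} (H : Halved n) where
  open Halved H

  k : ℕ
  k = κ ℕ.+ m₀

  k≤n : k ℕ.≤ n
  k≤n = ℕ.≤-trans (ℕ.+-monoʳ-≤ κ (ℕ.m≤m+n m₀ m₀)) (ℕ.≤-reflexive (sym order))

  n∸k : n ℕ.∸ k ≡ m₀
  n∸k = trans (cong (ℕ._∸ k) (trans order (sym (ℕ.+-assoc κ m₀ m₀)))) (ℕ.m+n∸m≡n k m₀)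

  n∸κ : n ℕ.∸ κ ≡ m₀ ℕ.+ m₀
  n∸κ = trans (cong (ℕ._∸ κ) order) (ℕ.m+n∸m≡n κ _)

  module Rank {S : Mat ℤ n} (sk : Skew S) where
    open Gram sk
    private
      u = walkVec S
      w = walks S

    -- The only walk number that can be odd is the one of index 0, equal to n. Index 0 is reached
    -- only for κ = 0, and then n is even.
    even-column : ∀ i t → + 2 ∣ w (i ℕ.+ (κ ℕ.+ t))
    even-column i t with κ | κ≤1 | order
    even-column zero    zero | zero | _ | o = subst (+ 2 ∣_) (sym (trans walks-zero (cong +_ o))) (divides (+ m₀)
        (double m₀))
    even-column zero    (suc t) | zero | _ | o = walks-even t
    even-column (suc i) t | zero | _ | o = walks-even (i ℕ.+ t)
    even-column i t | suc κ' | _ | o = subst (λ z → + 2 ∣ w z) (sym (ℕ.+-suc i (κ' ℕ.+ t))) (walks-even (i ℕ.+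
        (κ' ℕ.+ t)))

    -- By `even-column` the vectors Sʲe with κ ≤ j ≤ k span an isotropic space modulo 2. If
    -- independent, its dimension m₀ + 1 would exceed n/2.
    no-dual : ¬ DualFamily 2 u (suc k)
    no-dual D = too-many-vectors prime-2 f g (λ {i} i≤n → diag i (below-or-above K i) i≤n)
      (λ {i} {r} i<r r≤n → off i r (below-or-above K i) (below-or-above K r) i<r r≤n)
      where
      K = suc m₀
      -- The isotropic vectors v and their duals wd are paired with the same vectors in the opposite
      -- order. The matrix of products is unitriangular because v·v vanishes; the block wd·wd falls
      -- on the side that does not matter. Its size 2(m₀ + 1) is at least n + 1.
      v wd f g : ℕ → Vector n
      v i = u (κ ℕ.+ i)
      wd i = dual D (κ ℕ.+ i)
      f = split K v wd
      g = split K wd v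
      f· : ∀ i r {x y} → f i ≡ x → g r ≡ y → dot (f i) (g r) ≡ dot x y
      f· i r p q = cong₂ dot p q
      in-range : ∀ {i} → i ℕ.< K → κ ℕ.+ i ℕ.< suc k
      in-range i<K = ℕ.s≤s (ℕ.+-monoʳ-≤ κ (ℕ.≤-pred i<K))
      upper : ∀ {t} → K ℕ.+ t ℕ.≤ n → t ℕ.< K
      upper {t} le = ℕ.s≤s (ℕ.≤-trans (ℕ.+-cancelˡ-≤ m₀ _ _ (ℕ.≤-pred (begin
        suc m₀ ℕ.+ t ≤⟨ le ⟩
        n ≡⟨ order ⟩
        κ ℕ.+ (m₀ ℕ.+ m₀) ≤⟨ ℕ.+-monoˡ-≤ (m₀ ℕ.+ m₀) κ≤1 ⟩
        suc (m₀ ℕ.+ m₀) ∎))) ℕ.≤-refl)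
        where open ℕ.≤-Reasoning
      diag : ∀ i → (i ℕ.< K ⊎ ∃ λ t → i ≡ K ℕ.+ t) → i ℕ.≤ n → dot (f i) (g i) ≡ + 1 mod + 2
      diag i (inj₁ i<K) _ = mod-trans (mod-reflexive (f· i i (split-< K v wd i<K) (split-< K wd v i<K)))
          (dual-diagonal D (in-range i<K))
      diag i (inj₂ (t , refl)) le = mod-trans (mod-reflexive (trans (f· (K ℕ.+ t) (K ℕ.+ t) (split-≥ K v wd t)
          (split-≥ K wd v t)) (dot-comm (wd t) (v t))))
        (dual-diagonal D (in-range (upper le)))
      off : ∀ i r → (i ℕ.< K ⊎ ∃ λ t → i ≡ K ℕ.+ t) → (r ℕ.< K ⊎ ∃ λ t → r ≡ K ℕ.+ t) → i ℕ.< r → r ℕ.≤ n →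
          + 2 ∣ dot (f i) (g r)
      off i r (inj₁ i<K) (inj₁ r<K) i<r _ = subst (+ 2 ∣_) (sym (f· i r (split-< K v wd i<K) (split-< K wd v r<K)))
        (dual-other D (in-range i<K) (in-range r<K) (λ e → ℕ.<⇒≢ i<r (ℕ.+-cancelˡ-≡ κ _ _ e)))
      off i r (inj₁ i<K) (inj₂ (t , refl)) i<r _ = subst (+ 2 ∣_) (sym (trans (f· i (K ℕ.+ t) (split-< K v wd i<K)
          (split-≥ K wd v t)) (gram (κ ℕ.+ i) (κ ℕ.+ t))))
        (∣-*ˡ (sgn (κ ℕ.+ i)) (even-column (κ ℕ.+ i) t))
      off i r (inj₂ (s , refl)) (inj₁ r<K) i<r _ = ⊥-elim (ℕ.<-asym i<r (ℕ.<-≤-trans r<K (ℕ.m≤m+n K s)))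
      off i r (inj₂ (s , refl)) (inj₂ (t , refl)) i<r le = subst (+ 2 ∣_)
        (sym (trans (f· (K ℕ.+ s) (K ℕ.+ t) (split-≥ K v wd s) (split-≥ K wd v t)) (dot-comm (wd s) (v t))))
        (dual-other D (in-range (upper le)) (in-range (upper (ℕ.≤-trans (ℕ.<⇒≤ i<r) le)))
          (λ e → ℕ.<⇒≢ i<r (cong (K ℕ.+_) (sym (ℕ.+-cancelˡ-≡ κ _ _ e)))))

    relation : ∃ λ h → Monic k h × ∀ i → + 2 ∣ comb< (suc k) h u i
    relation = [ monic-relation S k , (λ D → ⊥-elim (no-dual D)) ]′ (dependent-or-dual prime-2 u (suc k))

    -- h(S)e = 2y makes every h(S)e·Sˡh(S)e divisible by 4, and modulo 4 only the squares survive.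
    squares : ∀ {h} → (∀ i → + 2 ∣ comb< (suc k) h u i) → ∀ l →
      + 4 ∣ ∑< (suc k) (λ i → sgn i * (h i * h i) * w (i ℕ.+ i ℕ.+ l))
    squares {h} rel l = mod⇒∣ (mod-trans (mod-sym (mod-trans (mod-reflexive expand)
        (mod-trans (∑-∑-diagonal (suc k) a pairs) (mod-reflexive (∑<-cong (suc k) (λ i _ → diagonal i))))))
      (∣⇒mod (subst (_∣ dot z (zl l)) (sym (solve 0 (con (+ 4) := con (+ 2) :* con (+ 2)) refl)) (∑-∣ (λ i → ∣-*
          (rel i) (zl-even l i))))))
      where
      z : Vector n
      z = comb< (suc k) h u
      zl : ℕ → Vector n
      zl l = comb< (suc k) h (λ j → u (l ℕ.+ j))
      zl-even : ∀ l i → + 2 ∣ zl l i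
      zl-even zero    i = rel i
      zl-even (suc l) i = subst (+ 2 ∣_) (sym (trans (∑<-cong (suc k) (λ j _ → cong (h j *_) (walkVec-suc S
          (l ℕ.+ j) i)))
        (sym (dot-comb<ʳ (suc k) (S i) h (λ j → u (l ℕ.+ j)))))) (∑-∣ (λ j → ∣-*ˡ (S i j) (zl-even l j)))
      a : ℕ → ℕ → ℤ
      a i j = h i * (h j * dot (u i) (u (l ℕ.+ j)))
      expand : dot z (zl l) ≡ ∑< (suc k) (λ i → ∑< (suc k) (a i))
      expand = trans (dot-comb<ˡ (suc k) (zl l) h u) (∑<-cong (suc k) (λ i _ → trans
        (cong (h i *_) (dot-comb<ʳ (suc k) (u i) h (λ j → u (l ℕ.+ j)))) (sym (∑-*ˡ {suc k} (h i) _))))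
      index : ∀ i j → i ℕ.+ (l ℕ.+ j) ≡ i ℕ.+ j ℕ.+ l
      index i j = trans (cong (i ℕ.+_) (ℕ.+-comm l j)) (sym (ℕ.+-assoc i j l))
      a-walk : ∀ i j → a i j ≡ h i * (h j * (sgn i * w (i ℕ.+ j ℕ.+ l)))
      a-walk i j = cong (λ z → h i * (h j * z)) (trans (gram i (l ℕ.+ j)) (cong (λ z → sgn i * w z) (index i j)))
      diagonal : ∀ i → a i i ≡ sgn i * (h i * h i) * w (i ℕ.+ i ℕ.+ l)
      diagonal i = trans (a-walk i i) (solve 3 (λ h s w → h :* (h :* (s :* w)) := s :* (h :* h) :* w) refl (h i)
          (sgn i) (w (i ℕ.+ i ℕ.+ l)))
      -- Distinct i and j exclude index 0, where the walk number n may be odd.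
      positive : ∀ i j → i ≢ j → + 2 ∣ w (i ℕ.+ j ℕ.+ l)
      positive zero    zero    i≢j = ⊥-elim (i≢j refl)
      positive zero    (suc j) i≢j = walks-even (j ℕ.+ l)
      positive (suc i) j       i≢j = walks-even (i ℕ.+ j ℕ.+ l)
      pairs : ∀ i j → i ≢ j → + 4 ∣ a i j + a j i
      pairs i j i≢j = subst₂ _∣_ (solve 0 (con (+ 2) :* con (+ 2) := con (+ 4)) refl)
        (sym (trans (cong₂ _+_ (a-walk i j) (trans (a-walk j i) (cong (λ z → h j * (h i * (sgn j * w (z ℕ.+ l))))
            (ℕ.+-comm j i))))
          (solve 5 (λ x y s t w → x :* (y :* (s :* w)) :+ y :* (x :* (t :* w)) :=
              (s :- con (+ 1) :+ (t :- con (+ 1)) :+ con (+ 2)) :* (x :* y :* w)) refl (h i) (h j) (sgn i)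
                  (sgn j) _)))
        (∣-* (∣-+ (∣-+ (sgn-odd i) (sgn-odd j)) ∣-refl) (∣-*ˡ (h i * h j) (positive i j i≢j)))

    module _ {m} (det-W : det′ (walkMatrix S) ≡ + (2 ℕ.^ m₀) * m) (odd : ¬ + 2 ∣ m) where

      private
        half-entry : ∀ i t → ∃ λ q → dot (u i) (u (κ ℕ.+ t)) ≡ q * + 2
        half-entry i t = _∣_.quotient even , _∣_.equality even
          where
          even : + 2 ∣ dot (u i) (u (κ ℕ.+ t))
          even = subst (+ 2 ∣_) (sym (gram i (κ ℕ.+ t))) (∣-*ˡ (sgn i) (even-column i t))

        -- The Gram matrix of the walk vectors with its even columns halved. There are n - κ = 2 m₀
        -- of them, exactly the power of 2 in (det W)², so an odd determinant m² remains.
        G : Mat ℤ n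
        G i j = split κ (λ j → dot (u (toℕ i)) (u j)) (λ t → proj₁ (half-entry (toℕ i) t)) (toℕ j)

        G-scaled : ∀ i j → G i j * split κ (λ _ → + 1) (λ _ → + 2) (toℕ j) ≡ dot (u (toℕ i)) (u (toℕ j))
        G-scaled i j with below-or-above κ (toℕ j)
        ... | inj₁ j<κ = trans (cong₂ _*_ (split-< κ (λ j → dot (u (toℕ i)) (u j)) _ j<κ) (split-< κ (λ _ →
            + 1) _ j<κ)) (*-identityʳ _)
        ... | inj₂ (t , e) = trans (cong₂ _*_ (trans (cong (split κ _ _) e) (split-≥ κ (λ j → dot (u (toℕ i))
            (u j)) _ t))
            (trans (cong (split κ _ _) e) (split-≥ κ (λ _ → + 1) _ t)))
          (trans (sym (proj₂ (half-entry (toℕ i) t))) (cong (λ z → dot (u (toℕ i)) (u z)) (sym e)))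

        power-≢0 : ∀ k → + (2 ℕ.^ k) ≢ + 0
        power-≢0 k e = ℕ.≢-nonZero⁻¹ (2 ℕ.^ k) {{ℕ.m^n≢0 2 k}} (ℤ.+-injective e)

        det-G : det′ G ≡ m * m
        det-G = *-cancelˡ (power-≢0 (m₀ ℕ.+ m₀)) (begin
          + (2 ℕ.^ (m₀ ℕ.+ m₀)) * det′ G ≡⟨ *-comm _ _ ⟩
          det′ G * + (2 ℕ.^ (m₀ ℕ.+ m₀)) ≡⟨ cong (λ z → det′ G * + (2 ℕ.^ z)) (sym n∸κ) ⟩
          det′ G * + (2 ℕ.^ (n ℕ.∸ κ)) ≡⟨ cong (det′ G *_) (det′-threshold n κ 2 (ℕ.≤-trans (ℕ.m≤m+n κ _)
              (ℕ.≤-reflexive (sym order)))) ⟨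
          det′ G * det′ {n} (threshold κ 2) ≡⟨ det′-⊡ G (threshold κ 2) ⟨
          det′ (G ⊡ threshold κ 2)
            ≡⟨ det′-gram _ (λ i j → trans (⊡-threshold G κ 2 i j) (G-scaled i j)) ⟩
          det′ (walkMatrix S) * det′ (walkMatrix S) ≡⟨ cong₂ _*_ det-W det-W ⟩
          + (2 ℕ.^ m₀) * m * (+ (2 ℕ.^ m₀) * m)
            ≡⟨ solve 2 (λ a m → a :* m :* (a :* m) := (a :* a) :* (m :* m)) refl (+ (2 ℕ.^ m₀)) m ⟩
          + (2 ℕ.^ m₀) * + (2 ℕ.^ m₀) * (m * m)
            ≡⟨ cong (_* (m * m)) (trans (sym (+-* (2 ℕ.^ m₀) (2 ℕ.^ m₀))) (cong +_ (sym
                (ℕ.^-distribˡ-+-* 2 m₀ m₀)))) ⟩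
          + (2 ℕ.^ (m₀ ℕ.+ m₀)) * (m * m) ∎)
          where open ≡-Reasoning

      -- In terms of the odd-determinant matrix `G` the hypothesis reads Gx ≡ 0 modulo 4, where x
      -- carries the factors 2 taken out of the columns. Hence 4 divides x, and c keeps at least one
      -- factor 2.
      nondegenerate : ∀ (c : ℕ → ℤ) → (∀ l → + 4 ∣ ∑< n (λ j → c j * w (j ℕ.+ l))) → ∀ j → j ℕ.< n → + 2 ∣ c j
      nondegenerate c h j j<n = subst (λ z → + 2 ∣ c z) (Fin.toℕ-fromℕ< j<n) (even-entry (Fin.fromℕ< j<n))
        where
        x : Vector n
        x j = split κ (λ _ → + 1) (λ _ → + 2) (toℕ j) * c (toℕ j)
        Gx : ∀ i → + 4 ∣ (G ▹ x) i
        Gx i = subst (+ 4 ∣_) (sym (trans (∑-cong (λ j → trans (sym (*-assoc (G i j) _ _)) (trans (cong (_* c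
            (toℕ j)) (trans (G-scaled i j) (gram (toℕ i) (toℕ j))))
            (trans (solve 3 (λ s w c → s :* w :* c := s :* (c :* w)) refl (sgn (toℕ i)) _ (c (toℕ j))) (cong (λ z →
                sgn (toℕ i) * (c (toℕ j) * w z)) (ℕ.+-comm (toℕ i) (toℕ j)))))))
          (∑-*ˡ (sgn (toℕ i)) (λ j → c (toℕ j) * w (toℕ j ℕ.+ toℕ i))))) (∣-*ˡ (sgn (toℕ i)) (h (toℕ i)))
        odd-G : ¬ + 2 ∣ det′ G
        odd-G e = [ odd , odd ]′ (prime-∣-* prime-2 m m (subst (+ 2 ∣_) det-G e))
        even-entry : ∀ i → + 2 ∣ c (toℕ i)
        even-entry i = [ (λ i<κ → subst (+ 2 ∣_) (trans (cong (_* c (toℕ i)) (split-< κ (λ _ → + 1) _ i<κ))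
            (*-identityˡ _))
              (∣-trans (divides (+ 2) (solve 0 (con (+ 4) := con (+ 2) :* con (+ 2)) refl)) four))
          , (λ { (t , e') → divides (_∣_.quotient four) (*-cancelˡ {+ 2} (λ ()) (trans
              (cong (_* c (toℕ i)) (sym (trans (cong (split κ _ _) e') (split-≥ κ (λ _ → + 1) (λ _ → + 2) t))))
              (trans (_∣_.equality four) (solve 1 (λ q → q :* con (+ 4) := con (+ 2) :* (q :* con
                  (+ 2))) refl _)))) }) ]′ (below-or-above κ (toℕ i))
          where
          2*2 : + 2 * + 2 ≡ + 4
          2*2 = *-def (+ 2) (+ 2)
          four : + 4 ∣ x i
          four = subst (_∣ x i) 2*2 (prime-square-cancel prime-2 (x i) odd-G (subst (_∣ det′ G * x i) (sym 2*2)
              (▹-∣ G x Gx i)))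

-- The relation modulo 2 is determined by the walk numbers

spread : (ℕ → ℤ) → ℕ → ℤ
spread t zero          = t zero
spread t (suc zero)    = + 0
spread t (suc (suc j)) = spread (t ∘ suc) j

spread-even : ∀ t i → spread t (i ℕ.+ i) ≡ t i
spread-even t zero    = refl
spread-even t (suc i) = trans (cong (λ z → spread t (suc z)) (ℕ.+-suc i i)) (spread-even (t ∘ suc) i)

spread-odd : ∀ t i → spread t (suc (i ℕ.+ i)) ≡ + 0
spread-odd t zero    = refl
spread-odd t (suc i) = trans (cong (λ z → spread t (suc (suc z))) (ℕ.+-suc i i)) (spread-odd (t ∘ suc) i)

∑<-spread : ∀ k t (f : ℕ → ℤ) → ∑< (k ℕ.+ k) (λ j → spread t j * f j) ≡ ∑< k (λ i → t i * f (i ℕ.+ i))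
∑<-spread zero    t f = trans (∑-empty _) (sym (∑-empty _))
∑<-spread (suc k) t f = begin
  ∑< (suc k ℕ.+ suc k) (λ j → spread t j * f j)
    ≡⟨ cong (λ z → ∑< (suc z) (λ j → spread t j * f j)) (ℕ.+-suc k k) ⟩
  ∑< (suc (suc (k ℕ.+ k))) (λ j → spread t j * f j)
    ≡⟨ trans (∑-suc _) (cong (_+_ (t 0 * f 0)) (∑-suc _)) ⟩
  t 0 * f 0 + (+ 0 * f 1 + ∑< (k ℕ.+ k) (λ j → spread (t ∘ suc) j * f (suc (suc j))))
    ≡⟨ cong (_+_ (t 0 * f 0)) (trans (cong₂ _+_ (zeroˡ (f 1)) (∑<-spread k (t ∘ suc) (λ j → f (suc (suc j)))))
        (+-identityˡ _)) ⟩
  t 0 * f 0 + ∑< k (λ i → t (suc i) * f (suc (suc (i ℕ.+ i))))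
    ≡⟨ cong (_+_ (t 0 * f 0)) (∑<-cong k (λ i _ → cong (λ z → t (suc i) * f (suc z)) (sym (ℕ.+-suc i i)))) ⟩
  t 0 * f 0 + ∑< k (λ i → t (suc i) * f (suc i ℕ.+ suc i)) ≡⟨ ∑-suc _ ⟨
  ∑< (suc k) (λ i → t i * f (i ℕ.+ i)) ∎
  where open ≡-Reasoning

-- Here 2k = n + κ. If κ = 1, the one additional index is n itself, which is odd, so its term
-- vanishes.
∑<-2k : ∀ κ m₀ {n} → κ ℕ.≤ 1 → n ≡ κ ℕ.+ (m₀ ℕ.+ m₀) → ∀ (f : ℕ → ℤ) → (∀ i → f (suc (i ℕ.+ i)) ≡ + 0) →
  ∑< (κ ℕ.+ m₀ ℕ.+ (κ ℕ.+ m₀)) f ≡ ∑< n f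
∑<-2k zero          m₀ _          refl f zero-odd = refl
∑<-2k (suc zero)    m₀ _          refl f zero-odd = trans (cong (λ z → ∑< z f) (cong suc (ℕ.+-suc m₀ m₀)))
  (trans (∑<-snoc (suc (m₀ ℕ.+ m₀)) f) (trans (cong (_+_ (∑< (suc (m₀ ℕ.+ m₀)) f)) (zero-odd m₀)) (+-identityʳ _)))
∑<-2k (suc (suc _)) m₀ (ℕ.s≤s ()) _    f zero-odd

odd-≢0 : ∀ {m} → ¬ + 2 ∣ m → m ≢ + 0
odd-≢0 odd refl = odd ∣-0

scaled-inverse : ∀ {n} {m} (V : Mat ℤ n) → det′ V ≡ m → ∃ λ L → ∀ i j → (L ⊡ V) i j ≡ + ∣ m ∣ * δℤ i j
scaled-inverse {n} {m} V e with ℤ.+∣i∣≡i⊎+∣i∣≡-i m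
... | inj₁ p = adjugate V , λ i j → trans (adjugate-inverseˡ V i j) (cong (_* δℤ i j) (trans e (sym p)))
... | inj₂ p = (λ i j → -[1+ 0 ] * adjugate V i j) , λ i j → trans
  (trans (∑-cong (λ k → *-assoc -[1+ 0 ] (adjugate V i k) (V k j))) (trans (∑-*ˡ -[1+ 0 ] _) (cong (-[1+ 0 ] *_)
      (adjugate-inverseˡ V i j))))
  (trans (solve 2 (λ a b → con -[1+ 0 ] :* (a :* b) := (:- a) :* b) refl (det′ V) (δℤ i j))
    (cong (_* δℤ i j) (trans (cong -_ e) (trans (neg-def m) (sym p)))))

-- B = μ Qᵀ for the regular orthogonal Q with QᵀSQ = S'.
record Transfer {n} (S S' : Mat ℤ n) (μ : ℤ) : Set where
  field
    B : Mat ℤ n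
    B-walk  : ∀ j → B ▹ walkVec S j ≗ (λ i → μ * walkVec S' j i)
    Bᵗ-walk : ∀ j → B ᵗ ▹ walkVec S' j ≗ (λ i → μ * walkVec S j i)
    BᵗB : ∀ i j → (B ᵗ ⊡ B) i j ≡ μ * μ * δℤ i j
    BBᵗ : ∀ i j → (B ⊡ B ᵗ) i j ≡ μ * μ * δℤ i j
    intertwines : ∀ i j → (B ⊡ S) i j ≡ (S' ⊡ B) i j

∏-≢0 : ∀ {n} {f : Fin n → ℤ} → (∀ i → f i ≢ + 0) → ∏ f ≢ + 0
∏-≢0 {zero}  h ()
∏-≢0 {suc n} h e = ∏-≢0 (h ∘ suc) (integral-domain e (h zero))

scalar-inverse-comm : ∀ {n} (X Y : Mat ℤ n) c → c ≢ + 0 → (∀ i j → (X ⊡ Y) i j ≡ c * δℤ i j) → ∀ i j →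
    (Y ⊡ X) i j ≡ c * δℤ i j
scalar-inverse-comm {n} X Y c c≢0 h = ⊡-cancelʳ Y det-Y (λ i j → trans (⊡-assoc Y X Y i j) (trans
  (⊡-cong {A = Y} (λ _ _ → refl) h i j) (trans (⊡-scalar c Y i j) (sym (scalar-⊡ c Y i j)))))
  where
  det-c : det′ {n} (scalar c) ≢ + 0
  det-c e = ∏-≢0 {n} (λ i e → c≢0 (trans (sym (*-identityʳ c)) (trans (cong (c *_) (sym (δ-refl i))) e)))
    (trans (sym (mod-0⇒≡ (det′-triangular {n = n} (scalar c) (λ i j j<i → subst (+ 0 ∣_)
      (sym (trans (cong (c *_) (δ-≢ {i = i} {j} (λ { refl → ℕ.<-irrefl refl j<i }))) (zeroʳ c))) ∣-0)))) e)
  det-Y : det′ Y ≢ + 0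
  det-Y e = det-c (trans (sym (det′-cong h)) (trans (det′-⊡ X Y) (trans (cong (det′ X *_) e) (zeroʳ _))))

2^≢0 : ∀ k → + (2 ℕ.^ k) ≢ + 0
2^≢0 k e = ℕ.≢-nonZero⁻¹ (2 ℕ.^ k) {{ℕ.m^n≢0 2 k}} (ℤ.+-injective e)

module _ {n} (H : Halved n) {S S' : Mat ℤ n} (sk : Skew S) (sk' : Skew S') (walks≡ : ∀ k → walks S k ≡ walks S' k)
  {m} (det-W : det′ (walkMatrix S) ≡ + (2 ℕ.^ Halved.m₀ H) * m) (odd : ¬ + 2 ∣ m)
  {h h' : ℕ → ℤ} (monic : Monic (TwoAdic.k H) h) (monic' : Monic (TwoAdic.k H) h')
  (rel : ∀ i → + 2 ∣ comb< (suc (TwoAdic.k H)) h (walkVec S) i) (rel' : ∀ i → + 2 ∣ comb< (suc (TwoAdic.k H)) h'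
      (walkVec S') i) where

  open Halved H
  open TwoAdic H
  private
    module R = Rank sk
    module R' = Rank sk'

    t : ℕ → ℤ
    t i = sgn i * (h i * h i) - sgn i * (h' i * h' i)

    difference : ∀ l → + 4 ∣ ∑< k (λ i → t i * walks S (i ℕ.+ i ℕ.+ l))
    difference l = subst (+ 4 ∣_) (trans (trans (cong (_+_ (∑< (suc k) (λ i → sgn i * (h i * h i) * walks S
        (i ℕ.+ i ℕ.+ l)))) (sym (∑-neg {suc k} _))) (trans (sym (∑-+ {suc k} _ _))
        (∑<-cong (suc k) (λ i _ → trans (cong (λ z → sgn i * (h i * h i) * walks S (i ℕ.+ i ℕ.+ l) - sgn i *
            (h' i * h' i) * z) (sym (walks≡ (i ℕ.+ i ℕ.+ l))))
          (solve 3 (λ a b w → a :* w :- b :* w := (a :- b) :* w) refl (sgn i * (h i * h i)) (sgn i *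
              (h' i * h' i)) _)))))
        (trans (∑<-snoc k (λ i → t i * walks S (i ℕ.+ i ℕ.+ l))) (trans (cong (λ z → ∑< k (λ i → t i * walks S
            (i ℕ.+ i ℕ.+ l)) + z * walks S (k ℕ.+ k ℕ.+ l)) t-k)
          (trans (cong (_+_ (∑< k (λ i → t i * walks S (i ℕ.+ i ℕ.+ l)))) (zeroˡ (walks S (k ℕ.+ k ℕ.+ l))))
              (+-identityʳ _)))))
      (∣-- (R.squares {h} rel l) (R'.squares {h'} rel' l))
      where
      -- Both relations are monic, so the top terms cancel; only indices i < k remain, for which 2i
      -- < n.
      t-k : t k ≡ + 0
      t-k = trans (cong₂ (λ x y → sgn k * (x * x) - sgn k * (y * y)) (lead monic) (lead monic')) (-‿inverseʳ
          (sgn k * (+ 1 * + 1)))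

    i+i<n : ∀ {i} → i ℕ.< k → i ℕ.+ i ℕ.< n
    i+i<n {i} i<k = ℕ.+-cancelˡ-≤ κ _ _ (begin
      κ ℕ.+ suc (i ℕ.+ i) ≤⟨ ℕ.+-monoˡ-≤ _ κ≤1 ⟩
      suc (suc (i ℕ.+ i)) ≡⟨ cong suc (ℕ.+-suc i i) ⟨
      suc i ℕ.+ suc i ≤⟨ ℕ.+-mono-≤ i<k i<k ⟩
      k ℕ.+ k ≡⟨ ℕ.+-assoc κ m₀ k ⟩
      κ ℕ.+ (m₀ ℕ.+ k) ≡⟨ cong (κ ℕ.+_) (trans (sym (ℕ.+-assoc m₀ κ m₀)) (trans (cong (ℕ._+ m₀) (ℕ.+-comm m₀ κ))
          (ℕ.+-assoc κ m₀ m₀))) ⟩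
      κ ℕ.+ (κ ℕ.+ (m₀ ℕ.+ m₀)) ≡⟨ cong (κ ℕ.+_) (sym order) ⟩
      κ ℕ.+ n ∎)
      where open ℕ.≤-Reasoning

    -- Only walk numbers of index 2i + l occur in `difference`, so t is placed at the even indices
    -- to become a coefficient vector for `nondegenerate`.
    t-even : ∀ i → i ℕ.< k → + 2 ∣ t i
    t-even i i<k = subst (+ 2 ∣_) (spread-even t i) (R.nondegenerate det-W odd (spread t)
      (λ l → subst (+ 4 ∣_) (trans (sym (∑<-spread k t (λ j → walks S (j ℕ.+ l))))
        (∑<-2k κ m₀ κ≤1 order (λ j → spread t j * walks S (j ℕ.+ l)) (λ i → trans (cong (_* walks S (suc
            (i ℕ.+ i) ℕ.+ l)) (spread-odd t i)) (zeroˡ _)))) (difference l))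
      (i ℕ.+ i) (i+i<n i<k))

    h≡h' : ∀ i → i ℕ.< suc k → h i ≡ h' i mod + 2
    h≡h' i i≤k = [ (λ i<k → congruent (from-squares (t-even i i<k)))
                 , (λ { refl → mod-reflexive (trans (lead monic) (sym (lead monic'))) }) ]′ (ℕ.m≤n⇒m<n∨m≡n
                     (ℕ.≤-pred i≤k))
      where
      -- Modulo 2, a² - b² equals (a - b)².
      from-squares : + 2 ∣ t i → + 2 ∣ h i - h' i
      from-squares e = [ (λ d → d) , (λ d → d) ]′ (prime-∣-* prime-2 (h i - h' i) (h i - h' i)
        (subst (+ 2 ∣_) (solve 2 (λ a b → (a :* a :- b :* b) :- con (+ 2) :* (b :* (a :- b)) := (a :- b) :*
            (a :- b)) refl (h i) (h' i))
          (∣-- (sgn-∣ i (subst (+ 2 ∣_) (solve 3 (λ s a b → s :* a :- s :* b := s :* (a :- b)) refl (sgn i)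
              (h i * h i) (h' i * h' i)) e))
            (∣-*ʳ (h' i * (h i - h' i)) ∣-refl))))

  -- The coefficients of the two relations agree modulo 2, so one integral h can be used for both
  -- graphs.
  common-relation : ∀ i → + 2 ∣ comb< (suc k) h (walkVec S') i
  common-relation i = mod-∣ (mod-∑< (suc k) (λ j j≤k → mod-* (h≡h' j j≤k) (mod-refl {a = walkVec S' j i}))) (rel' i)

-- Construction of the transfer matrix B

module Construct {n} (H : Halved n) {S S' : Mat ℤ n} (sk : Skew S) (sk' : Skew S') (walks≡ : ∀ k → walks S k ≡ walks S' k)
  {m} (det-W : det′ (walkMatrix S) ≡ + (2 ℕ.^ Halved.m₀ H) * m) (odd : ¬ + 2 ∣ m)
  (h : ℕ → ℤ) (monic : Monic (TwoAdic.k H) h) (y y' : Vector n)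
  (y-eq : ∀ i → comb< (suc (TwoAdic.k H)) h (walkVec S) i ≡ + 2 * y i)
  (y'-eq : ∀ i → comb< (suc (TwoAdic.k H)) h (walkVec S') i ≡ + 2 * y' i)
  (L : Mat ℤ n) (LV : ∀ i j → (L ⊡ reduced S (TwoAdic.k H) y) i j ≡ + ∣ m ∣ * δℤ i j) where

  open Halved H
  open TwoAdic H
  private
    V V' D W W' Hm : Mat ℤ n
    V = reduced S k y
    V' = reduced S' k y'
    D = threshold k 2
    W = walkMatrix S
    W' = walkMatrix S'
    Hm = shift-matrix n k h

    product-≢0 : ∀ {a b} → a ≢ + 0 → b ≢ + 0 → a * b ≢ + 0
    product-≢0 a≢0 b≢0 e = b≢0 (integral-domain e a≢0)

    det-W≢0 : det′ W ≢ + 0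
    det-W≢0 e = product-≢0 (2^≢0 m₀) (odd-≢0 odd) (trans (sym det-W) e)

    gram-equal : ∀ i j → dot (walkVec S i) (walkVec S j) ≡ dot (walkVec S' i) (walkVec S' j)
    gram-equal i j = trans (Gram.gram sk i j) (trans (cong (sgn i *_) (walks≡ (i ℕ.+ j))) (sym (Gram.gram sk' i j)))

    -- Both walk matrices have the same Gram matrix, hence the same squared determinant.
    det-W'≢0 : det′ W' ≢ + 0
    det-W'≢0 e = product-≢0 det-W≢0 det-W≢0 (trans (sym (Gram.det′-gram sk (λ i j → dot (walkVec S (toℕ i))
        (walkVec S (toℕ j))) (λ i j → refl)))
      (trans (Gram.det′-gram sk' _ (λ i j → gram-equal (toℕ i) (toℕ j))) (trans (cong (det′ W' *_) e) (zeroʳ _))))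

    transpose-≢0 : ∀ {M : Mat ℤ n} → det′ M ≢ + 0 → det′ (M ᵗ) ≢ + 0
    transpose-≢0 {M} h e = h (trans (sym (det′-ᵗ M)) e)

  μ : ℤ
  μ = + ∣ m ∣

  μ≢0 : μ ≢ + 0
  μ≢0 e = odd-≢0 odd (ℤ.∣i∣≡0⇒i≡0 (ℤ.+-injective e))

  private
    -- Since L is μ times the inverse of V, this is the integral matrix with BV = μV'.
    B : Mat ℤ n
    B = V' ⊡ L

    BV : ∀ i j → (B ⊡ V) i j ≡ μ * V' i j
    BV i j = trans (⊡-assoc V' L V i j) (trans (⊡-cong {A = V'} (λ _ _ → refl) LV i j) (⊡-scalar μ V' i j))

    -- V and V' arise from W and W' through the same matrices `Hm` and `D`, because h is shared;
    -- `Hm` has determinant 1 and cancels.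
    BW : ∀ i j → (B ⊡ W) i j ≡ μ * W' i j
    BW i j = trans (⊡-cancelʳ {X = B ⊡ W} {scalar μ ⊡ W'} Hm (λ e → one≢0 (trans (sym
        (det′-shift-matrix n k monic)) e)) (λ i j → begin
        ((B ⊡ W) ⊡ Hm) i j ≡⟨ ⊡-assoc B W Hm i j ⟩
        (B ⊡ (W ⊡ Hm)) i j ≡⟨ ⊡-cong {A = B} (λ _ _ → refl) (walk-factorization S k h y 2 monic y-eq) i j ⟩
        (B ⊡ (V ⊡ D)) i j ≡⟨ ⊡-assoc B V D i j ⟨
        ((B ⊡ V) ⊡ D) i j ≡⟨ ⊡-cong {B = D} (λ i j → trans (BV i j) (sym (scalar-⊡ μ V' i j))) (λ _ _ → refl) i j ⟩
        ((scalar μ ⊡ V') ⊡ D) i j ≡⟨ ⊡-assoc (scalar μ) V' D i j ⟩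
        (scalar μ ⊡ (V' ⊡ D)) i j ≡⟨ ⊡-cong {A = scalar μ} (λ _ _ → refl) (λ i j → sym
            (walk-factorization S' k h y' 2 monic y'-eq i j)) i j ⟩
        (scalar μ ⊡ (W' ⊡ Hm)) i j ≡⟨ ⊡-assoc (scalar μ) W' Hm i j ⟨
        ((scalar μ ⊡ W') ⊡ Hm) i j ∎) i j)
      (scalar-⊡ μ W' i j)
      where
      open ≡-Reasoning
      one≢0 : + 1 ≢ + 0
      one≢0 ()

    B-low : ∀ (j : Fin n) → B ▹ walkVec S (toℕ j) ≗ (λ i → μ * walkVec S' (toℕ j) i)
    B-low j i = BW i j

    dot-B : ∀ (x z : Vector n) → dot (B ▹ x) (B ▹ z) ≡ dot x (B ᵗ ▹ (B ▹ z))
    dot-B x z = dot-▹ B x (B ▹ z)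

    -- Tested against the columns of W, both sides have the products prescribed by the common Gram
    -- matrix.
    BᵗB-low : ∀ (j : Fin n) → B ᵗ ▹ (B ▹ walkVec S (toℕ j)) ≗ (λ i → μ * μ * walkVec S (toℕ j) i)
    BᵗB-low j = ≗-injective (W ᵗ) (transpose-≢0 {W} det-W≢0) (λ i → trans (sym (dot-B (walkVec S (toℕ i)) (walkVec S
        (toℕ j))))
      (trans (dot-cong (B-low i) (B-low j)) (trans (dot-*ˡ μ _ (walkVec S' (toℕ i))) (trans (cong (μ *_) (dot-*ʳ μ
          (walkVec S' (toℕ i)) _))
        (trans (sym (*-assoc μ μ _)) (trans (cong (μ * μ *_) (sym (gram-equal (toℕ i) (toℕ j)))) (sym (dot-*ʳ
            (μ * μ) (walkVec S (toℕ i)) _))))))))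

    BᵗB : ∀ i j → (B ᵗ ⊡ B) i j ≡ μ * μ * δℤ i j
    BᵗB = ⊡-cancelʳ W det-W≢0 (λ i j → trans (▹-▹ (B ᵗ) B (walkVec S (toℕ j)) i)
      (trans (BᵗB-low j i) (sym (scalar-▹ (μ * μ) (walkVec S (toℕ j)) i))))

    -- For j ≥ n the vector is no column of W. It is identified through its products with the
    -- columns of W', since `intertwines` is itself deduced from this lemma.
    B-walk : ∀ j → B ▹ walkVec S j ≗ (λ i → μ * walkVec S' j i)
    B-walk j = ≗-injective (W' ᵗ) (transpose-≢0 {W'} det-W'≢0) (λ i → *-cancelˡ μ≢0 (begin
      μ * dot (walkVec S' (toℕ i)) (B ▹ walkVec S j) ≡⟨ dot-*ˡ μ (B ▹ walkVec S j) (walkVec S' (toℕ i)) ⟨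
      dot (λ l → μ * walkVec S' (toℕ i) l) (B ▹ walkVec S j) ≡⟨ dot-cong (λ l → sym (B-low i l)) (λ _ → refl) ⟩
      dot (B ▹ walkVec S (toℕ i)) (B ▹ walkVec S j) ≡⟨ dot-B (walkVec S (toℕ i)) (walkVec S j) ⟩
      dot (walkVec S (toℕ i)) (B ᵗ ▹ (B ▹ walkVec S j))
        ≡⟨ dot-cong {x = walkVec S (toℕ i)} (λ _ → refl) (λ l → trans (sym (▹-▹ (B ᵗ) B (walkVec S j) l)) (trans
            (▹-congˡ (walkVec S j) BᵗB l) (scalar-▹ (μ * μ) (walkVec S j) l))) ⟩
      dot (walkVec S (toℕ i)) (λ l → μ * μ * walkVec S j l) ≡⟨ dot-*ʳ (μ * μ) (walkVec S (toℕ i)) (walkVec S j) ⟩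
      μ * μ * dot (walkVec S (toℕ i)) (walkVec S j) ≡⟨ cong (μ * μ *_) (gram-equal (toℕ i) j) ⟩
      μ * μ * dot (walkVec S' (toℕ i)) (walkVec S' j) ≡⟨ *-assoc μ μ _ ⟩
      μ * (μ * dot (walkVec S' (toℕ i)) (walkVec S' j)) ≡⟨ cong (μ *_) (dot-*ʳ μ (walkVec S' (toℕ i))
          (walkVec S' j)) ⟨
      μ * dot (walkVec S' (toℕ i)) (λ l → μ * walkVec S' j l) ∎))
      where open ≡-Reasoning

    Bᵗ-walk : ∀ j → B ᵗ ▹ walkVec S' j ≗ (λ i → μ * walkVec S j i)
    Bᵗ-walk j i = *-cancelˡ μ≢0 (trans (sym (dot-*ʳ μ ((B ᵗ) i) (walkVec S' j))) (trans (▹-congʳ (B ᵗ) (λ l → sym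
        (B-walk j l)) i)
      (trans (sym (▹-▹ (B ᵗ) B (walkVec S j) i)) (trans (▹-congˡ (walkVec S j) BᵗB i) (trans (scalar-▹ (μ * μ)
          (walkVec S j) i) (*-assoc μ μ _))))))

    intertwines : ∀ i j → (B ⊡ S) i j ≡ (S' ⊡ B) i j
    intertwines = ⊡-cancelʳ W det-W≢0 (λ i j → begin
      ((B ⊡ S) ▹ walkVec S (toℕ j)) i ≡⟨ ▹-▹ B S (walkVec S (toℕ j)) i ⟩
      (B ▹ (S ▹ walkVec S (toℕ j))) i ≡⟨ ▹-congʳ B (walkVec-suc S (toℕ j)) i ⟨
      (B ▹ walkVec S (suc (toℕ j))) i ≡⟨ B-walk (suc (toℕ j)) i ⟩
      μ * walkVec S' (suc (toℕ j)) i ≡⟨ cong (μ *_) (walkVec-suc S' (toℕ j) i) ⟩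
      μ * (S' ▹ walkVec S' (toℕ j)) i ≡⟨ dot-*ʳ μ (S' i) (walkVec S' (toℕ j)) ⟨
      (S' ▹ (λ l → μ * walkVec S' (toℕ j) l)) i ≡⟨ ▹-congʳ S' (B-walk (toℕ j)) i ⟨
      (S' ▹ (B ▹ walkVec S (toℕ j))) i ≡⟨ ▹-▹ S' B (walkVec S (toℕ j)) i ⟨
      ((S' ⊡ B) ▹ walkVec S (toℕ j)) i ∎)
      where open ≡-Reasoning

  transfer : Transfer S S' μ
  transfer = record
    { B = B ; B-walk = B-walk ; Bᵗ-walk = Bᵗ-walk ; BᵗB = BᵗB
    ; BBᵗ = scalar-inverse-comm (B ᵗ) B (μ * μ) (product-≢0 μ≢0 μ≢0) BᵗB ; intertwines = intertwines }

CommonRelation : ∀ {n} → Halved n → Mat ℤ n → Mat ℤ n → Set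
CommonRelation {n} H S S' = ∃ λ h → Monic k h × (∃ λ (y : Vector n) → ∀ i → comb< (suc k) h (walkVec S) i ≡ + 2 * y i)
  × ∃ λ (y : Vector n) → ∀ i → comb< (suc k) h (walkVec S') i ≡ + 2 * y i
  where open TwoAdic H using (k)

module _ {n} (H : Halved n) {S S' : Mat ℤ n} (sk : Skew S) (sk' : Skew S') (walks≡ : ∀ k → walks S k ≡ walks S' k)
  {m} (det-W : det′ (walkMatrix S) ≡ + (2 ℕ.^ Halved.m₀ H) * m) (odd : ¬ + 2 ∣ m) where

  open Halved H
  open TwoAdic H

  private
    halves : ∀ {x : Vector n} → (∀ i → + 2 ∣ x i) → ∃ λ (y : Vector n) → ∀ i → x i ≡ + 2 * y i
    halves rel = (λ i → _∣_.quotient (rel i)) , λ i → trans (_∣_.equality (rel i)) (*-comm _ _)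

    common : (∃ λ h → Monic k h × ∀ i → + 2 ∣ comb< (suc k) h (walkVec S) i) →
      (∃ λ h → Monic k h × ∀ i → + 2 ∣ comb< (suc k) h (walkVec S') i) → CommonRelation H S S'
    common (h , monic , rel) (h' , monic' , rel') = h , monic , halves rel , halves
        (common-relation H sk sk' walks≡ det-W odd monic monic' rel rel')

    from-common : CommonRelation H S S' → Transfer S S' (+ ∣ m ∣)
    from-common (h , monic , (y , y-eq) , (y' , y'-eq)) = with-inverse (scaled-inverse (reduced S k y) det-V)
      where
      -- As n - k = m₀, the division by 2 uses up the whole factor 2^m₀ of det W.
      det-V : det′ (reduced S k y) ≡ m
      det-V = *-cancelˡ (2^≢0 m₀) (trans (*-comm _ _) (trans (cong (λ z → det′ (reduced S k y) * + (2 ℕ.^ z))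
          (sym n∸k))
        (trans (sym (det′-reduced S k h y 2 monic k≤n y-eq)) det-W)))
      with-inverse : (∃ λ L → ∀ i j → (L ⊡ reduced S k y) i j ≡ + ∣ m ∣ * δℤ i j) → Transfer S S' (+ ∣ m ∣)
      with-inverse (L , LV) = Construct.transfer H sk sk' walks≡ det-W odd h monic y y' y-eq y'-eq L LV

  transfer : Transfer S S' (+ ∣ m ∣)
  transfer = from-common (common (Rank.relation sk) (Rank.relation sk'))

-- Odd primes dividing det W exactly once

negate : ∀ {n} → Mat ℤ n → Mat ℤ n
negate S i j = - S i j

negate-▹ : ∀ {n} (S : Mat ℤ n) x → negate S ▹ x ≗ (λ i → - (S ▹ x) i)
negate-▹ S x i = trans (∑-cong (λ k → solve 2 (λ a b → (:- a) :* b := :- (a :* b)) refl (S i k) (x k))) (∑-neg _)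

walkVec-negate : ∀ {n} (S : Mat ℤ n) j → walkVec (negate S) j ≗ (λ i → sgn j * walkVec S j i)
walkVec-negate S zero    i = sym (*-identityˡ _)
walkVec-negate S (suc j) i = begin
  walkVec (negate S) (suc j) i ≡⟨ walkVec-suc (negate S) j i ⟩
  (negate S ▹ walkVec (negate S) j) i ≡⟨ ▹-congʳ (negate S) (walkVec-negate S j) i ⟩
  (negate S ▹ (λ i → sgn j * walkVec S j i)) i ≡⟨ negate-▹ S _ i ⟩
  - (S ▹ (λ i → sgn j * walkVec S j i)) i ≡⟨ cong -_ (dot-*ʳ (sgn j) (S i) (walkVec S j)) ⟩
  - (sgn j * (S ▹ walkVec S j) i) ≡⟨ cong (λ z → - (sgn j * z)) (walkVec-suc S j i) ⟨
  - (sgn j * walkVec S (suc j) i) ≡⟨ solve 2 (λ s x → :- (s :* x) := (:- s) :* x) refl (sgn j) _ ⟩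
  - sgn j * walkVec S (suc j) i ≡⟨ cong (_* walkVec S (suc j) i) (sgn-suc j) ⟨
  sgn (suc j) * walkVec S (suc j) i ∎
  where open ≡-Reasoning

extend-by-0 : ∀ {m} → (Fin m → ℤ) → ℕ → ℤ
extend-by-0 {zero}  g _       = + 0
extend-by-0 {suc m} g zero    = g zero
extend-by-0 {suc m} g (suc j) = extend-by-0 (g ∘ suc) j

extend-toℕ : ∀ {m} (g : Fin m → ℤ) i → extend-by-0 g (toℕ i) ≡ g i
extend-toℕ g zero    = refl
extend-toℕ g (suc i) = extend-toℕ (g ∘ suc) i

dot-bilinear : ∀ {n} a b a' b' (x y x' y' : Vector n) →
  dot (λ i → a * x i + b * y i) (λ i → a' * x' i + b' * y' i) ≡
  a * a' * dot x x' + (a * b' * dot x y' + b * a' * dot y x') + b * b' * dot y y'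
dot-bilinear a b a' b' x y x' y' = begin
  dot (λ i → a * x i + b * y i) v' ≡⟨ dot-linˡ b v' (λ i → a * x i) y ⟩
  dot (λ i → a * x i) v' + b * dot y v' ≡⟨ cong₂ (λ s t → s + b * t) (trans (dot-*ˡ a v' x) (cong (a *_) (right x)))
      (right y) ⟩
  a * (a' * dot x x' + b' * dot x y') + b * (a' * dot y x' + b' * dot y y')
    ≡⟨ solve 8 (λ a b a' b' s t u v → a :* (a' :* s :+ b' :* t) :+ b :* (a' :* u :+ b' :* v) :=
         a :* a' :* s :+ (a :* b' :* t :+ b :* a' :* u) :+ b :* b' :* v) refl a b a' b' _ _ _ _ ⟩
  a * a' * dot x x' + (a * b' * dot x y' + b * a' * dot y x') + b * b' * dot y y' ∎
  where
  open ≡-Reasoning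
  v' : Vector _
  v' i = a' * x' i + b' * y' i
  right : ∀ x → dot x v' ≡ a' * dot x x' + b' * dot x y'
  right x = trans (dot-linʳ b' x (λ i → a' * x' i) y') (cong (_+ b' * dot x y') (dot-*ʳ a' x x'))

-- Modulo p the space M spanned by e, …, S^{k-1}e (k = n - 1) is a hyperplane, and y completes it to a basis.
module Hyperplane {k} {S : Mat ℤ (suc k)} {p} (pr : Prime p) {h : ℕ → ℤ} (monic : Monic k h) (y : Vector (suc k))
  (y-eq : ∀ i → comb< (suc k) h (walkVec S) i ≡ + p * y i) (p∤V : ¬ + p ∣ det′ (reduced S k y)) where

  private
    n = suc k
    u = walkVec S
    P = + p
    V : Mat ℤ n
    V = reduced S k y
    column-y : split k u (λ t → iterate S t y) k ≡ y
    column-y = trans (cong (split k u (λ t → iterate S t y)) (sym (ℕ.+-identityʳ k))) (split-≥ k u _ 0)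

  δV : ℤ
  δV = det′ V

  V-columns : ∀ (γ : ℕ → ℤ) i → ∑< n (λ j → split k u (λ t → iterate S t y) j i * γ j) ≡ comb< k γ u i + γ k * y i
  V-columns γ i = trans (∑<-snoc k (λ j → split k u (λ t → iterate S t y) j i * γ j)) (cong₂ _+_
    (∑<-cong k (λ j j<k → trans (cong (λ f → f i * γ j) (split-< k u (λ t → iterate S t y) j<k)) (*-comm (u j i)
        (γ j))))
    (trans (cong (λ f → f i * γ k) column-y) (*-comm (y i) (γ k))))

  -- The k + 1 vectors tested are all the columns of V, which is invertible modulo p.
  vanish : ∀ x → (∀ {j} → j ℕ.< k → P ∣ dot (u j) x) → P ∣ dot y x → ∀ i → P ∣ x i
  vanish x low top i = prime-cancel pr (x i) p∤V (subst (λ d → P ∣ d * x i) (det′-ᵗ V)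
    (▹-∣ (V ᵗ) x (λ j → [ (λ j<k → subst (λ f → P ∣ dot f x) (sym (split-< k u _ j<k)) (low j<k))
      , (λ j≡k → subst (λ f → P ∣ dot f x) (sym (trans (cong (split k u _) j≡k) column-y)) top) ]′
      (ℕ.m≤n⇒m<n∨m≡n (ℕ.≤-pred (Fin.toℕ<n j)))) i))

  independent : ∀ (γ : ℕ → ℤ) → (∀ i → P ∣ comb< k γ u i) → ∀ {j} → j ℕ.< k → P ∣ γ j
  independent γ rel {j} j<k = subst (P ∣_) (trans (cong ĝ (Fin.toℕ-fromℕ< j<n)) (split-< k γ _ j<k))
    (prime-cancel pr _ p∤V (▹-∣ V (ĝ ∘ toℕ) (λ i → subst (P ∣_) (sym (V▹ĝ i)) (rel i)) (Fin.fromℕ< j<n)))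
    where
    ĝ : ℕ → ℤ
    ĝ = split k γ (λ _ → + 0)
    j<n : j ℕ.< n
    j<n = ℕ.m<n⇒m<1+n j<k
    ĝ-k : ĝ k ≡ + 0
    ĝ-k = trans (cong ĝ (sym (ℕ.+-identityʳ k))) (split-≥ k γ _ 0)
    V▹ĝ : ∀ i → (V ▹ (ĝ ∘ toℕ)) i ≡ comb< k γ u i
    V▹ĝ i = trans (V-columns ĝ i) (trans (cong₂ _+_ (∑<-cong k (λ j j<k → cong (_* u j i) (split-< k γ _ j<k)))
      (trans (cong (_* y i) ĝ-k) (zeroˡ (y i)))) (+-identityʳ _))

  coordinates : Vector n → ℕ → ℤ
  coordinates x = extend-by-0 (adjugate' V ▹ x)

  span : ∀ x i → δV * x i ≡ comb< k (coordinates x) u i + coordinates x k * y i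
  span x i = trans (sym (adjugate'-▹ V x i)) (trans (∑-cong (λ j → cong (V i j *_) (sym (extend-toℕ
      (adjugate' V ▹ x) j))))
    (V-columns (coordinates x) i))

  -- The kernel of Wᵗ modulo p is spanned by any z in it that is nonzero modulo p.
  module Kernel (z : Vector n) (z-low : ∀ j → P ∣ dot (u j) z) (z≢0 : ∃ λ i → ¬ P ∣ z i) where

    τ : ℤ
    τ = dot y z

    p∤τ : ¬ P ∣ τ
    p∤τ e = proj₂ z≢0 (vanish z (λ {j} _ → z-low j) e (proj₁ z≢0))

    -- The coefficients τ = y·z and y·x make this combination exactly orthogonal to y. Both vectors
    -- are orthogonal to the walk vectors modulo p, so `vanish` applies.
    proportional : ∀ x → (∀ {j} → j ℕ.< k → P ∣ dot (u j) x) → ∀ i → P ∣ τ * x i - dot y x * z i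
    proportional x low i = subst (P ∣_) (as-difference i) (vanish X (λ {j} j<k → subst (P ∣_) (sym (dot-X (u j)))
        (∣-+ (∣-*ˡ τ (low j<k)) (∣-*ˡ (- dot y x) (z-low j))))
      (subst (P ∣_) (sym (trans (dot-X y) (solve 2 (λ t a → t :* a :+ (:- a) :* t := con (+ 0)) refl τ
          (dot y x)))) ∣-0) i)
      where
      X : Vector n
      X i = τ * x i + (- dot y x) * z i
      as-difference : ∀ i → X i ≡ τ * x i - dot y x * z i
      as-difference i = solve 3 (λ a b c → a :+ (:- b) :* c := a :- b :* c) refl (τ * x i) (dot y x) (z i)
      dot-X : ∀ v → dot v X ≡ τ * dot v x + (- dot y x) * dot v z
      dot-X v = trans (dot-linʳ (- dot y x) v (λ i → τ * x i) z) (cong (_+ (- dot y x) * dot v z) (dot-*ʳ τ v x))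

    decompose : ∀ x → (∀ {j} → j ℕ.< k → P ∣ dot (u j) x) →
      ∃ λ (X : Vector n) → ∀ i → τ * x i ≡ dot y x * z i + P * X i
    decompose x low = (λ i → _∣_.quotient (proportional x low i)) , λ i → trans
      (solve 2 (λ a b → a := b :+ (a :- b)) refl (τ * x i) (dot y x * z i))
      (cong (_+_ (dot y x * z i)) (trans (_∣_.equality (proportional x low i)) (*-comm _ P)))

    -- If x and x' lie in the kernel, then modulo p² the form x·x' only sees z·z, z·X and z·X'.
    pairing : ∀ {x x' : Vector n} {X X' : Vector n} → (∀ i → τ * x i ≡ dot y x * z i + P * X i) →
      (∀ i → τ * x' i ≡ dot y x' * z i + P * X' i) →
      τ * τ * dot x x' ≡ dot y x * dot y x' * dot z z + P *
          (dot y x * dot z X' + dot y x' * dot z X) + P * P * dot X X'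
    pairing {x} {x'} {X} {X'} e e' = begin
      τ * τ * dot x x' ≡⟨ *-assoc τ τ _ ⟩
      τ * (τ * dot x x') ≡⟨ cong (τ *_) (dot-*ʳ τ x x') ⟨
      τ * dot x (λ i → τ * x' i) ≡⟨ dot-*ˡ τ _ x ⟨
      dot (λ i → τ * x i) (λ i → τ * x' i) ≡⟨ dot-cong e e' ⟩
      dot (λ i → a * z i + P * X i) (λ i → a' * z i + P * X' i) ≡⟨ dot-bilinear a P a' P z X z X' ⟩
      a * a' * dot z z + (a * P * dot z X' + P * a' * dot X z) + P * P * dot X X'
        ≡⟨ cong (λ w → a * a' * dot z z + (a * P * dot z X' + P * a' * w) + P * P * dot X X') (dot-comm X z) ⟩
      a * a' * dot z z + (a * P * dot z X' + P * a' * dot z X) + P * P * dot X X'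
        ≡⟨ solve 7 (λ a a' p zz zX' zX XX → a :* a' :* zz :+ (a :* p :* zX' :+ p :* a' :* zX) :+ p :* p :* XX :=
             a :* a' :* zz :+ p :* (a :* zX' :+ a' :* zX) :+ p :* p :* XX) refl a a' P (dot z z) (dot z X')
                 (dot z X) (dot X X') ⟩
      a * a' * dot z z + P * (a * dot z X' + a' * dot z X) + P * P * dot X X' ∎
      where
      open ≡-Reasoning
      a = dot y x
      a' = dot y x'

∣-*-self : ∀ {p} a → p * p ∣ p * p * a
∣-*-self {p} a = ∣-*ʳ a ∣-refl

square-∣ : ∀ {p a} b → p ∣ a → p * p ∣ a * a * b
square-∣ b d = ∣-*ʳ b (∣-* d d)

-- Isotropic lines at an odd prime

module OddPrime {k} {S S' : Mat ℤ (suc k)} (sk : Skew S) {p} (pr : Prime p) (p-odd : ¬ + p ∣ + 2)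
  {h : ℕ → ℤ} (monic : Monic k h) (y : Vector (suc k))
  (y-eq : ∀ i → comb< (suc k) h (walkVec S) i ≡ + p * y i) (p∤V : ¬ + p ∣ det′ (reduced S k y))
  {μ} (p∣μ : + p ∣ μ) (p²∤μ : ¬ + p * + p ∣ μ) (T : Transfer S S' μ) (T₀ : Transfer S (negate S) μ) where

  open Hyperplane {S = S} pr monic y y-eq p∤V
  private
    module T = Transfer T
    module T₀ = Transfer T₀
    n = suc k
    u = walkVec S
    P = + p

    -- The products of the walk vectors with a row of B are entries of μ times the walk vectors of
    -- R, so the row lies in the kernel of Wᵗ modulo p.
    row-low : ∀ {R} (T : Transfer S R μ) i j → P ∣ dot (u j) (Transfer.B T i)
    row-low {R} T i j = subst (P ∣_) (trans (sym (Transfer.B-walk T j i)) (dot-comm (Transfer.B T i) (u j))) (∣-*ʳ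
        (walkVec R j i) p∣μ)

    row-dot : ∀ {R} (T : Transfer S R μ) i j → P * P ∣ dot (Transfer.B T i) (Transfer.B T j)
    row-dot T i j = subst (P * P ∣_) (sym (Transfer.BBᵗ T i j)) (square-∣ (δℤ i j) p∣μ)

  module _ (i₀ j₀ : Fin n) (p∤B : ¬ P ∣ T.B i₀ j₀) where

    private
      z : Vector n
      z = T.B i₀
    open Kernel z (row-low T i₀) (j₀ , p∤B)

    -- Every row of either matrix is, up to the unit τ, a multiple of z plus p times a correction.
    -- Isotropy modulo p² within each family makes the corrections orthogonal to z modulo p, so a
    -- product of rows from different families is 0 modulo p² as well.
    both-nonintegral : (∃ λ i → ∃ λ j → ¬ P ∣ T₀.B i j) → ∀ i j → P * P ∣ dot (T.B i) (T₀.B j)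
    both-nonintegral (i₁ , j₁ , p∤B₀) i j = prime-square-cancel pr _ p∤τ (prime-square-cancel pr _ p∤τ
      (subst (P * P ∣_) (trans (sym (pairing (A-eq i) (C-eq j))) (*-assoc τ τ _))
        (∣-+ (∣-+ (∣-*ˡ _ (row-dot T i₀ i₀)) (∣-* ∣-refl (∣-+ (∣-*ˡ _ (zC j)) (∣-*ˡ _ zA)))) (∣-*-self _))))
      where
      A : ∀ i → ∃ λ (X : Vector n) → ∀ l → τ * T.B i l ≡ dot y (T.B i) * z l + P * X l
      A i = decompose (T.B i) (λ {j} _ → row-low T i j)
      C : ∀ j → ∃ λ (X : Vector n) → ∀ l → τ * T₀.B j l ≡ dot y (T₀.B j) * z l + P * X l
      C i = decompose (T₀.B i) (λ {j} _ → row-low T₀ i j)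
      A-eq : ∀ i l → τ * T.B i l ≡ dot y (T.B i) * z l + P * proj₁ (A i) l
      A-eq i = proj₂ (A i)
      C-eq : ∀ i l → τ * T₀.B i l ≡ dot y (T₀.B i) * z l + P * proj₁ (C i) l
      C-eq i = proj₂ (C i)
      -- Here z is itself a row of `T.B`, so both z·z and its product with row i vanish modulo p².
      zA : P ∣ dot z (proj₁ (A i))
      zA = ∣-cancelˡ (prime-≢0 pr) (subst (P * P ∣_)
        (solve 2 (λ a b → (a :+ b) :- a := b) refl (dot y (T.B i) * dot z z) (P * dot z (proj₁ (A i))))
        (∣-- (subst (P * P ∣_) expand (∣-*ˡ τ (row-dot T i₀ i))) (∣-*ˡ (dot y (T.B i)) (row-dot T i₀ i₀))))
        where
        expand : τ * dot z (T.B i) ≡ dot y (T.B i) * dot z z + P * dot z (proj₁ (A i))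
        expand = trans (sym (dot-*ʳ τ z (T.B i))) (trans (dot-cong {x = z} (λ _ → refl) (A-eq i))
          (trans (dot-linʳ P z _ (proj₁ (A i))) (cong (_+ P * dot z (proj₁ (A i))) (dot-*ʳ _ z z))))
      p∤b₁ : ¬ P ∣ dot y (T₀.B i₁)
      p∤b₁ e = p∤B₀ (prime-cancel pr _ p∤τ (subst (P ∣_) (sym (C-eq i₁ j₁)) (∣-+ (∣-*ʳ _ e) (∣-*ʳ _ ∣-refl))))
      -- For `T₀.B` only products among its own rows are known; row i₁, not divisible by p, serves
      -- as reference.
      mixed : ∀ j → P ∣ dot y (T₀.B i₁) * dot z (proj₁ (C j)) + dot y (T₀.B j) * dot z (proj₁ (C i₁))
      mixed j = ∣-cancelˡ (prime-≢0 pr) (subst (P * P ∣_)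
        (solve 3 (λ a b c → (a :+ b :+ c) :- a :- c := b) refl (dot y (T₀.B i₁) * dot y (T₀.B j) * dot z z) _
            (P * P * dot (proj₁ (C i₁)) (proj₁ (C j))))
        (∣-- (∣-- (subst (P * P ∣_) (pairing (C-eq i₁) (C-eq j)) (∣-*ˡ (τ * τ) (row-dot T₀ i₁ j))) (∣-*ˡ _
            (row-dot T i₀ i₀))) (∣-*-self _)))
      -- The case j = i₁ gives twice the wanted product; this uses that p is odd.
      zC₁ : P ∣ dot z (proj₁ (C i₁))
      zC₁ = prime-cancel pr _ p∤b₁ (prime-cancel pr _ p-odd (subst (P ∣_)
        (solve 1 (λ a → a :+ a := con (+ 2) :* a) refl _) (mixed i₁)))
      zC : ∀ j → P ∣ dot z (proj₁ (C j))
      zC j = prime-cancel pr _ p∤b₁ (subst (P ∣_)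
        (solve 2 (λ a b → (a :+ b) :- b := a) refl _ _) (∣-- (mixed j) (∣-*ˡ (dot y (T₀.B j)) zC₁)))

    -- If Q₀ were p-integral it would act on the line L/M by (-1)ᵏ and on its dual M*/L, spanned by z,
    -- by the same sign; but z lies in M, where this sign forces its top coefficient, hence z itself, to vanish.
    not-integral : ¬ (∀ i j → P ∣ T₀.B i j)
    not-integral P∣B₀ = contradiction k refl
      where
      q : ℤ
      q = _∣_.quotient p∣μ
      μ-eq : μ ≡ P * q
      μ-eq = trans (_∣_.equality p∣μ) (*-comm q P)
      p∤q : ¬ P ∣ q
      p∤q e = p²∤μ (subst (P * P ∣_) (sym μ-eq) (∣-* ∣-refl e))
      B' : Mat ℤ n
      B' i j = _∣_.quotient (P∣B₀ i j)
      B₀-eq : ∀ i j → T₀.B i j ≡ P * B' i j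
      B₀-eq i j = trans (_∣_.equality (P∣B₀ i j)) (*-comm _ P)
      ε : ℤ
      ε = sgn k
      divide : ∀ (R : Mat ℤ n) j i → P * (R ▹ u j) i ≡ μ * (sgn j * u j i) → (R ▹ u j) i ≡ q * (sgn j * u j i)
      divide R j i e = *-cancelˡ (prime-≢0 pr) (trans e (trans (cong (_* (sgn j * u j i)) μ-eq) (*-assoc P q _)))
      B'-walk : ∀ j → B' ▹ u j ≗ (λ i → q * (sgn j * u j i))
      B'-walk j i = divide B' j i (begin
        P * (B' ▹ u j) i ≡⟨ dot-*ˡ P (u j) (B' i) ⟨
        dot (λ l → P * B' i l) (u j) ≡⟨ dot-cong (λ l → sym (B₀-eq i l)) (λ _ → refl) ⟩
        (T₀.B ▹ u j) i ≡⟨ T₀.B-walk j i ⟩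
        μ * walkVec (negate S) j i ≡⟨ cong (μ *_) (walkVec-negate S j i) ⟩
        μ * (sgn j * u j i) ∎)
        where open ≡-Reasoning
      B'ᵗ-walk : ∀ j → B' ᵗ ▹ u j ≗ (λ i → q * (sgn j * u j i))
      B'ᵗ-walk j i = divide (B' ᵗ) j i (begin
        P * (B' ᵗ ▹ u j) i ≡⟨ dot-*ˡ P (u j) (λ l → B' l i) ⟨
        dot (λ l → P * B' l i) (u j) ≡⟨ dot-cong (λ l → sym (B₀-eq l i)) (λ l → signs l) ⟩
        (T₀.B ᵗ ▹ (λ l → sgn j * walkVec (negate S) j l)) i ≡⟨ dot-*ʳ (sgn j) ((T₀.B ᵗ) i) (walkVec (negate S) j) ⟩
        sgn j * (T₀.B ᵗ ▹ walkVec (negate S) j) i ≡⟨ cong (sgn j *_) (T₀.Bᵗ-walk j i) ⟩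
        sgn j * (μ * u j i) ≡⟨ solve 3 (λ s m u → s :* (m :* u) := m :* (s :* u)) refl (sgn j) μ (u j i) ⟩
        μ * (sgn j * u j i) ∎)
        where
        open ≡-Reasoning
        signs : ∀ l → u j l ≡ sgn j * walkVec (negate S) j l
        signs l = sym (trans (cong (sgn j *_) (walkVec-negate S j l)) (trans (sym (*-assoc (sgn j) (sgn j) _))
          (trans (cong (_* u j l) (sgn-square j)) (*-identityˡ _))))

      apply : ∀ (R : Mat ℤ n) → (∀ j → R ▹ u j ≗ (λ i → q * (sgn j * u j i))) → ∀ m c i →
        (R ▹ comb< m c u) i ≡ q * comb< m (λ j → sgn j * c j) u i
      apply R R-walk m c i = trans (dot-comb<ʳ m (R i) c u) (trans (∑<-cong m (λ j _ → trans (cong (c j *_)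
          (R-walk j i))
        (solve 4 (λ c q s u → c :* (q :* (s :* u)) := q :* (s :* c :* u)) refl (c j) q (sgn j) (u j i))))
            (∑-*ˡ {m} q _))

      linear-comb : ∀ m a (c d : ℕ → ℤ) i → comb< m (λ j → c j + a * d j) u i ≡ comb< m c u i + a * comb< m d u i
      linear-comb m a c d i = trans (∑<-cong m (λ j _ → solve 4 (λ c a d u → (c :+ a :* d) :* u := c :* u :+ a :*
          (d :* u)) refl (c j) a (d j) (u j i)))
        (trans (∑-+ {m} _ _) (cong (_+_ (comb< m c u i)) (∑-*ˡ {m} a _)))

      -- h⁻ is h(-x), and f = h(-x) - (-1)ᵏh(x) has degree below k. It also annihilates e modulo p,
      -- so its coefficients vanish modulo p: h has the parity of its degree.
      h⁻ f : ℕ → ℤ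
      h⁻ j = sgn j * h j
      f j = h⁻ j + (- ε) * h j
      f-k : f k ≡ + 0
      f-k = solve 2 (λ s h → s :* h :+ (:- s) :* h := con (+ 0)) refl ε (h k)
      B'y : ∀ i → P * (B' ▹ y) i ≡ q * comb< n h⁻ u i
      B'y i = trans (sym (dot-*ʳ P (B' i) y)) (trans (▹-congʳ B' (λ l → sym (y-eq l)) i) (apply B' B'-walk n h i))
      f-comb : ∀ i → comb< k f u i ≡ comb< n h⁻ u i + (- ε) * comb< n h u i
      f-comb i = trans (sym (trans (∑<-snoc k (λ j → f j * u j i)) (trans (cong (_+_ (comb< k f u i)) (trans (cong
          (_* u k i) f-k) (zeroˡ _))) (+-identityʳ _))))
        (linear-comb n (- ε) h⁻ h i)
      f-∣ : ∀ {j} → j ℕ.< k → P ∣ f j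
      f-∣ = independent f (λ i → subst (P ∣_) (sym (f-comb i)) (∣-+
        (prime-cancel pr _ p∤q (subst (P ∣_) (B'y i) (∣-*ʳ _ ∣-refl)))
        (∣-*ˡ (- ε) (subst (P ∣_) (sym (y-eq i)) (∣-*ʳ _ ∣-refl)))))

      -- After multiplication by p this is a sum of products f j · (z·Sʲe), where both factors are
      -- divisible by p; one factor p is cancelled.
      z·B'y : P ∣ dot z (B' ▹ y) - q * ε * τ
      z·B'y = ∣-cancelˡ (prime-≢0 pr) (subst (P * P ∣_) (sym (begin
        P * (dot z (B' ▹ y) - q * ε * τ)
          ≡⟨ solve 5 (λ p b q e t → p :* (b :- q :* e :* t) := p :* b :- q :* e :* (p :* t)) refl P _ q ε τ ⟩
        P * dot z (B' ▹ y) - q * ε * (P * τ)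
          ≡⟨ cong₂ (λ s t → s - q * ε * t) (trans (sym (dot-*ʳ P z (B' ▹ y))) (trans (dot-cong {x = z} (λ _ →
              refl) B'y) (dot-*ʳ q z (comb< n h⁻ u))))
               (trans (cong (P *_) (dot-comm y z)) (trans (sym (dot-*ʳ P z y)) (dot-cong {x = z} (λ _ → refl) (λ i →
                   sym (y-eq i))))) ⟩
        q * dot z (comb< n h⁻ u) - q * ε * dot z (comb< n h u)
          ≡⟨ solve 4 (λ q a e b → q :* a :- q :* e :* b := q :* (a :+ (:- e) :* b)) refl q _ ε _ ⟩
        q * (dot z (comb< n h⁻ u) + (- ε) * dot z (comb< n h u)) ≡⟨ cong (q *_) (dot-linʳ (- ε) z (comb< n h⁻ u)
            (comb< n h u)) ⟨
        q * dot z (λ i → comb< n h⁻ u i + (- ε) * comb< n h u i) ≡⟨ cong (q *_) (dot-cong {x = z} (λ _ →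
            refl) f-comb) ⟨
        q * dot z (comb< k f u) ≡⟨ cong (q *_) (dot-comb<ʳ k z f u) ⟩
        q * ∑< k (λ j → f j * dot z (u j)) ∎))
        (∣-*ˡ q (∑<-∣ k (λ j j<k → ∣-* (f-∣ j<k) (subst (P ∣_) (dot-comm (u j) z) (row-low T i₀ j))))))
        where open ≡-Reasoning

      -- Orthogonality to the walk vectors is inherited from z, and orthogonality to y is `z·B'y`.
      B'ᵗz : ∀ i → P ∣ (B' ᵗ ▹ z) i + (- (q * ε)) * z i
      B'ᵗz = vanish (λ i → (B' ᵗ ▹ z) i + (- (q * ε)) * z i)
        (λ {j} _ → subst (P ∣_) (sym (trans (dot-linʳ (- (q * ε)) (u j) (B' ᵗ ▹ z) z) (cong (_+ (- (q * ε)) * dot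
            (u j) z)
            (trans (sym (dot-▹ B' (u j) z)) (trans (dot-cong (λ l → trans (B'-walk j l) (sym (*-assoc q (sgn j) _)))
                (λ _ → refl)) (dot-*ˡ (q * sgn j) z (u j)))))))
          (∣-+ (∣-*ˡ (q * sgn j) (row-low T i₀ j)) (∣-*ˡ (- (q * ε)) (row-low T i₀ j))))
        (subst (P ∣_) (sym (trans (dot-linʳ (- (q * ε)) y (B' ᵗ ▹ z) z) (trans (cong (_+ (- (q * ε)) * τ) (trans
            (sym (dot-▹ B' y z)) (dot-comm (B' ▹ y) z)))
          (solve 3 (λ a b c → a :+ (:- b) :* c := a :- b :* c) refl _ (q * ε) τ)))) z·B'y)

      γ : ℕ → ℤ
      γ = coordinates z
      -- Take the product of z with its own expansion: z·z and all z·Sʲe vanish modulo p, while τ is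
      -- a unit.
      γ-top : P ∣ γ k
      γ-top = prime-cancel pr _ p∤τ (subst (P ∣_) (trans (cong (_- ∑< k (λ j → γ j * dot z (u j))) (begin
          δV * dot z z ≡⟨ dot-*ʳ δV z z ⟨
          dot z (λ i → δV * z i) ≡⟨ dot-cong {x = z} (λ _ → refl) (span z) ⟩
          dot z (λ i → comb< k γ u i + γ k * y i) ≡⟨ dot-linʳ (γ k) z (comb< k γ u) y ⟩
          dot z (comb< k γ u) + γ k * dot z y ≡⟨ cong₂ (λ s t → s + γ k * t) (dot-comb<ʳ k z γ u) (dot-comm z y) ⟩
          ∑< k (λ j → γ j * dot z (u j)) + γ k * τ ∎))
          (solve 3 (λ s g t → (s :+ g :* t) :- s := t :* g) refl (∑< k (λ j → γ j * dot z (u j))) (γ k) τ))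
        (∣-- (∣-*ˡ δV (∣-trans (∣-*ˡ P ∣-refl) (row-dot T i₀ i₀)))
          (∑<-∣ k (λ j _ → ∣-*ˡ (γ j) (subst (P ∣_) (dot-comm (u j) z) (row-low T i₀ j))))))
        where open ≡-Reasoning
      δz : ∀ i → P ∣ δV * z i + -[1+ 0 ] * comb< k γ u i
      δz i = subst (P ∣_) (sym (trans (cong (_+ -[1+ 0 ] * comb< k γ u i) (span z i))
        (solve 2 (λ a b → (a :+ b) :+ con -[1+ 0 ] :* a := b) refl (comb< k γ u i) (γ k * y i)))) (∣-*ʳ (y i) γ-top)

      -- On Sʲe the matrix B'ᵗ acts by q(-1)ʲ and on z by q(-1)ᵏ; compare coefficients.
      parity : ∀ {j} → j ℕ.< k → P ∣ γ j * (sgn j - ε)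
      parity {j} j<k = prime-cancel pr _ p∤q (subst (P ∣_) (solve 4 (λ q s g e → q :* (s :* g) :+ (:-
          (q :* e)) :* g := q :* (g :* (s :- e))) refl q (sgn j) (γ j) ε)
        (independent (λ j → q * (sgn j * γ j) + (- (q * ε)) * γ j) combination j<k))
        where
        combination : ∀ i → P ∣ comb< k (λ j → q * (sgn j * γ j) + (- (q * ε)) * γ j) u i
        combination i = subst (P ∣_) (sym (begin
          comb< k (λ j → q * (sgn j * γ j) + (- (q * ε)) * γ j) u i ≡⟨ linear-comb k (- (q * ε)) (λ j → q *
              (sgn j * γ j)) γ i ⟩
          comb< k (λ j → q * (sgn j * γ j)) u i + (- (q * ε)) * comb< k γ u i
            ≡⟨ cong (_+ (- (q * ε)) * comb< k γ u i) (trans (∑<-cong k (λ j _ → *-assoc q (sgn j * γ j) (u j i)))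
                (trans (∑-*ˡ {k} q _) (sym (apply (B' ᵗ) B'ᵗ-walk k γ i)))) ⟩
          (B' ᵗ ▹ comb< k γ u) i + (- (q * ε)) * comb< k γ u i
            ≡⟨ solve 4 (λ b d z c → b :+ c :* d := (z :+ con -[1+ 0 ] :* (z :+ con -[1+ 0 ] :* b)) :+ c :* d) refl _
                (comb< k γ u i) (δV * (B' ᵗ ▹ z) i) (- (q * ε)) ⟩
          δV * (B' ᵗ ▹ z) i + -[1+ 0 ] * (δV * (B' ᵗ ▹ z) i + -[1+ 0 ] * (B' ᵗ ▹ comb< k γ u) i) + (-
              (q * ε)) * comb< k γ u i
            ≡⟨ cong (λ w → δV * (B' ᵗ ▹ z) i + -[1+ 0 ] * w + (- (q * ε)) * comb< k γ u i)
                 (trans (cong (_+ -[1+ 0 ] * (B' ᵗ ▹ comb< k γ u) i) (sym (dot-*ʳ δV ((B' ᵗ) i) z))) (sym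
                     (dot-linʳ -[1+ 0 ] ((B' ᵗ) i) (λ l → δV * z l) (comb< k γ u)))) ⟩
          δV * (B' ᵗ ▹ z) i + -[1+ 0 ] * (B' ᵗ ▹ (λ l → δV * z l + -[1+ 0 ] * comb< k γ u l)) i + (-
              (q * ε)) * comb< k γ u i
            ≡⟨ solve 6 (λ d b w c z g → d :* b :+ w :+ c :* g := d :* (b :+ c :* z) :+ w :+ (:- c) :*
                (d :* z :+ con -[1+ 0 ] :* g)) refl
                 δV ((B' ᵗ ▹ z) i) _ (- (q * ε)) (z i) (comb< k γ u i) ⟩
          δV * ((B' ᵗ ▹ z) i + (- (q * ε)) * z i) + -[1+ 0 ] * (B' ᵗ ▹ (λ l → δV * z l + -[1+ 0 ] * comb< k γ u l)) i
            + (- (- (q * ε))) * (δV * z i + -[1+ 0 ] * comb< k γ u i) ∎))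
          (∣-+ (∣-+ (∣-*ˡ δV (B'ᵗz i)) (∣-*ˡ -[1+ 0 ] (∑-∣ (λ l → ∣-*ˡ ((B' ᵗ) i l) (δz l))))) (∣-*ˡ (- (- (q * ε)))
              (δz i)))
          where open ≡-Reasoning

      conclude : (∀ {j} → j ℕ.< k → P ∣ γ j) → ⊥
      conclude all = p∤B (prime-cancel pr _ p∤V (subst (P ∣_)
        (solve 2 (λ a b → (a :+ con -[1+ 0 ] :* b) :+ b := a) refl (δV * z j₀) (comb< k γ u j₀))
        (∣-+ (δz j₀) (∑<-∣ k (λ j j<k → ∣-*ʳ (u j j₀) (all j<k))))))

      contradiction : ∀ l → l ≡ k → ⊥
      -- For k = 0 no coordinate lies below the top one.
      contradiction zero    refl = conclude (λ ())
      contradiction (suc l) refl = conclude (λ {j} j<k → descend (l ℕ.∸ j) j (ℕ.m+[n∸m]≡n (ℕ.≤-pred j<k)))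
        where
        σ : ℤ
        σ = dot y (S ▹ z)
        -- The index l = k - 1 has the sign opposite to that of k. This coefficient suffices to
        -- start the descent through the others.
        γ-last : P ∣ γ l
        γ-last = sgn-∣ l (prime-cancel pr _ p-odd (subst (P ∣_) (trans (cong (λ e → γ l * (sgn l - e)) (sgn-suc l))
          (solve 2 (λ g s → g :* (s :- (:- s)) := con (+ 2) :* (s :* g)) refl (γ l) (sgn l))) (parity (ℕ.n<1+n l))))
        -- S maps the kernel of Wᵗ modulo p into itself, and the kernel is a line, so z is an
        -- eigenvector.
        eigen : ∀ i → P ∣ τ * (S ▹ z) i - σ * z i
        eigen = proportional (S ▹ z) (λ {j} _ → subst (P ∣_) (sym (trans (dot-comm (u j) (S ▹ z)) (trans
            (skew-▹ sk z (u j))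
          (cong -_ (trans (dot-comm z (S ▹ u j)) (dot-cong (λ i → sym (walkVec-suc S j i)) (λ _ → refl))))))) (∣-neg
              (row-low T i₀ (suc j))))
        Sγ : ∀ i → P ∣ (S ▹ comb< (suc l) γ u) i + -[1+ 0 ] * comb< (suc l) (shift γ) u i
        Sγ i = subst (P ∣_) (sym (trans (cong₂ (λ s t → s + -[1+ 0 ] * t) (trans (dot-comb<ʳ (suc l) (S i) γ u) (trans
            (∑<-cong (suc l) (λ j _ → cong (γ j *_) (sym (walkVec-suc S j i)))) (∑<-snoc l (λ j → γ j * u
                (suc j) i))))
            (trans (∑-suc _) (trans (cong (_+ ∑< l (λ j → γ j * u (suc j) i)) (zeroˡ (u 0 i))) (+-identityˡ _))))
          (solve 2 (λ a b → (a :+ b) :+ con -[1+ 0 ] :* a := b) refl (∑< l (λ j → γ j * u (suc j) i)) (γ l * u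
              (suc l) i)))) (∣-*ʳ (u (suc l) i) γ-last)
        -- Coefficients of the eigenvector equation. Since `γ l` vanishes modulo p, applying S does
        -- not leave the span of e, ..., Sᵏ⁻¹e. The equation at j + 1 reads τ γⱼ ≡ σ γⱼ₊₁.
        shifted-relation : ∀ {j} → j ℕ.< suc l → P ∣ τ * shift γ j + (- σ) * γ j
        shifted-relation = independent (λ j → τ * shift γ j + (- σ) * γ j) (λ i → subst (P ∣_) (sym (begin
          comb< (suc l) (λ j → τ * shift γ j + (- σ) * γ j) u i ≡⟨ linear-comb (suc l) (- σ) (λ j →
              τ * shift γ j) γ i ⟩
          comb< (suc l) (λ j → τ * shift γ j) u i + (- σ) * g i
            ≡⟨ cong (_+ (- σ) * g i) (trans (∑<-cong (suc l) (λ j _ → *-assoc τ (shift γ j) (u j i)))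
                (∑-*ˡ {suc l} τ _)) ⟩
          τ * comb< (suc l) (shift γ) u i + (- σ) * g i
            ≡⟨ solve 7 (λ t w s g d z b → t :* w :+ (:- s) :* g :=
                 (:- t) :* (b :+ con -[1+ 0 ] :* w) :+ (d :* (t :* z) :+ (:- t) :* (d :* z :+ con -[1+ 0 ] :* b) :+
                     (:- s) :* g))
                 refl τ (comb< (suc l) (shift γ) u i) σ (g i) δV ((S ▹ z) i) ((S ▹ g) i) ⟩
          (- τ) * ((S ▹ g) i + -[1+ 0 ] * comb< (suc l) (shift γ) u i) +
            (δV * (τ * (S ▹ z) i) + (- τ) * (δV * (S ▹ z) i + -[1+ 0 ] * (S ▹ g) i) + (- σ) * g i)
            ≡⟨ cong₂ _+_ refl (trans (cong (λ w → δV * (τ * (S ▹ z) i) + (- τ) * w + (- σ) * g i)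
                 (trans (cong (_+ -[1+ 0 ] * (S ▹ g) i) (sym (dot-*ʳ δV (S i) z))) (sym (dot-linʳ -[1+ 0 ] (S i)
                     (λ l → δV * z l) g))))
                 (solve 7 (λ t s g d z Sz w → d :* (t :* Sz) :+ (:- t) :* w :+ (:- s) :* g :=
                    d :* (t :* Sz :- s :* z) :+ (:- t) :* w :+ s :* (d :* z :+ con -[1+ 0 ] :* g)) refl τ σ (g i) δV
                        (z i) ((S ▹ z) i)
                    ((S ▹ (λ l → δV * z l + -[1+ 0 ] * g l)) i))) ⟩
          (- τ) * ((S ▹ g) i + -[1+ 0 ] * comb< (suc l) (shift γ) u i) +
            (δV * (τ * (S ▹ z) i - σ * z i) + (- τ) * (S ▹ (λ l → δV * z l + -[1+ 0 ] * g l)) i + σ *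
                (δV * z i + -[1+ 0 ] * g i)) ∎))
          (∣-+ (∣-*ˡ (- τ) (Sγ i)) (∣-+ (∣-+ (∣-*ˡ δV (eigen i)) (∣-*ˡ (- τ) (∑-∣ (λ l → ∣-*ˡ (S i l) (δz l)))))
              (∣-*ˡ σ (δz i)))))
          where
          open ≡-Reasoning
          g : Vector n
          g = comb< (suc l) γ u
        descend : ∀ d j → j ℕ.+ d ≡ l → P ∣ γ j
        descend zero    j e = subst (λ z → P ∣ γ z) (sym (trans (sym (ℕ.+-identityʳ j)) e)) γ-last
        descend (suc d) j e = prime-cancel pr _ p∤τ (subst (P ∣_)
          (solve 3 (λ a s b → (a :+ (:- s) :* b) :+ s :* b := a) refl (τ * γ j) σ (γ (suc j)))
          (∣-+ (shifted-relation (ℕ.s≤s (ℕ.≤-trans (ℕ.m≤m+n (suc j) d) (ℕ.≤-reflexive j+d)))) (∣-*ˡ σ (descend d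
              (suc j) j+d))))
          where
          j+d : suc j ℕ.+ d ≡ l
          j+d = trans (sym (ℕ.+-suc j d)) e

  all-or-witness : (M : Mat ℤ n) → (∀ i j → P ∣ M i j) ⊎ (∃ λ i → ∃ λ j → ¬ P ∣ M i j)
  all-or-witness M with Fin.any? (λ i → Fin.any? (λ j → ¬? (P ∣? M i j)))
  ... | yes found = inj₂ found
  ... | no none = inj₁ (λ i j → decidable-stable (P ∣? M i j) (λ ¬d → none (i , j , ¬d)))

  -- As p divides μ exactly once, the alternatives say that Q, respectively QᵀQ₀, is p-integral.
  dichotomy : (∀ i j → P ∣ T.B i j) ⊎ (∀ i j → P * P ∣ dot (T.B i) (T₀.B j))
  dichotomy = [ inj₁ , (λ { (i , j , p∤B) → inj₂ ([ (λ integral → ⊥-elim (not-integral i j p∤B integral))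
    , both-nonintegral i j p∤B ]′ (all-or-witness T₀.B)) }) ]′ (all-or-witness T.B)

-- Least multipliers that clear the denominators of X/ν

Clears : ∀ {n} → ℤ → Mat ℤ n → ℕ → Set
Clears ν X c = ∀ i j → ν ∣ + c * X i j

clears? : ∀ {n} ν (X : Mat ℤ n) c → Dec (Clears ν X c)
clears? ν X c = Fin.all? (λ i → Fin.all? (λ j → ν ∣? + c * X i j))

least : ∀ {P : ℕ → Set} → (∀ k → Dec (P k)) → ∀ N → P N → ∃ λ ℓ → P ℓ × (∀ {j} → j ℕ.< ℓ → ¬ P j)
least {P} P? N PN = scan 0 N (λ ()) refl
  where
  scan : ∀ k d → (∀ {j} → j ℕ.< k → ¬ P j) → k ℕ.+ d ≡ N → ∃ λ ℓ → P ℓ × (∀ {j} → j ℕ.< ℓ → ¬ P j)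
  scan k zero    none e = k , subst P (sym (trans (sym (ℕ.+-identityʳ k)) e)) PN , none
  scan k (suc d) none e with P? k
  ... | yes Pk = k , Pk , none
  ... | no ¬Pk = scan (suc k) d (λ {j} j<sk Pj → [ (λ j<k → none j<k Pj) , (λ { refl → ¬Pk Pj }) ]′ (ℕ.m≤n⇒m<n∨m≡n
      (ℕ.≤-pred j<sk)))
    (trans (sym (ℕ.+-suc k d)) e)

-- `HasLevel` asks for minimality; divisibility of all clearing multipliers is the form that permits
-- arguments prime by prime.
record Level {n} (ν : ℤ) (X : Mat ℤ n) : Set where
  field
    level : ℕ
    level>0 : 0 ℕ.< level
    clears : Clears ν X level
    divides-clearing : ∀ c → Clears ν X c → level ℕ.∣ c
open Level

-- The remainder of any clearing multiplier modulo the least positive one is again clearing, hence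
-- 0.
level-exists : ∀ {n} ν (X : Mat ℤ (suc n)) N → 0 ℕ.< N → Clears ν X N → Level ν X
level-exists ν X N 0<N clN = build (least (λ k → (0 ℕ.<? k) ×-dec clears? ν X k) N (0<N , clN))
  where
  build : (∃ λ ℓ → (0 ℕ.< ℓ × Clears ν X ℓ) × (∀ {j} → j ℕ.< ℓ → ¬ (0 ℕ.< j × Clears ν X j))) → Level ν X
  build (ℓ@(suc _) ,
      (0<ℓ , cl) , minimal) = record { level = ℓ ; level>0 = 0<ℓ ; clears = cl ; divides-clearing = divisor }
    where
    divisor : ∀ c → Clears ν X c → ℓ ℕ.∣ c
    divisor c clc with c ℕ.% ℓ ℕ.≟ 0
    ... | yes r≡0 = ℕ.m%n≡0⇒n∣m c ℓ r≡0
    ... | no r≢0 = ⊥-elim (minimal (ℕ.m%n<n c ℓ) (ℕ.n≢0⇒n>0 r≢0 , remainder))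
      where
      remainder : Clears ν X (c ℕ.% ℓ)
      remainder i j = subst (ν ∣_) (trans (cong (λ z → z * X i j - + (c ℕ./ ℓ) * (+ ℓ * X i j)) split-c)
        (solve 4 (λ r q l x → (r :+ q :* l) :* x :- q :* (l :* x) := r :* x) refl (+ (c ℕ.% ℓ)) (+ (c ℕ./ ℓ)) (+ ℓ)
            (X i j)))
        (∣-- (clc i j) (∣-*ˡ (+ (c ℕ./ ℓ)) (cl i j)))
        where
        split-c : + c ≡ + (c ℕ.% ℓ) + + (c ℕ./ ℓ) * + ℓ
        split-c = trans (cong +_ (ℕ.m≡m%n+[m/n]*n c ℓ)) (trans (++-+ (c ℕ.% ℓ) _) (cong (_+_ (+ (c ℕ.% ℓ))) (+-*
            (c ℕ./ ℓ) ℓ)))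

no-common-prime⇒coprime : ∀ {a b} → 0 ℕ.< a → (∀ {p} → Prime p → p ℕ.∣ a → p ℕ.∣ b → ⊥) → Coprime a b
no-common-prime⇒coprime {a} 0<a none {zero} (d∣a , d∣b) = ⊥-elim (ℕ.<⇒≢ 0<a (sym (ℕ.0∣⇒≡0 d∣a)))
no-common-prime⇒coprime {a} 0<a none {d@(suc _)} (d∣a , d∣b) = from-factors (factorise d)
  where
  from-factors : PrimeFactorisation d → d ≡ 1
  from-factors record { factors = [] ; isFactorisation = e } = e
  from-factors record { factors = p ∷ ps ; isFactorisation = e ; factorsPrime = pr ∷ _ } =
    ⊥-elim (none pr (ℕ.∣-trans p∣d d∣a) (ℕ.∣-trans p∣d d∣b))
    where
    p∣d : p ℕ.∣ d
    p∣d = subst (p ℕ.∣_) (sym e) (ℕ.m∣m*n _)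

-- Integer matrices that are c times a regular orthogonal matrix

record ScaledOrthogonal {n} (X : Mat ℤ n) (c : ℤ) : Set where
  field
    row-gram    : ∀ i j → (X ⊡ X ᵗ) i j ≡ c * c * δℤ i j
    column-gram : ∀ i j → (X ᵗ ⊡ X) i j ≡ c * c * δℤ i j
    row-sum : ∀ i → (X ▹ 1ᵛ) i ≡ c
    column-sum : ∀ i → (X ᵗ ▹ 1ᵛ) i ≡ c
open ScaledOrthogonal

ᵗ-scaledOrthogonal : ∀ {n} {X : Mat ℤ n} {c} → ScaledOrthogonal X c → ScaledOrthogonal (X ᵗ) c
ᵗ-scaledOrthogonal O = record { row-gram = column-gram O ; column-gram = row-gram O ; row-sum = column-sum O ; column-sum = row-sum O }

⊡-scaledOrthogonal : ∀ {n} {X Y : Mat ℤ n} {c d} → ScaledOrthogonal X c → ScaledOrthogonal Y d → ScaledOrthogonal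
    (X ⊡ Y) (c * d)
⊡-scaledOrthogonal {n} {X} {Y} {c} {d} O O' = record
  { row-gram = λ i j → product X Y c d (row-gram O) (row-gram O') i j
  ; column-gram = λ i j → trans (⊡-cong {A = (X ⊡ Y) ᵗ} {B = X ⊡ Y} (λ i j → ⊡-ᵗ X Y j i) (λ i j → ⊡-ᵗ X Y i j) i j)
      (trans (product (Y ᵗ) (X ᵗ) d c (column-gram O') (column-gram O) i j)
      (cong (_* δℤ i j) (solve 2 (λ c d → d :* c :* (d :* c) := c :* d :* (c :* d)) refl c d)))
  ; row-sum = λ i → trans (▹-▹ X Y 1ᵛ i) (trans (▹-congʳ X (λ k → trans (row-sum O' k) (sym (*-identityʳ d))) i)
      (trans (dot-*ʳ d (X i) 1ᵛ) (trans (cong (d *_) (row-sum O i)) (*-comm d c))))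
  ; column-sum = λ i → trans (▹-congˡ 1ᵛ (λ i j → ⊡-ᵗ X Y j i) i) (trans (▹-▹ (Y ᵗ) (X ᵗ) 1ᵛ i)
      (trans (▹-congʳ (Y ᵗ) (λ k → trans (column-sum O k) (sym (*-identityʳ c))) i)
      (trans (dot-*ʳ c ((Y ᵗ) i) 1ᵛ) (cong (c *_) (column-sum O' i)))))
  }
  where
  product : ∀ (X Y : Mat ℤ n) c d → (∀ i j → (X ⊡ X ᵗ) i j ≡ c * c * δℤ i j) → (∀ i j →
      (Y ⊡ Y ᵗ) i j ≡ d * d * δℤ i j) →
    ∀ i j → ((X ⊡ Y) ⊡ (X ⊡ Y) ᵗ) i j ≡ c * d * (c * d) * δℤ i j
  product X Y c d XXᵗ YYᵗ i j = begin
    ((X ⊡ Y) ⊡ (X ⊡ Y) ᵗ) i j ≡⟨ ⊡-cong {A = X ⊡ Y} (λ _ _ → refl) (λ i j → ⊡-ᵗ X Y j i) i j ⟩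
    ((X ⊡ Y) ⊡ (Y ᵗ ⊡ X ᵗ)) i j ≡⟨ ⊡-assoc X Y (Y ᵗ ⊡ X ᵗ) i j ⟩
    (X ⊡ (Y ⊡ (Y ᵗ ⊡ X ᵗ))) i j ≡⟨ ⊡-cong {A = X} (λ _ _ → refl) (λ i j → trans (sym (⊡-assoc Y (Y ᵗ) (X ᵗ) i j))
                                            (trans (⊡-cong {B = X ᵗ} YYᵗ (λ _ _ → refl) i j) (scalar-⊡ (d * d)
                                                (X ᵗ) i j))) i j ⟩
    (X ⊡ (λ i j → d * d * (X ᵗ) i j)) i j ≡⟨ dot-*ʳ (d * d) (X i) (X j) ⟩
    d * d * (X ⊡ X ᵗ) i j ≡⟨ cong (d * d *_) (XXᵗ i j) ⟩
    d * d * (c * c * δℤ i j) ≡⟨ solve 3 (λ c d e → d :* d :* (c :* c :* e) := c :* d :* (c :* d) :* e) refl c d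
        (δℤ i j) ⟩
    c * d * (c * d) * δℤ i j ∎
    where open ≡-Reasoning

-- Integral regular orthogonal matrices are permutation matrices

square-sum : ∀ {n} → Vector n → ℕ
square-sum {zero}  x = 0
square-sum {suc n} x = ∣ x zero ∣ ℕ.* ∣ x zero ∣ ℕ.+ square-sum (x ∘ suc)

dot-self : ∀ {n} (x : Vector n) → dot x x ≡ + square-sum x
dot-self {zero}  x = ∑-empty _
dot-self {suc n} x = trans (∑-suc _) (trans (cong₂ _+_ (square (x zero)) (dot-self (x ∘ suc))) (sym (++-+ _ _)))
  where
  square : ∀ a → a * a ≡ + (∣ a ∣ ℕ.* ∣ a ∣)
  square (+ n)    = sym (+-* n n)
  square -[1+ n ] = *-def _ _

square-sum-0 : ∀ {n} (x : Vector n) → square-sum x ≡ 0 → ∀ i → x i ≡ + 0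
square-sum-0 {suc n} x e zero = ℤ.∣i∣≡0⇒i≡0 ([ (λ p → p) , (λ p → p) ]′ (ℕ.m*n≡0⇒m≡0∨n≡0 ∣ x zero ∣
    (ℕ.m+n≡0⇒m≡0 _ e)))
square-sum-0 {suc n} x e (suc i) = square-sum-0 (x ∘ suc) (ℕ.m+n≡0⇒n≡0 (∣ x zero ∣ ℕ.* ∣ x zero ∣) e) i

square-sum-1 : ∀ {n} (x : Vector n) → square-sum x ≡ 1 → ∃ λ j → ∀ i → i ≢ j → x i ≡ + 0
square-sum-1 {suc n} x e with ∣ x zero ∣ in eq
... | zero = let j , h = square-sum-1 (x ∘ suc) e in suc j , λ { zero _ → ℤ.∣i∣≡0⇒i≡0 eq ; (suc i) i≢j → h i (i≢j ∘ cong suc) }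
... | suc zero = zero , λ { zero i≢j → ⊥-elim (i≢j refl) ; (suc i) _ → square-sum-0 (x ∘ suc) (ℕ.suc-injective e) i }
... | suc (suc a) with () ← e

-- Norm 1 leaves a single nonzero entry of absolute value 1, and the sum of the entries decides its
-- sign.
unit-vector : ∀ {n} (x : Vector n) → dot x x ≡ + 1 → dot x 1ᵛ ≡ + 1 → ∃ λ j → ∀ i → x i ≡ δℤ j i
unit-vector x xx x1 with square-sum-1 x (ℤ.+-injective (trans (sym (dot-self x)) xx))
... | j , h = j , entry
  where
  at-j : x j ≡ + 1
  at-j = trans (sym (∑-δʳ j x)) (trans (∑-cong (λ i → value i (i Fin.≟ j))) x1)
    where
    value : ∀ i → Dec (i ≡ j) → x i * δℤ i j ≡ x i * 1ᵛ i
    value i (yes refl) = cong (x i *_) (δ-refl i)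
    value i (no i≢j)   = trans (cong (_* δℤ i j) (h i i≢j)) (trans (zeroˡ _) (sym (trans (cong (_* + 1) (h i i≢j))
        (zeroˡ (+ 1)))))
  entry : ∀ i → x i ≡ δℤ j i
  entry i with i Fin.≟ j
  ... | yes refl = trans at-j (sym (δ-refl i))
  ... | no i≢j   = trans (h i i≢j) (sym (δ-≢ (i≢j ∘ sym)))

-- The rows and the columns of R are unit vectors; the positions of their entries 1 give two maps,
-- inverse to each other because they describe the same entries.
permutation : ∀ {n} {S S' R : Mat ℤ n} → ScaledOrthogonal R (+ 1) → (∀ i j → (R ⊡ S) i j ≡ (S' ⊡ R) i j) →
  Σ (Fin n ↔ Fin n) λ σ → ∀ i j → S (Inverse.to σ i) (Inverse.to σ j) ≡ S' i j
permutation {n} {S} {S'} {R} O RS = mk↔ₛ′ ρ τ ρτ τρ , λ i j → begin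
    S (ρ i) (ρ j) ≡⟨ ∑-δˡ (ρ i) (λ k → S k (ρ j)) ⟨
    ∑ (λ k → δℤ (ρ i) k * S k (ρ j)) ≡⟨ ∑-cong (λ k → cong (_* S k (ρ j)) (proj₂ (row i) k)) ⟨
    (R ⊡ S) i (ρ j) ≡⟨ RS i (ρ j) ⟩
    (S' ⊡ R) i (ρ j) ≡⟨ ∑-cong (λ k → trans (cong (S' i k *_) (trans (proj₂ (column (ρ j)) k) (δ-sym _ k))) refl) ⟩
    ∑ (λ k → S' i k * δℤ k (τ (ρ j))) ≡⟨ ∑-δʳ (τ (ρ j)) (S' i) ⟩
    S' i (τ (ρ j)) ≡⟨ cong (S' i) (τρ j) ⟩
    S' i j ∎
  where
  open ≡-Reasoning
  one : ∀ (i : Fin n) → + 1 * + 1 * δℤ i i ≡ + 1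
  one i = trans (cong (+ 1 * + 1 *_) (δ-refl i)) (solve 0 (con (+ 1) :* con (+ 1) :* con (+ 1) := con (+ 1)) refl)
  row : ∀ i → ∃ λ j → ∀ k → R i k ≡ δℤ j k
  row i = unit-vector (R i) (trans (row-gram O i i) (one i)) (row-sum O i)
  column : ∀ j → ∃ λ i → ∀ k → R k j ≡ δℤ i k
  column j = unit-vector (λ k → R k j) (trans (column-gram O j j) (one j)) (column-sum O j)
  ρ τ : Fin n → Fin n
  ρ i = proj₁ (row i)
  τ j = proj₁ (column j)
  δ-one : ∀ (i j : Fin n) → δℤ i j ≡ + 1 → i ≡ j
  δ-one i j e with i Fin.≟ j
  ... | yes p = p
  ... | no i≢j with () ← e
  τρ : ∀ i → τ (ρ i) ≡ i
  τρ i = δ-one _ _ (trans (sym (proj₂ (column (ρ i)) i)) (trans (proj₂ (row i) (ρ i)) (δ-refl (ρ i))))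
  ρτ : ∀ j → ρ (τ j) ≡ j
  ρτ j = δ-one _ _ (trans (sym (proj₂ (row (τ j)) j)) (trans (proj₂ (column j) (τ j)) (δ-refl (τ j))))

divide-scaledOrthogonal : ∀ {n} {X : Mat ℤ n} {c} → c ≢ + 0 → ScaledOrthogonal X c → (R : Mat ℤ n) → (∀ i j →
    X i j ≡ c * R i j) → ScaledOrthogonal R (+ 1)
divide-scaledOrthogonal {n} {X} {c} c≢0 O R e = record
  { row-gram = λ i j → gram (row-gram O) R (λ i j → e i j) i j
  ; column-gram = λ i j → gram (column-gram O) (R ᵗ) (λ i j → e j i) i j
  ; row-sum = λ i → sums (R i) (X i) (e i) (row-sum O i)
  ; column-sum = λ i → sums (λ j → R j i) (λ j → X j i) (λ j → e j i) (column-sum O i) }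
  where
  gram : ∀ {X : Mat ℤ n} → (∀ i j → (X ⊡ X ᵗ) i j ≡ c * c * δℤ i j) → (R : Mat ℤ n) → (∀ i j → X i j ≡ c * R i j) →
    ∀ i j → (R ⊡ R ᵗ) i j ≡ + 1 * + 1 * δℤ i j
  gram {X} h R e i j = trans (*-cancelˡ c≢0 (*-cancelˡ c≢0 (begin
    c * (c * dot (R i) (R j)) ≡⟨ cong (c *_) (dot-*ʳ c (R i) (R j)) ⟨
    c * dot (R i) (λ k → c * R j k) ≡⟨ dot-*ˡ c (λ k → c * R j k) (R i) ⟨
    dot (λ k → c * R i k) (λ k → c * R j k) ≡⟨ dot-cong (λ k → sym (e i k)) (λ k → sym (e j k)) ⟩
    (X ⊡ X ᵗ) i j ≡⟨ h i j ⟩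
    c * c * δℤ i j ≡⟨ *-assoc c c _ ⟩
    c * (c * δℤ i j) ∎)))
    (solve 1 (λ d → d := con (+ 1) :* con (+ 1) :* d) refl (δℤ i j))
    where open ≡-Reasoning
  sums : ∀ (r x : Vector n) → (∀ k → x k ≡ c * r k) → dot x 1ᵛ ≡ c → dot r 1ᵛ ≡ + 1
  sums r x e h = *-cancelˡ c≢0 (trans (sym (dot-*ˡ c 1ᵛ r)) (trans (dot-cong (λ k → sym (e k)) (λ _ → refl))
      (trans h (sym (*-identityʳ c)))))

-- Rational numbers with a common denominator

ι : ℤ → ℚ
ι z = mkℚ z 0 (Coprimality.sym (1-coprimeTo ∣ z ∣))

-- `toℚ` normalises by a gcd that is stuck on variables; `ι` is the literal normal form on which the
-- operations of ℚ compute.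
toℚ-ι : ∀ z → toℚ z ≡ ι z
toℚ-ι z = ℚ.↥p/↧p≡p (ι z)

toℚ-+ : ∀ a b → toℚ (a + b) ≡ toℚ a ℚ.+ toℚ b
toℚ-+ a b = trans (cong toℚ (trans (+-def a b) (sym (cong₂ ℤ._+_ (ℤ.*-identityʳ a) (ℤ.*-identityʳ b))))) (sym
    (cong₂ ℚ._+_ (toℚ-ι a) (toℚ-ι b)))

toℚ-* : ∀ a b → toℚ (a * b) ≡ toℚ a ℚ.* toℚ b
toℚ-* a b = trans (cong toℚ (*-def a b)) (sym (cong₂ ℚ._*_ (toℚ-ι a) (toℚ-ι b)))

toℚ-injective : ∀ {a b} → toℚ a ≡ toℚ b → a ≡ b
toℚ-injective {a} {b} e = cong ↥_ (trans (sym (toℚ-ι a)) (trans e (toℚ-ι b)))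

-- A relation, since a / ν need not be in lowest terms. Sums and products are followed on numerators
-- over a fixed denominator, and an equation in ℚ becomes one cross-multiplied equation in ℤ.
record Fraction (ν : ℕ) (x : ℚ) (a : ℤ) : Set where
  constructor fraction
  field numerator : toℚ (+ ν) ℚ.* x ≡ toℚ a
open Fraction

fraction-/ : ∀ ν .{{_ : ℕ.NonZero ν}} a → Fraction ν (a ℚ./ ν) a
fraction-/ ν@(suc _) a = fraction (trans (cong (ℚ._* (a ℚ./ ν)) (toℚ-ι (+ ν))) (cross (a ℚ./ ν) (ℚ.↥-/ a ν)
    (ℚ.↧-/ a ν)))
  where
  cross : ∀ x {g} → ↥ x ℤ.* g ≡ a → ↧ x ℤ.* g ≡ + ν → ι (+ ν) ℚ.* x ≡ toℚ a
  cross x@(mkℚ n d _) {g} ng dg = ℚ.fromℚᵘ-cong {mkℚᵘ (+ ν ℤ.* n) (d ℕ.+ 0)} {mkℚᵘ a 0} (*≡* (begin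
    + ν ℤ.* n ℤ.* + 1 ≡⟨ ℤ.*-identityʳ _ ⟩
    + ν ℤ.* n ≡⟨ cong (ℤ._* n) dg ⟨
    + suc d ℤ.* g ℤ.* n ≡⟨ trans (ℤ.*-assoc (+ suc d) g n) (trans (ℤ.*-comm (+ suc d) _) (cong (ℤ._* + suc d) (trans
        (ℤ.*-comm g n) ng))) ⟩
    a ℤ.* + suc d ≡⟨ cong (λ z → a ℤ.* + suc z) (sym (ℕ.+-identityʳ d)) ⟩
    a ℤ.* + suc (d ℕ.+ 0) ∎))
    where open ≡-Reasoning

fraction-toℚ : ∀ a → Fraction 1 (toℚ a) a
fraction-toℚ a = fraction (trans (sym (toℚ-* (+ 1) a)) (cong toℚ (*-identityˡ a)))

fraction-* : ∀ {ν ν' x y a b} → Fraction ν x a → Fraction ν' y b → Fraction (ν ℕ.* ν') (x ℚ.* y) (a * b)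
fraction-* {ν} {ν'} {x} {y} {a} {b} (fraction p) (fraction q) = fraction (begin
  toℚ (+ (ν ℕ.* ν')) ℚ.* (x ℚ.* y) ≡⟨ cong (ℚ._* (x ℚ.* y)) (trans (cong toℚ (+-* ν ν')) (toℚ-* (+ ν) (+ ν'))) ⟩
  toℚ (+ ν) ℚ.* toℚ (+ ν') ℚ.* (x ℚ.* y) ≡⟨ ℚ.*-assoc (toℚ (+ ν)) (toℚ (+ ν')) _ ⟩
  toℚ (+ ν) ℚ.* (toℚ (+ ν') ℚ.* (x ℚ.* y)) ≡⟨ cong (toℚ (+ ν) ℚ.*_) (trans (sym (ℚ.*-assoc (toℚ (+ ν')) x y)) (trans
      (cong (ℚ._* y) (ℚ.*-comm (toℚ (+ ν')) x)) (ℚ.*-assoc x (toℚ (+ ν')) y))) ⟩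
  toℚ (+ ν) ℚ.* (x ℚ.* (toℚ (+ ν') ℚ.* y)) ≡⟨ ℚ.*-assoc (toℚ (+ ν)) x _ ⟨
  toℚ (+ ν) ℚ.* x ℚ.* (toℚ (+ ν') ℚ.* y) ≡⟨ cong₂ ℚ._*_ p q ⟩
  toℚ a ℚ.* toℚ b ≡⟨ toℚ-* a b ⟨
  toℚ (a * b) ∎)
  where open ≡-Reasoning

fraction-∑ : ∀ {n ν} {f : Fin n → ℚ} {g : Fin n → ℤ} → (∀ k → Fraction ν (f k) (g k)) → Fraction ν (sumℚ f) (∑ g)
fraction-∑ {zero}  {ν} {f} {g} h = fraction (trans (ℚ.*-zeroʳ (toℚ (+ ν))) (sym (cong toℚ (∑-empty g))))
fraction-∑ {suc n} {ν} {f} {g} h = fraction (trans (ℚ.*-distribˡ-+ (toℚ (+ ν)) (f zero) _)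
  (trans (cong₂ ℚ._+_ (numerator (h zero)) (numerator (fraction-∑ (h ∘ suc)))) (trans (sym (toℚ-+ _ _)) (cong toℚ
      (sym (∑-suc g))))))

fraction-≡ : ∀ {ν x a b} → a ≡ b → Fraction ν x a → Fraction ν x b
fraction-≡ refl f = f

toℚ-cancel : ∀ ν .{{_ : ℕ.NonZero ν}} {x y} → toℚ (+ ν) ℚ.* x ≡ toℚ (+ ν) ℚ.* y → x ≡ y
toℚ-cancel ν@(suc _) {x} {y} e = begin
  x ≡⟨ undo x ⟨
  ℚ.1/ ι (+ ν) ℚ.* (ι (+ ν) ℚ.* x) ≡⟨ cong (ℚ.1/ ι (+ ν) ℚ.*_) (trans (sym (cong (ℚ._* x) (toℚ-ι (+ ν)))) (trans e
      (cong (ℚ._* y) (toℚ-ι (+ ν))))) ⟩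
  ℚ.1/ ι (+ ν) ℚ.* (ι (+ ν) ℚ.* y) ≡⟨ undo y ⟩
  y ∎
  where
  open ≡-Reasoning
  undo : ∀ x → ℚ.1/ ι (+ ν) ℚ.* (ι (+ ν) ℚ.* x) ≡ x
  undo x = trans (sym (ℚ.*-assoc (ℚ.1/ ι (+ ν)) (ι (+ ν)) x)) (trans (cong (ℚ._* x) (ℚ.*-inverseˡ (ι (+ ν))))
      (ℚ.*-identityˡ x))

fraction-unique : ∀ {ν x y a} .{{_ : ℕ.NonZero ν}} → Fraction ν x a → Fraction ν y a → x ≡ y
fraction-unique {ν} (fraction p) (fraction q) = toℚ-cancel ν (trans p (sym q))

fraction-scale : ∀ {ν x a} κ → Fraction ν x a → Fraction (κ ℕ.* ν) x (+ κ * a)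
fraction-scale {ν} {x} {a} κ (fraction p) = fraction (trans (cong (ℚ._* x) (trans (cong toℚ (+-* κ ν)) (toℚ-* (+ κ)
    (+ ν))))
  (trans (ℚ.*-assoc (toℚ (+ κ)) (toℚ (+ ν)) x) (trans (cong (toℚ (+ κ) ℚ.*_) p) (sym (toℚ-* (+ κ) a)))))

fraction-cross : ∀ {ν ν' x y a b} .{{_ : ℕ.NonZero ν}} .{{_ : ℕ.NonZero ν'}} → Fraction ν x a → Fraction ν' y b →
    + ν' * a ≡ + ν * b → x ≡ y
fraction-cross {ν} {ν'} {x} {y} {a} p q e = fraction-unique {{ℕ.m*n≢0 ν' ν}} (fraction-scale ν' p)
  (subst (λ z → Fraction z y (+ ν' * a)) (ℕ.*-comm ν ν') (fraction-≡ (sym e) (fraction-scale ν q)))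

denominator-1⇒toℚ : ∀ x → ↧ₙ x ≡ 1 → x ≡ toℚ (↥ x)
denominator-1⇒toℚ x e = trans (sym (ℚ.↥p/↧p≡p x)) (ℚ./-cong {↥ x} refl e)

toℚ⇒denominator-1 : ∀ {x} z → x ≡ toℚ z → ↧ₙ x ≡ 1
toℚ⇒denominator-1 z e = cong ↧ₙ_ (trans e (toℚ-ι z))

_/ᴹ_ : ∀ {n} → Mat ℤ n → (ν : ℕ) → .{{_ : ℕ.NonZero ν}} → Mat ℚ n
(X /ᴹ ν) i j = X i j ℚ./ ν

module _ {n} (X : Mat ℤ n) (ν : ℕ) .{{nz : ℕ.NonZero ν}} where

  clears⇒integral : ∀ {c} → Clears (+ ν) X c → IsIntegral (scale c (X /ᴹ ν))
  clears⇒integral {c} cl i j with cl i j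
  ... | divides z e = toℚ⇒denominator-1 z (fraction-cross {1 ℕ.* ν} {1} {{ℕ.m*n≢0 1 ν}} (fraction-* (fraction-toℚ
      (+ c)) (fraction-/ ν (X i j))) (fraction-toℚ z)
    (trans (*-identityˡ _) (trans e (trans (*-comm z (+ ν)) (cong (λ w → + w * z) (sym (ℕ.*-identityˡ ν)))))))

  integral⇒clears : ∀ {c} → IsIntegral (scale c (X /ᴹ ν)) → Clears (+ ν) X c
  integral⇒clears {c} int i j = divides z (toℚ-injective (begin
    toℚ (+ c * X i j) ≡⟨ numerator f ⟨
    toℚ (+ (1 ℕ.* ν)) ℚ.* x ≡⟨ cong₂ (λ w y → toℚ (+ w) ℚ.* y) (ℕ.*-identityˡ ν) (denominator-1⇒toℚ x (int i j)) ⟩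
    toℚ (+ ν) ℚ.* toℚ z ≡⟨ toℚ-* (+ ν) z ⟨
    toℚ (+ ν * z) ≡⟨ cong toℚ (*-comm (+ ν) z) ⟩
    toℚ (z * + ν) ∎))
    where
    open ≡-Reasoning
    x = toℚ (+ c) ℚ.* (X i j ℚ./ ν)
    z = ↥ x
    f : Fraction (1 ℕ.* ν) x (+ c * X i j)
    f = fraction-* (fraction-toℚ (+ c)) (fraction-/ ν (X i j))

  hasLevel : (L : Level (+ ν) X) → HasLevel (X /ᴹ ν) (level L)
  hasLevel L = level>0 L , clears⇒integral (clears L) , λ k 0<k k<ℓ int →
    ℕ.<⇒≱ k<ℓ (ℕ.∣⇒≤ {{ℕ.>-nonZero 0<k}} (divides-clearing L k (integral⇒clears int)))

  permutation⇒level-1 : (L : Level (+ ν) X) → IsPermutationMatrix (X /ᴹ ν) → level L ≡ 1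
  permutation⇒level-1 L (σ , e) = ℕ.∣1⇒≡1 (divides-clearing L 1 (integral⇒clears (λ i j →
    toℚ⇒denominator-1 (δℤ (Inverse.to σ i) j) (trans (ℚ.*-identityˡ _) (trans (e i j) (δ-toℚ (Inverse.to σ i) j))))))
    where
    δ-toℚ : ∀ (i j : Fin n) → δℚ i j ≡ toℚ (δℤ i j)
    δ-toℚ i j with i Fin.≟ j
    ... | yes _ = refl
    ... | no _  = refl

  regOrth : ScaledOrthogonal X (+ ν) → RegOrth (X /ᴹ ν)
  regOrth O = (λ i → fraction-cross {ν} {1} (fraction-≡ (trans (∑-cong (λ j → sym (*-identityʳ (X i j))))
      (row-sum O i)) (fraction-∑ (λ j → fraction-/ ν (X i j)))) (fraction-toℚ (+ 1))
      (*-comm (+ 1) (+ ν)))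
    , λ i j → fraction-cross {ν ℕ.* ν} {1} {{ℕ.m*n≢0 ν ν}} (fraction-∑ (λ k → fraction-* (fraction-/ ν (X k i))
        (fraction-/ ν (X k j)))) (δ-fraction i j)
      (trans (*-identityˡ _) (trans (column-gram O i j) (cong (_* δℤ i j) (sym (+-* ν ν)))))
    where
    δ-fraction : ∀ (i j : Fin n) → Fraction 1 (δℚ i j) (δℤ i j)
    δ-fraction i j with i Fin.≟ j
    ... | yes _ = fraction-toℚ (+ 1)
    ... | no _  = fraction-toℚ (+ 0)

-- Oriented graphs as bounded skew matrices

skew-skew : ∀ {n} (G : OrientedGraph n) → Skew (skew G)
skew-skew G i j = cases (arc G i j) (arc G j i) refl refl
  where
  cases : ∀ a b → arc G i j ≡ a → arc G j i ≡ b → skew G i j ≡ - skew G j i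
  cases a b p q with arc G i j | arc G j i | asym G i j
  ... | true  | true  | h with () ← h refl
  ... | true  | false | _ = sym (neg-def -[1+ 0 ])
  ... | false | true  | _ = sym (neg-def (+ 1))
  ... | false | false | _ = sym (neg-def (+ 0))

skew-bounded : ∀ {n} (G : OrientedGraph n) → Bounded (skew G)
skew-bounded G i j with arc G i j | arc G j i
... | true  | _     = ℕ.≤-refl
... | false | true  = ℕ.≤-refl
... | false | false = ℕ.z≤n

skew-converse : ∀ {n} (G : OrientedGraph n) i j → skew (converse G) i j ≡ negate (skew G) i j
skew-converse G i j = skew-skew G j i

negate-skew : ∀ {n} {S : Mat ℤ n} → Skew S → Skew (negate S)
negate-skew sk i j = cong -_ (sk i j)

walks-negate : ∀ {n} {S : Mat ℤ n} → Skew S → ∀ k → walks S k ≡ walks (negate S) k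
walks-negate {S = S} sk k = trans (Gram.walks-sgn sk k) (sym (trans (dot-cong {x = 1ᵛ} (λ _ → refl)
    (walkVec-negate S k)) (dot-*ʳ (sgn k) 1ᵛ (walkVec S k))))

transfer-scaledOrthogonal : ∀ {n} {S S' : Mat ℤ n} {μ} (T : Transfer S S' μ) → ScaledOrthogonal (Transfer.B T) μ
transfer-scaledOrthogonal {μ = μ} T = record
  { row-gram = Transfer.BBᵗ T ; column-gram = Transfer.BᵗB T
  ; row-sum = λ i → trans (Transfer.B-walk T 0 i) (*-identityʳ μ)
  ; column-sum = λ i → trans (Transfer.Bᵗ-walk T 0 i) (*-identityʳ μ) }

prime-∤-2^ : ∀ {p} → Prime p → ¬ + p ∣ + 2 → ∀ k → ¬ + p ∣ + (2 ℕ.^ k)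
prime-∤-2^ pr odd zero    h = prime-∤1 pr h
prime-∤-2^ pr odd (suc k) h = prime-∤-2^ pr odd k (prime-cancel pr _ odd (subst (_ ∣_) (+-* 2 (2 ℕ.^ k)) h))

odd-prime : ∀ {p} {m} → Prime p → ¬ + 2 ∣ m → + p ∣ m → ¬ + p ∣ + 2
odd-prime {p} pr odd p∣m h = odd (subst (λ q → + q ∣ _) (p≡2 (ℕ.∣⇒≤ (∣⇒∣ℕ h))
    (ℕ.nonTrivial⇒n>1 p {{prime⇒nonTrivial pr}})) p∣m)
  where
  p≡2 : p ℕ.≤ 2 → 1 ℕ.< p → p ≡ 2
  p≡2 p≤2 1<p = ℕ.≤-antisym p≤2 1<p

-- The levels of Q, Q₀ and QᵀQ₀

module Assembly {k} {S S' : Mat ℤ (suc k)} (sk : Skew S) (m₀ : ℕ) {m}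
  (det-W : det′ (walkMatrix S) ≡ + (2 ℕ.^ m₀) * m) (odd : ¬ + 2 ∣ m) (squareFree : SquareFreeInt m)
  (T : Transfer S S' (+ ∣ m ∣)) (T₀ : Transfer S (negate S) (+ ∣ m ∣)) where

  private
    n M : ℕ
    n = suc k
    M = ∣ m ∣
    μ : ℤ
    μ = + M
    module T = Transfer T
    module T₀ = Transfer T₀
    u = walkVec S
    -- With `T.B` = μQᵀ and `T₀.B` = μQ₀ᵀ, this is μ²QᵀQ₀.
    C : Mat ℤ n
    C = T.B ⊡ T₀.B ᵗ

    μ≢0 : μ ≢ + 0
    μ≢0 e = odd-≢0 odd (ℤ.∣i∣≡0⇒i≡0 (ℤ.+-injective e))
    μμ≢0 : μ * μ ≢ + 0
    μμ≢0 e = μ≢0 (integral-domain e μ≢0)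

  instance
    M-nonZero : ℕ.NonZero M
    M-nonZero = ℕ.≢-nonZero (λ e → μ≢0 (cong +_ e))
    MM-nonZero : ℕ.NonZero (M ℕ.* M)
    MM-nonZero = ℕ.m*n≢0 M M

  private
    M>0 : 0 ℕ.< M
    M>0 = ℕ.>-nonZero⁻¹ M

    O : ScaledOrthogonal T.B μ
    O = transfer-scaledOrthogonal T
    O₀ : ScaledOrthogonal T₀.B μ
    O₀ = transfer-scaledOrthogonal T₀
    OC : ScaledOrthogonal C (μ * μ)
    OC = ⊡-scaledOrthogonal O (ᵗ-scaledOrthogonal O₀)

    L : Level μ (T.B ᵗ)
    L = level-exists μ (T.B ᵗ) M M>0 (λ i j → ∣-*ʳ _ ∣-refl)
    L₀ : Level μ (T₀.B ᵗ)
    L₀ = level-exists μ (T₀.B ᵗ) M M>0 (λ i j → ∣-*ʳ _ ∣-refl)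
    L₂ : Level (+ (M ℕ.* M)) C
    L₂ = level-exists (+ (M ℕ.* M)) C (M ℕ.* M) (ℕ.>-nonZero⁻¹ (M ℕ.* M)) (λ i j → ∣-*ʳ _ ∣-refl)

    p²∤m : ∀ {p} → Prime p → ¬ + p * + p ∣ m
    p²∤m {p} pr h = ℕ.<⇒≢ (ℕ.nonTrivial⇒n>1 p {{prime⇒nonTrivial pr}})
      (sym (squareFree p (subst (ℕ._∣ ∣ m ∣) (abs-* (+ p) (+ p)) (∣⇒∣ℕ h))))

    μ∣⇒m∣ : ∀ {d} → d ∣ μ → d ∣ m
    μ∣⇒m∣ h = ∣ℕ⇒∣ (∣⇒∣ℕ h)

    dependence : ∀ {p} → Prime p → + p ∣ m → ∃ λ h → Monic k h × ∀ i → + p ∣ comb< (suc k) h u i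
    dependence {p} pr p∣m = [ monic-relation S k , (λ D → ⊥-elim (dual-det pr (walkMatrix S) u (λ i j → refl) D
      (subst (+ p ∣_) (sym det-W) (∣-*ˡ _ p∣m)))) ]′ (dependent-or-dual pr u (suc k))

    prime-dichotomy : ∀ {p} → Prime p → + p ∣ μ → (∀ i j → + p ∣ T.B i j) ⊎ (∀ i j → + p * + p ∣ C i j)
    prime-dichotomy {p} pr p∣μ = from-relation (dependence pr p∣m)
      where
      p∣m : + p ∣ m
      p∣m = μ∣⇒m∣ p∣μ
      p-odd : ¬ + p ∣ + 2
      p-odd = odd-prime pr odd p∣m
      from-relation : (∃ λ h → Monic k h × ∀ i → + p ∣ comb< (suc k) h u i) → (∀ i j → + p ∣ T.B i j) ⊎ (∀ i j →
          + p * + p ∣ C i j)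
      from-relation (h , monic , rel) = OddPrime.dichotomy sk pr p-odd monic y y-eq p∤V p∣μ (λ d → p²∤m pr
          (μ∣⇒m∣ d)) T T₀
        where
        y : Vector n
        y i = _∣_.quotient (rel i)
        y-eq : ∀ i → comb< (suc k) h u i ≡ + p * y i
        y-eq i = trans (_∣_.equality (rel i)) (*-comm _ (+ p))
        p^1 : + (p ℕ.^ (suc k ℕ.∸ k)) ≡ + p
        p^1 = cong +_ (trans (cong (p ℕ.^_) (ℕ.m+n∸n≡m 1 k)) (ℕ.*-identityʳ p))
        -- The relation takes one factor p out of det W; a second one would have to divide m, since
        -- p is odd.
        p∤V : ¬ + p ∣ det′ (reduced S k y)
        p∤V d = p²∤m pr (prime-square-cancel pr m (prime-∤-2^ pr p-odd m₀) (subst (+ p * + p ∣_)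
          (trans (sym (trans (det′-reduced S k h y p monic (ℕ.n≤1+n k) y-eq) (cong (det′
              (reduced S k y) *_) p^1))) det-W)
          (∣-* d ∣-refl)))

    -- Put q = |m| / p, which is prime to p. If p divides B, then q clears Q; if p² divides C, then
    -- q² clears QᵀQ₀. Either way p does not divide that level.
    not-both : ∀ {p} → Prime p → p ℕ.∣ level L → p ℕ.∣ level L₂ → ⊥
    not-both {p} pr p∣ℓ p∣ℓ₂ = contradiction (∣ℕ⇒∣ {+ p} {μ} (ℕ.∣-trans p∣ℓ (divides-clearing L M (λ i j →
        ∣-*ʳ _ ∣-refl))))
      where
      contradiction : + p ∣ μ → ⊥
      contradiction p∣μ = [ one-integral , other-integral ]′ (prime-dichotomy pr p∣μ)
        where
        q : ℕ
        q = ℕ.quotient (∣⇒∣ℕ p∣μ)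
        μ-eq : μ ≡ + q * + p
        μ-eq = trans (cong +_ (ℕ._∣_.equality (∣⇒∣ℕ p∣μ))) (+-* q p)
        p∤q : ¬ + p ∣ + q
        p∤q d = p²∤m pr (μ∣⇒m∣ (subst (+ p * + p ∣_) (sym μ-eq) (∣-* d ∣-refl)))
        one-integral : (∀ i j → + p ∣ T.B i j) → ⊥
        one-integral h = p∤q (∣ℕ⇒∣ (ℕ.∣-trans p∣ℓ (divides-clearing L q (λ i j →
          subst (_∣ + q * T.B j i) (sym μ-eq) (∣-* ∣-refl (h j i))))))
        other-integral : (∀ i j → + p * + p ∣ C i j) → ⊥
        other-integral h = [ p∤q , p∤q ]′ (prime-∣-* pr (+ q) (+ q) (subst (+ p ∣_) (+-* q q)
          (∣ℕ⇒∣ (ℕ.∣-trans p∣ℓ₂ (divides-clearing L₂ (q ℕ.* q) (λ i j →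
            subst₂ _∣_ (trans (solve 2 (λ p q → q :* q :* (p :* p) := (q :* p) :* (q :* p)) refl (+ p) (+ q)) (trans
                (sym (cong₂ _*_ μ-eq μ-eq)) (sym (+-* M M))))
              (cong (_* C i j) (sym (+-* q q))) (∣-* ∣-refl (h i j))))))))

    coprime : Coprime (level L) (level L₂)
    coprime = no-common-prime⇒coprime (level>0 L) not-both

    -- Q = Q₀Q₂ᵀ and Q₂ = QᵀQ₀ bound each level by the product of the two others.
    ℓ∣ℓ₂ℓ₀ : level L ℕ.∣ level L₂ ℕ.* level L₀
    ℓ∣ℓ₂ℓ₀ = divides-clearing L _ (λ i j → ∣-cancelˡ μμ≢0 (subst₂ _∣_ (cong (_* μ) (+-* M M)) (expand i j)
      (∑-∣ (λ l → ∣-* (clears L₂ j l) (clears L₀ i l)))))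
      where
      open ≡-Reasoning
      ℓ₀ = + level L₀
      ℓ₂ = + level L₂
      expand : ∀ i j → ∑ (λ l → ℓ₂ * C j l * (ℓ₀ * T₀.B l i)) ≡ μ * μ * (+ (level L₂ ℕ.* level L₀) * T.B j i)
      expand i j = begin
        ∑ (λ l → ℓ₂ * C j l * (ℓ₀ * T₀.B l i))
          ≡⟨ ∑-cong (λ l → solve 4 (λ a c b d → a :* c :* (b :* d) := a :* b :* (c :* d)) refl ℓ₂ (C j l) ℓ₀
              (T₀.B l i)) ⟩
        ∑ (λ l → ℓ₂ * ℓ₀ * (C j l * T₀.B l i)) ≡⟨ ∑-*ˡ (ℓ₂ * ℓ₀) (λ l → C j l * T₀.B l i) ⟩
        ℓ₂ * ℓ₀ * (C ⊡ T₀.B) j i ≡⟨ cong (ℓ₂ * ℓ₀ *_) (⊡-assoc T.B (T₀.B ᵗ) T₀.B j i) ⟩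
        ℓ₂ * ℓ₀ * (T.B ⊡ (T₀.B ᵗ ⊡ T₀.B)) j i ≡⟨ cong (ℓ₂ * ℓ₀ *_) (trans (⊡-cong {A = T.B} (λ _ _ →
            refl) T₀.BᵗB j i) (⊡-scalar (μ * μ) T.B j i)) ⟩
        ℓ₂ * ℓ₀ * (μ * μ * T.B j i) ≡⟨ solve 3 (λ a b c → a :* (b :* c) := b :* (a :* c)) refl (ℓ₂ * ℓ₀) (μ * μ)
            (T.B j i) ⟩
        μ * μ * (ℓ₂ * ℓ₀ * T.B j i) ≡⟨ cong (λ z → μ * μ * (z * T.B j i)) (+-* (level L₂) (level L₀)) ⟨
        μ * μ * (+ (level L₂ ℕ.* level L₀) * T.B j i) ∎

    ℓ₂∣ℓℓ₀ : level L₂ ℕ.∣ level L ℕ.* level L₀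
    ℓ₂∣ℓℓ₀ = divides-clearing L₂ _ (λ i j → subst₂ _∣_ (sym (+-* M M)) (trans (∑-cong (λ l →
        solve 4 (λ a c b d → a :* c :* (b :* d) := a :* b :* (c :* d)) refl (+ level L) (T.B i l) (+ level L₀)
            (T₀.B j l)))
        (trans (∑-*ˡ _ _) (cong (_* C i j) (sym (+-* (level L) (level L₀))))))
      (∑-∣ (λ l → ∣-* (clears L l i) (clears L₀ l j))))

    ℓ∣ℓ₀ : level L ℕ.∣ level L₀
    ℓ∣ℓ₀ = coprime-divisor coprime ℓ∣ℓ₂ℓ₀

    ℓ₂∣ℓ₀ : level L₂ ℕ.∣ level L₀
    ℓ₂∣ℓ₀ = coprime-divisor (Coprimality.sym coprime) ℓ₂∣ℓℓ₀

    -- If a were the whole level of Q₀, then b would divide a, and coprimality would give b = 1.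
    smaller : ∀ {a b} → Coprime a b → b ≢ 1 → a ℕ.∣ level L₀ → b ℕ.∣ level L₀ → a ℕ.< level L₀
    smaller {a} {b} c b≢1 a∣ b∣ = ℕ.≤∧≢⇒< (ℕ.∣⇒≤ {{ℕ.>-nonZero (level>0 L₀)}} a∣)
      (λ a≡ → b≢1 (c (subst (b ℕ.∣_) (sym a≡) b∣ , ℕ.∣-refl)))

  Q Q₀ Q₂ : Mat ℚ n
  Q = (T.B ᵗ) /ᴹ M
  Q₀ = (T₀.B ᵗ) /ᴹ M
  Q₂ = C /ᴹ (M ℕ.* M)

  Q₀-regOrth : RegOrth Q₀
  Q₀-regOrth = regOrth (T₀.B ᵗ) M (ᵗ-scaledOrthogonal O₀)

  private
    OC' : ScaledOrthogonal C (+ (M ℕ.* M))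
    OC' = subst (ScaledOrthogonal C) (sym (+-* M M)) OC

    product : ∀ i j → (T.B ᵗ ⊡ C) i j ≡ μ * μ * T₀.B j i
    product i j = trans (sym (⊡-assoc (T.B ᵗ) T.B (T₀.B ᵗ) i j))
      (trans (⊡-cong {B = T₀.B ᵗ} T.BᵗB (λ _ _ → refl) i j) (scalar-⊡ (μ * μ) (T₀.B ᵗ) i j))

    factorization : ∀ i j → Q₀ i j ≡ (Q · Q₂) i j
    factorization i j = fraction-cross {M} {M ℕ.* (M ℕ.* M)} {{M-nonZero}} {{ℕ.m*n≢0 M (M ℕ.* M)}} (fraction-/ M
        (T₀.B j i))
      (fraction-∑ (λ l → fraction-* (fraction-/ M (T.B l i)) (fraction-/ (M ℕ.* M) (C l j))))
      (trans (cong (_* T₀.B j i) (trans (+-* M (M ℕ.* M)) (cong (μ *_) (+-* M M)))) (trans (*-assoc μ (μ * μ) _)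
          (cong (μ *_) (sym (product i j)))))

  factorable : level L ≢ 1 → level L₂ ≢ 1 → Factorable Q₀
  factorable ℓ≢1 ℓ₂≢1 = level L₀ , hasLevel (T₀.B ᵗ) M L₀ , Q , Q₂ , level L , level L₂ ,
    regOrth (T.B ᵗ) M (ᵗ-scaledOrthogonal O) , regOrth C (M ℕ.* M) OC' ,
    hasLevel (T.B ᵗ) M L , hasLevel C (M ℕ.* M) L₂ ,
    smaller coprime ℓ₂≢1 ℓ∣ℓ₀ ℓ₂∣ℓ₀ , smaller (Coprimality.sym coprime) ℓ≢1 ℓ₂∣ℓ₀ ℓ∣ℓ₀ ,
    (λ perm → ℓ≢1 (permutation⇒level-1 (T.B ᵗ) M L perm)) , (λ perm → ℓ₂≢1 (permutation⇒level-1 C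
        (M ℕ.* M) L₂ perm)) ,
    factorization

  conjugates : ∀ i j → (transpose Q₀ · ((λ i j → toℚ (S i j)) · Q₀)) i j ≡ toℚ (negate S i j)
  conjugates i j = fraction-cross {M ℕ.* (1 ℕ.* M)} {1} {{ℕ.m*n≢0 M (1 ℕ.* M) {{M-nonZero}} {{ℕ.m*n≢0 1 M}}}}
    (fraction-∑ (λ l → fraction-* (fraction-/ M (T₀.B i l)) (fraction-∑ (λ r → fraction-* (fraction-toℚ (S l r))
        (fraction-/ M (T₀.B j r))))))
    (fraction-toℚ (negate S i j))
    (trans (*-identityˡ _) (begin
      (T₀.B ⊡ (S ⊡ T₀.B ᵗ)) i j ≡⟨ ⊡-assoc T₀.B S (T₀.B ᵗ) i j ⟨
      ((T₀.B ⊡ S) ⊡ T₀.B ᵗ) i j ≡⟨ ⊡-cong {B = T₀.B ᵗ} T₀.intertwines (λ _ _ → refl) i j ⟩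
      ((negate S ⊡ T₀.B) ⊡ T₀.B ᵗ) i j ≡⟨ ⊡-assoc (negate S) T₀.B (T₀.B ᵗ) i j ⟩
      (negate S ⊡ (T₀.B ⊡ T₀.B ᵗ)) i j ≡⟨ trans (⊡-cong {A = negate S} (λ _ _ → refl) T₀.BBᵗ i j) (⊡-scalar (μ * μ)
          (negate S) i j) ⟩
      μ * μ * negate S i j ≡⟨ cong (_* negate S i j) (trans (cong (μ *_) (cong +_ (sym (ℕ.*-identityˡ M)))) (sym
          (+-* M (1 ℕ.* M)))) ⟩
      + (M ℕ.* (1 ℕ.* M)) * negate S i j ∎))
    where open ≡-Reasoning

  private
    permutation-of-level-1 : ∀ {X R R' : Mat ℤ n} {c} → c ≢ + 0 → ScaledOrthogonal X c → (∀ i j → c ∣ X i j) →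
        (∀ i j → (X ⊡ R) i j ≡ (R' ⊡ X) i j) →
      Σ (Fin n ↔ Fin n) λ σ → ∀ i j → R (Inverse.to σ i) (Inverse.to σ j) ≡ R' i j
    permutation-of-level-1 {X} {R} {R'} {c} c≢0 OX c∣X XR = permutation (divide-scaledOrthogonal c≢0 OX P X-eq)
        (λ i j → *-cancelˡ c≢0 (begin
        c * (P ⊡ R) i j ≡⟨ dot-*ˡ c (λ l → R l j) (P i) ⟨
        dot (λ l → c * P i l) (λ l → R l j) ≡⟨ dot-cong (λ l → sym (X-eq i l)) (λ _ → refl) ⟩
        (X ⊡ R) i j ≡⟨ XR i j ⟩
        (R' ⊡ X) i j ≡⟨ dot-cong {x = R' i} (λ _ → refl) (λ l → X-eq l j) ⟩
        dot (R' i) (λ l → c * P l j) ≡⟨ dot-*ʳ c (R' i) (λ l → P l j) ⟩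
        c * (R' ⊡ P) i j ∎))
      where
      open ≡-Reasoning
      P : Mat ℤ n
      P i j = _∣_.quotient (c∣X i j)
      X-eq : ∀ i j → X i j ≡ c * P i j
      X-eq i j = trans (_∣_.equality (c∣X i j)) (*-comm _ c)

    C-intertwines : ∀ i j → (C ⊡ negate S) i j ≡ (S' ⊡ C) i j
    C-intertwines i j = begin
      ((T.B ⊡ T₀.B ᵗ) ⊡ negate S) i j ≡⟨ ⊡-assoc T.B (T₀.B ᵗ) (negate S) i j ⟩
      (T.B ⊡ (T₀.B ᵗ ⊡ negate S)) i j ≡⟨ ⊡-cong {A = T.B} (λ _ _ → refl) transposed i j ⟩
      (T.B ⊡ (S ⊡ T₀.B ᵗ)) i j ≡⟨ ⊡-assoc T.B S (T₀.B ᵗ) i j ⟨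
      ((T.B ⊡ S) ⊡ T₀.B ᵗ) i j ≡⟨ ⊡-cong {B = T₀.B ᵗ} T.intertwines (λ _ _ → refl) i j ⟩
      ((S' ⊡ T.B) ⊡ T₀.B ᵗ) i j ≡⟨ ⊡-assoc S' T.B (T₀.B ᵗ) i j ⟩
      (S' ⊡ C) i j ∎
      where
      open ≡-Reasoning
      -- The transpose of the intertwining relation for `T₀.B`, with the signs from the skewness of
      -- S.
      transposed : ∀ i j → (T₀.B ᵗ ⊡ negate S) i j ≡ (S ⊡ T₀.B ᵗ) i j
      transposed i j = begin
        dot (λ l → T₀.B l i) (λ l → - S l j) ≡⟨ dot-cong {x = λ l → T₀.B l i} (λ _ → refl) (λ l → sym (sk j l)) ⟩
        dot (λ l → T₀.B l i) (S j) ≡⟨ dot-comm (λ l → T₀.B l i) (S j) ⟩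
        (S ⊡ T₀.B) j i ≡⟨ solve 1 (λ a → a := :- (:- a)) refl _ ⟩
        - - (S ⊡ T₀.B) j i ≡⟨ cong -_ (negate-▹ S (λ l → T₀.B l i) j) ⟨
        - (negate S ⊡ T₀.B) j i ≡⟨ cong -_ (T₀.intertwines j i) ⟨
        - dot (T₀.B j) (λ l → S l i) ≡⟨ trans (∑-cong (λ l → solve 2 (λ a b → a :* (:- b) := :- (a :* b)) refl
            (T₀.B j l) (S l i))) (∑-neg _) ⟨
        dot (T₀.B j) (λ l → - S l i) ≡⟨ dot-cong {x = T₀.B j} (λ _ → refl) (λ l → sym (sk i l)) ⟩
        dot (T₀.B j) (S i) ≡⟨ dot-comm (T₀.B j) (S i) ⟩
        dot (S i) (T₀.B j) ∎

    integral-at-1 : ∀ {ν} {X : Mat ℤ n} (L : Level ν X) → level L ≡ 1 → ∀ i j → ν ∣ X i j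
    integral-at-1 {ν} {X} L e i j = subst (ν ∣_) (trans (cong (λ z → + z * X i j) e) (*-identityˡ _)) (clears L i j)

  isomorphic : level L ≡ 1 → Σ (Fin n ↔ Fin n) λ σ → ∀ i j → S (Inverse.to σ i) (Inverse.to σ j) ≡ S' i j
  isomorphic e = permutation-of-level-1 {T.B} {S} {S'} {μ} μ≢0 O (λ i j → integral-at-1 L e j i) T.intertwines

  isomorphic-converse : level L₂ ≡ 1 → Σ (Fin n ↔ Fin n) λ σ → ∀ i j → negate S (Inverse.to σ i)
      (Inverse.to σ j) ≡ S' i j
  isomorphic-converse e = permutation-of-level-1 {C} {negate S} {S'} {μ * μ} μμ≢0 OC
    (λ i j → subst (_∣ C i j) (+-* M M) (integral-at-1 L₂ e i j)) C-intertwines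

  conclusion : ¬ Factorable Q₀ →
    (Σ (Fin n ↔ Fin n) λ σ → ∀ i j → S (Inverse.to σ i) (Inverse.to σ j) ≡ S' i j) ⊎
    (Σ (Fin n ↔ Fin n) λ σ → ∀ i j → negate S (Inverse.to σ i) (Inverse.to σ j) ≡ S' i j)
  conclusion nf with level L ℕ.≟ 1 | level L₂ ℕ.≟ 1
  ... | yes e | _      = inj₁ (isomorphic e)
  ... | no _  | yes e  = inj₂ (isomorphic-converse e)
  ... | no a  | no b   = ⊥-elim (nf (factorable a b))

theorem5p1 : (n : ℕ) (Σ' : OrientedGraph n) → InG Σ' →
    ((Q₀ : Mat ℚ n) → RegOrth Q₀ → ConjToConverse Σ' Q₀ → ¬ Factorable Q₀) →
    WDGSS Σ'
-- The empty graph is separate because the analysis at odd primes is indexed by k = n - 1.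
theorem5p1 zero Σ' _ _ Δ _ = inj₁ (mk↔ₛ′ (λ i → i) (λ i → i) (λ _ → refl) (λ _ → refl) , λ ())
theorem5p1 n@(suc k) Σ' (m , det-walk , oddInt , squareFree) notFactorable Δ (spectrum , cospectrum) =
  [ inj₁ , (λ { (σ , e) → inj₂ (σ , λ i j → trans (skew-converse Σ' _ _) (e i j)) }) ]′
    -- The assumption on Q₀ is applied to the matrix constructed from `T₀`, after checking that it
    -- conjugates S to the matrix of the converse.
    (A.conclusion (notFactorable A.Q₀ A.Q₀-regOrth (λ i j → trans (A.conjugates i j) (cong toℚ (sym
        (skew-converse Σ' i j))))))
  where
  S S' : Mat ℤ n
  S = skew Σ'
  S' = skew Δ
  H : Halved n
  H = halved n
  odd : ¬ + 2 ∣ m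
  odd d = oddInt (∣⇒∣ℕ d)
  det-W : det′ (walkMatrix S) ≡ + (2 ℕ.^ Halved.m₀ H) * m
  det-W = trans (det′-def _) (trans det-walk (trans (cong (λ z → + (2 ℕ.^ z) ℤ.* m) (Halved.half H)) (sym
      (*-def _ m))))
  T : Transfer S S' (+ ∣ m ∣)
  T = transfer H (skew-skew Σ') (skew-skew Δ)
    (walks-equal (skew-skew Σ') (skew-skew Δ) (skew-bounded Σ') (skew-bounded Δ) spectrum cospectrum) det-W odd
  T₀ : Transfer S (negate S) (+ ∣ m ∣)
  T₀ = transfer H (skew-skew Σ') (negate-skew (skew-skew Σ')) (walks-negate (skew-skew Σ')) det-W odd
  module A = Assembly (skew-skew Σ') (Halved.m₀ H) det-W odd squareFree T T₀
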